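{- Let $(G,\sigma)$ be a 2-edge-connected cubic signed graph. If $(G,\sigma)$ is flow-admissible, then $\mathrm{scc}(G,\sigma)\le \frac{26}{9}|E(G)|$.
   Context: A signed graph $(G,\sigma)$ is a graph $G$ with a map $\sigma:E(G)\to\{ -1,+1\}$; an edge $e$ is positive if $\sigma(e)=1$ and negative if $\sigma(e)=-1$. A cycle is a connected 2-regular subgraph; it is positive if it contains an even number of negative edges and negative otherwise. A barbell is a pair of edge-disjoint negative cycles joined by a path (possibly of length zero, i.e. the cycles may share a vertex). A circuit of $(G,\sigma)$ is a positive cycle or a barbell. A circuit cover is a family of circuits whose union contains every edge of $G$; its length is $\sum_{C}|E(C)|$ over the circuits of the family (counted with multiplicity). $\mathrm{scc}(G,\sigma)$ is the minimum length of a circuit cover of $(G,\sigma)$. Flows on signed graphs: each edge is split into two half-edges, each given a direction (toward or away from its end vertex), such that for a positive edge one half-edge points toward its end and the other away, while for a negative edge both half-edges point toward their ends or both point away. An integer flow is a map $f:E(G)\to\mathbb{Z}$ such that at every vertex the sum of $f$ over incident half-edges directed into the vertex equals the sum over incident half-edges directed out of it. $(G,\sigma)$ is flow-admissible if it admits a nowhere-zero integer flow (i.e. $f(e)\neq 0$ for all $e$). -}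

module Defs where

open import Data.Nat using (ℕ; zero; suc; _+_; _*_; _≤_)
open import Data.Integer using (ℤ) renaming (_+_ to _+ℤ_; 0ℤ to 0ℤ)
open import Data.Fin using (Fin; zero; suc; _≟_)
open import Data.Bool using (Bool; true; false; if_then_else_; _∨_; not; _∧_)
open import Data.Product using (Σ; ∃; _×_; _,_; proj₁; proj₂)
open import Data.Sum using (_⊎_)
open import Data.List using (List; map)
open import Data.Nat.ListAction using (sum)
open import Data.List.Relation.Unary.All using (All)
open import Data.List.Relation.Unary.Any using (Any)
open import Relation.Binary.PropositionalEquality using (_≡_)
open import Relation.Nullary using (¬_)
open import Relation.Nullary.Decidable using (⌊_⌋)
open import Data.Nat.Base using (_%_)

-- A finite graph (multigraph; parallel edges and loops allowed) with
-- vertex set Fin n and edge set Fin m; edge e has ends (proj₁ (ends e), proj₂ (ends e)).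
record Graph : Set where
  field
    n    : ℕ
    m    : ℕ
    ends : Fin m → Fin n × Fin n

data Sign : Set where
  positive negative : Sign

∑ : {k : ℕ} → (Fin k → ℕ) → ℕ
∑ {zero}  f = 0
∑ {suc k} f = f zero + ∑ (λ i → f (suc i))

∑ℤ : {k : ℕ} → (Fin k → ℤ) → ℤ
∑ℤ {zero}  f = 0ℤ
∑ℤ {suc k} f = f zero +ℤ ∑ℤ (λ i → f (suc i))

EdgeSet : ℕ → Set
EdgeSet m = Fin m → Bool

module _ (G : Graph) where
  open Graph G

  src tgt : Fin m → Fin n
  src e = proj₁ (ends e)
  tgt e = proj₂ (ends e)

  size : EdgeSet m → ℕ
  size S = ∑ (λ e → if S e then 1 else 0)

  -- degree of v in the subgraph with edge set S (a loop counts twice)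
  deg : EdgeSet m → Fin n → ℕ
  deg S v = ∑ (λ e → if S e then
                        (if ⌊ src e ≟ v ⌋ then 1 else 0) + (if ⌊ tgt e ≟ v ⌋ then 1 else 0)
                      else 0)

  allEdges : EdgeSet m
  allEdges _ = true

  _∈V_ : Fin n → EdgeSet m → Set
  v ∈V S = ¬ (deg S v ≡ 0)

  data Conn (A : EdgeSet m) : Fin n → Fin n → Set where
    here  : ∀ {u} → Conn A u u
    fwd   : ∀ {u} e → A e ≡ true → Conn A u (src e) → Conn A u (tgt e)
    bwd   : ∀ {u} e → A e ≡ true → Conn A u (tgt e) → Conn A u (src e)

  Connected : Set
  Connected = ∀ u v → Conn allEdges u v

  TwoEdgeConnected : Set
  TwoEdgeConnected =
    Connected × (∀ (e : Fin m) u v → Conn (λ e′ → not ⌊ e′ ≟ e ⌋) u v)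

  Cubic : Set
  Cubic = ∀ v → deg allEdges v ≡ 3

  module _ (σ : Fin m → Sign) where

    -- direction of a half-edge: toward its end vertex or away from it
    data Dir : Set where
      toward away : Dir

    flipDir : Dir → Dir
    flipDir toward = away
    flipDir away   = toward

    -- an orientation is given by the direction of the half-edge at the first end;
    -- the half-edge at the second end is then determined by the sign:
    -- positive edge: opposite directions; negative edge: same direction.
    Orientation : Set
    Orientation = Fin m → Dir

    dir₂ : Orientation → Fin m → Dir
    dir₂ τ e with σ e
    ... | positive = flipDir (τ e)
    ... | negative = τ e

    isToward : Dir → Bool
    isToward toward = true
    isToward away   = false

    inflow : Orientation → (Fin m → ℤ) → Fin n → ℤ
    inflow τ f v = ∑ℤ (λ e →
        (if ⌊ src e ≟ v ⌋ ∧ isToward (τ e) then f e else 0ℤ)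
        +ℤ (if ⌊ tgt e ≟ v ⌋ ∧ isToward (dir₂ τ e) then f e else 0ℤ))

    outflow : Orientation → (Fin m → ℤ) → Fin n → ℤ
    outflow τ f v = ∑ℤ (λ e →
        (if ⌊ src e ≟ v ⌋ ∧ not (isToward (τ e)) then f e else 0ℤ)
        +ℤ (if ⌊ tgt e ≟ v ⌋ ∧ not (isToward (dir₂ τ e)) then f e else 0ℤ))

    IsFlow : Orientation → (Fin m → ℤ) → Set
    IsFlow τ f = ∀ v → inflow τ f v ≡ outflow τ f v

    FlowAdmissible : Set
    FlowAdmissible = Σ Orientation λ τ → Σ (Fin m → ℤ) λ f →
      IsFlow τ f × (∀ e → ¬ (f e ≡ 0ℤ))

    isNeg : Fin m → Bool
    isNeg e with σ e
    ... | positive = false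
    ... | negative = true

    negCount : EdgeSet m → ℕ
    negCount S = ∑ (λ e → if S e ∧ isNeg e then 1 else 0)

    IsCycle : EdgeSet m → Set
    IsCycle S = (∃ λ e → S e ≡ true)
              × (∀ v → deg S v ≡ 0 ⊎ deg S v ≡ 2)
              × (∀ u v → u ∈V S → v ∈V S → Conn S u v)

    PositiveCycle : EdgeSet m → Set
    PositiveCycle S = IsCycle S × negCount S % 2 ≡ 0

    NegativeCycle : EdgeSet m → Set
    NegativeCycle S = IsCycle S × negCount S % 2 ≡ 1

    IsPath : EdgeSet m → Fin n → Fin n → Set
    IsPath P u v = ¬ (u ≡ v)
                 × (∃ λ e → P e ≡ true)
                 × deg P u ≡ 1 × deg P v ≡ 1
                 × (∀ w → ¬ (w ≡ u) → ¬ (w ≡ v) → deg P w ≡ 0 ⊎ deg P w ≡ 2)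
                 × (∀ x y → x ∈V P → y ∈V P → Conn P x y)

    Disjoint : EdgeSet m → EdgeSet m → Set
    Disjoint A B = ∀ e → A e ∧ B e ≡ false

    IsBarbell : EdgeSet m → Set
    IsBarbell S = Σ (EdgeSet m) λ C₁ → Σ (EdgeSet m) λ C₂ → Σ (EdgeSet m) λ P →
      NegativeCycle C₁ × NegativeCycle C₂ × Disjoint C₁ C₂
      × (∀ e → S e ≡ (C₁ e ∨ C₂ e ∨ P e))
      × ( ( (∀ e → P e ≡ false)
          × Σ (Fin n) λ u → u ∈V C₁ × u ∈V C₂
              × (∀ w → w ∈V C₁ → w ∈V C₂ → w ≡ u))
        ⊎ Σ (Fin n) λ u → Σ (Fin n) λ v →
            IsPath P u v × u ∈V C₁ × v ∈V C₂
            × (∀ w → w ∈V C₁ → ¬ (w ∈V C₂))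
            × (∀ w → w ∈V P → w ∈V C₁ → w ≡ u)
            × (∀ w → w ∈V P → w ∈V C₂ → w ≡ v))

    IsCircuit : EdgeSet m → Set
    IsCircuit S = PositiveCycle S ⊎ IsBarbell S

    IsCircuitCover : List (EdgeSet m) → Set
    IsCircuitCover 𝓒 = All IsCircuit 𝓒 × (∀ e → Any (λ C → C e ≡ true) 𝓒)

    coverLength : List (EdgeSet m) → ℕ
    coverLength 𝓒 = sum (map size 𝓒)

{-# OPTIONS --safe #-}
-- Replace the signature by an equivalent one with as few negative edges as possible; let N be its set
-- of negative edges, H the rest and H₀ the union of the cycles of H.  All cycles of H are positive, and
-- by minimality every bridge of H forms a 2-edge cut with an edge of N.  The 8-flow theorem covers H₀ by
-- three even sets of total size at most 12/7 |H₀|, and averaging over their span lets every even set and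
-- every join be moved so that it uses at most half of H₀.
--
-- It remains to cover an even set W ⊇ N of about half the edges.  W is a disjoint union of cycles; its
-- positive cycles are circuits, and an even number of negative ones is joined up by barbells along a join
-- of one root per cycle, again about half the edges.  With an odd number of negative cycles one of them is
-- used twice, which is cheap because balls in a 2-edge-connected cubic graph grow by two vertices per
-- step.  This fails only for a single negative cycle C.  If some negative cycle avoids C, both form a
-- barbell.  Otherwise all negative cycles meet C; then take a circuit D through an edge e₀ of N, cover
-- N − e₀ by an even set whose negative cycles are joined along C, and replace D by one of the barbells so
-- obtained as long as that is shorter.
module Submission where

open import Defs
open import Data.Nat using (ℕ; zero; suc; _+_; _*_; _∸_; _≤_; _<_; z≤n; s≤s; s≤s⁻¹; _≤?_; _<?_; _≤ᵇ_; _≡ᵇ_; _%_; _/_)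
open import Data.Nat.Properties hiding (_≟_)
open import Data.Nat.DivMod using (m≡m%n+[m/n]*n; m%n<n; m/n*n≤m)
open import Data.Nat.Tactic.RingSolver using (solve-∀)
open import Data.Integer using (ℤ; 0ℤ; -_) renaming (_+_ to _+ℤ_; +_ to ℤ⁺; -[1+_] to ℤ⁻)
import Data.Integer.Properties as ℤ
open import Data.Fin using (Fin; zero; suc; _≟_)
open import Data.Fin.Properties using (any?; all?)
open import Data.Bool using (Bool; true; false; if_then_else_; _∨_; _∧_; not; _xor_; T)
open import Data.Bool.Properties using (xor-same; xor-comm; xor-assoc; xor-identityʳ; ∧-distribˡ-xor; ∧-distribʳ-xor; ∧-comm; ∧-assoc; ∧-zeroʳ; ∧-identityʳ; ∨-zeroʳ; ∨-identityʳ; not-involutive) renaming (_≟_ to _≟ᵇ_)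
open import Data.Product using (Σ; ∃; _×_; _,_; proj₁; proj₂)
open import Data.Sum using (_⊎_; inj₁; inj₂; [_,_]′)
open import Data.Empty using (⊥; ⊥-elim)
open import Data.Unit using (⊤; tt)
open import Data.List using (List; []; _∷_; _++_; length; map; lookup)
open import Data.List.Relation.Unary.Any.Properties using (++⁺ˡ; ++⁺ʳ)
open import Data.List.Relation.Unary.All.Properties using (++⁺)
open import Data.List.Properties using (map-++)
open import Data.Nat.ListAction.Properties using (sum-++)
open import Data.List.Relation.Unary.All using (All; []; _∷_)
open import Data.List.Relation.Unary.Any using (Any; here; there)
open import Data.List.Relation.Unary.AllPairs using (AllPairs; []; _∷_)
open import Data.Nat.ListAction using (sum)
open import Function using (_∘_; id)
open import Relation.Nullary using (¬_; Dec; yes; no)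
open import Relation.Nullary.Decidable using (⌊_⌋; map′; _×-dec_; _⊎-dec_; ¬?)
open import Relation.Binary.PropositionalEquality

-- The constant is nearly forced by the cases counted in `budget-paths`. Besides the cover of `H₀`
-- they cost half of `H₀`, the edges outside `H₀`, and about n = 2m/3 more for paths and repeated
-- cycles. So an edge of `H₀` costs 12/7 + 1/2 + 2/3 = 121/42, only 1/126 below 26/9.
--
-- Additive constants are charged to the edges outside `H₀`. If the number of negative cycles is
-- odd, so is |N|, and |N| = 1 is impossible: after switching, the conservation laws of a flow sum
-- to plus or minus twice the value of the only negative edge. Hence there are at least three such
-- edges.
--
-- Even subsets of `H₀` avoid `N` and are positive. Adding one changes neither the trace of a set on
-- `N` nor its parity, so averaging is compatible with prescribing the trace.
--
-- The 8-flow theorem is obtained by Seymour's method for 6-flows with F₂² in place of F₃, so that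
-- everything happens modulo 2. Accordingly paths become joins, edge sets with prescribed odd
-- vertices, concatenated by symmetric difference; genuine paths appear only inside barbells.

allB : (Bool → Bool) → Bool
allB p = p true ∧ p false

allB-sound : ∀ (p : Bool → Bool) → T (allB p) → ∀ b → T (p b)
allB-sound p h b with p true in e₁ | p false in e₂
allB-sound p h true  | true | true = subst T (sym e₁) tt
allB-sound p h false | true | true = subst T (sym e₂) tt

eqB : Bool → Bool → Bool
eqB a b = not (a xor b)

eqB-sound : ∀ a b → T (eqB a b) → a ≡ b
eqB-sound true  true  _ = refl
eqB-sound false false _ = refl

-- For closed `f` and `g` the implicit argument reduces to `⊤` and is filled in automatically, so a
-- Boolean identity is proved by stating it. The same holds for the versions in more variables.
bool₁ : (f g : Bool → Bool) {_ : T (allB λ a → eqB (f a) (g a))} → ∀ a → f a ≡ g a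
bool₁ f g {h} a = eqB-sound _ _ (allB-sound (λ a → eqB (f a) (g a)) h a)

bool₂ : (f g : Bool → Bool → Bool) {_ : T (allB λ a → allB λ b → eqB (f a b) (g a b))} →
        ∀ a b → f a b ≡ g a b
bool₂ f g {h} a b =
  eqB-sound _ _ (allB-sound (λ b → eqB (f a b) (g a b))
    (allB-sound (λ a → allB λ b → eqB (f a b) (g a b)) h a) b)

bool₃ : (f g : Bool → Bool → Bool → Bool)
        {_ : T (allB λ a → allB λ b → allB λ c → eqB (f a b c) (g a b c))} →
        ∀ a b c → f a b c ≡ g a b c
bool₃ f g {h} a b c =
  eqB-sound _ _ (allB-sound (λ c → eqB (f a b c) (g a b c))
    (allB-sound (λ b → allB λ c → eqB (f a b c) (g a b c))
      (allB-sound (λ a → allB λ b → allB λ c → eqB (f a b c) (g a b c)) h a) b) c)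

bool₄ : (f g : Bool → Bool → Bool → Bool → Bool)
        {_ : T (allB λ a → allB λ b → allB λ c → allB λ d → eqB (f a b c d) (g a b c d))} →
        ∀ a b c d → f a b c d ≡ g a b c d
bool₄ f g {h} a b c d =
  bool₃ (f a) (g a) {allB-sound (λ a → allB λ b → allB λ c → allB λ d → eqB (f a b c d) (g a b c d)) h a} b c d

true≢false : ∀ {b} → b ≡ true → b ≡ false → ⊥
true≢false refl ()

∧-true : ∀ {a b} → a ∧ b ≡ true → a ≡ true × b ≡ true
∧-true {true} {true} _ = refl , refl

∧-intro : ∀ {a b} → a ≡ true → b ≡ true → a ∧ b ≡ true
∧-intro refl refl = refl

∨-true : ∀ {a b} → a ∨ b ≡ true → a ≡ true ⊎ b ≡ true
∨-true {true} _ = inj₁ refl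
∨-true {false} h = inj₂ h

∨-introʳ : ∀ {a b} → b ≡ true → a ∨ b ≡ true
∨-introʳ {a} refl = ∨-zeroʳ a

∨-introˡ : ∀ {a b} → a ≡ true → a ∨ b ≡ true
∨-introˡ refl = refl

not-true : ∀ {a} → not a ≡ true → a ≡ false
not-true {false} _ = refl

≢true : ∀ {b} → ¬ (b ≡ true) → b ≡ false
≢true {true} h = ⊥-elim (h refl)
≢true {false} _ = refl

≢false : ∀ {b} → ¬ (b ≡ false) → b ≡ true
≢false {false} h = ⊥-elim (h refl)
≢false {true} _ = refl

bool-split : ∀ b → b ≡ true ⊎ b ≡ false
bool-split true = inj₁ refl
bool-split false = inj₂ refl

xor≡false : ∀ {a b} → a xor b ≡ false → a ≡ b
xor≡false {true} {true} _ = refl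
xor≡false {false} {false} _ = refl

bool-ext : ∀ {a b} → (a ≡ true → b ≡ true) → (b ≡ true → a ≡ true) → a ≡ b
bool-ext {true}  {b}     f g = sym (f refl)
bool-ext {false} {true}  f g = g refl
bool-ext {false} {false} f g = refl

dec-true : ∀ {p} {P : Set p} (d : Dec P) → P → ⌊ d ⌋ ≡ true
dec-true (yes _) _ = refl
dec-true (no ¬p) p = ⊥-elim (¬p p)

dec-false : ∀ {p} {P : Set p} (d : Dec P) → ¬ P → ⌊ d ⌋ ≡ false
dec-false (yes p) ¬p = ⊥-elim (¬p p)
dec-false (no _) _ = refl

true-dec : ∀ {p} {P : Set p} (d : Dec P) → ⌊ d ⌋ ≡ true → P
true-dec (yes p) _ = p

infix 6 _==_
_==_ : ∀ {n} → Fin n → Fin n → Bool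
u == v = ⌊ u ≟ v ⌋

==-refl : ∀ {n} (u : Fin n) → (u == u) ≡ true
==-refl u = dec-true (u ≟ u) refl

==-≡ : ∀ {n} {u v : Fin n} → (u == v) ≡ true → u ≡ v
==-≡ {u = u} {v} = true-dec (u ≟ v)

==-≢ : ∀ {n} {u v : Fin n} → ¬ u ≡ v → (u == v) ≡ false
==-≢ {u = u} {v} = dec-false (u ≟ v)

==-sym : ∀ {n} (u v : Fin n) → (u == v) ≡ (v == u)
==-sym u v = bool-ext (λ h → subst (λ w → (w == u) ≡ true) (==-≡ h) (==-refl u))
                      (λ h → subst (λ w → (w == v) ≡ true) (==-≡ h) (==-refl v))

==-suc : ∀ {n} (u v : Fin n) → (suc u == suc v) ≡ (u == v)
==-suc u v = bool-ext
  (λ h → subst (λ w → (u == w) ≡ true) (Data.Fin.Properties.suc-injective (==-≡ h)) (==-refl u))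
  (λ h → subst (λ w → (suc u == suc w) ≡ true) (==-≡ h) (==-refl (suc u)))

-- Sums over finite index sets

⨁ : {k : ℕ} → (Fin k → Bool) → Bool
⨁ {zero}  f = false
⨁ {suc k} f = f zero xor ⨁ (f ∘ suc)

⨁-cong : ∀ {k} {f g : Fin k → Bool} → (∀ i → f i ≡ g i) → ⨁ f ≡ ⨁ g
⨁-cong {zero} h = refl
⨁-cong {suc k} h = cong₂ _xor_ (h zero) (⨁-cong (h ∘ suc))

⨁-false : ∀ {k} {f : Fin k → Bool} → (∀ i → f i ≡ false) → ⨁ f ≡ false
⨁-false {zero} h = refl
⨁-false {suc k} h = cong₂ _xor_ (h zero) (⨁-false (h ∘ suc))

⨁-xor : ∀ {k} (f g : Fin k → Bool) → ⨁ (λ i → f i xor g i) ≡ ⨁ f xor ⨁ g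
⨁-xor {zero} f g = refl
⨁-xor {suc k} f g =
  trans (cong ((f zero xor g zero) xor_) (⨁-xor (f ∘ suc) (g ∘ suc)))
        (bool₄ (λ a b c d → (a xor b) xor (c xor d)) (λ a b c d → (a xor c) xor (b xor d))
          (f zero) (g zero) (⨁ (f ∘ suc)) (⨁ (g ∘ suc)))

⨁-∧ : ∀ {k} a (f : Fin k → Bool) → ⨁ (λ i → a ∧ f i) ≡ a ∧ ⨁ f
⨁-∧ true f = refl
⨁-∧ {k} false f = ⨁-false {k} {λ _ → false} (λ _ → refl)

⨁-swap : ∀ {k l} (f : Fin k → Fin l → Bool) → ⨁ (λ i → ⨁ (f i)) ≡ ⨁ (λ j → ⨁ (λ i → f i j))
⨁-swap {zero} {l} f = sym (⨁-false {l} {λ _ → false} (λ _ → refl))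
⨁-swap {suc k} f =
  trans (cong (⨁ (f zero) xor_) (⨁-swap (f ∘ suc)))
        (sym (⨁-xor (f zero) (λ j → ⨁ (λ i → f (suc i) j))))

⨁-single : ∀ {k} (j : Fin k) (f : Fin k → Bool) → ⨁ (λ i → (i == j) ∧ f i) ≡ f j
⨁-single {suc k} zero f =
  trans (cong (f zero xor_) (⨁-false (λ i → cong (_∧ f (suc i)) (==-≢ {u = suc i} {zero} (λ ()))))) (xor-identityʳ _)
⨁-single {suc k} (suc j) f =
  trans (cong₂ _xor_ (cong (_∧ f zero) (==-≢ {u = zero} {suc j} (λ ())))
           (⨁-cong (λ i → cong (_∧ f (suc i)) (==-suc i j))))
        (⨁-single j (f ∘ suc))

⨁-∃ : ∀ {k} (f : Fin k → Bool) → ⨁ f ≡ true → ∃ λ i → f i ≡ true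
⨁-∃ {suc k} f h with f zero in e
... | true = zero , e
... | false = let i , p = ⨁-∃ (f ∘ suc) h in suc i , p

-- Without the term at `j` the sum is odd, so a true term remains.
⨁-∃₂ : ∀ {k} (f : Fin k → Bool) (j : Fin k) → f j ≡ true → ⨁ f ≡ false →
       ∃ λ i → ¬ i ≡ j × f i ≡ true
⨁-∃₂ f j fj h =
  let g = λ i → f i xor ((i == j) ∧ f i)
      i , gi = ⨁-∃ g (trans (⨁-xor f (λ i → (i == j) ∧ f i))
                       (cong₂ _xor_ h (trans (⨁-single j f) fj)))
  in i , (λ i≡j → true≢false gi (trans (cong (λ i → f i xor ((i == j) ∧ f i)) i≡j)
                    (trans (cong (λ b → f j xor (b ∧ f j)) (==-refl j)) (xor-same (f j)))))
       , go (f i) (i == j) gi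
  where
  go : ∀ a b → a xor (b ∧ a) ≡ true → a ≡ true
  go true b _ = refl
  go false true ()
  go false false ()

∑-cong : ∀ {k} {f g : Fin k → ℕ} → (∀ i → f i ≡ g i) → ∑ f ≡ ∑ g
∑-cong {zero} h = refl
∑-cong {suc k} h = cong₂ _+_ (h zero) (∑-cong (h ∘ suc))

∑-mono : ∀ {k} {f g : Fin k → ℕ} → (∀ i → f i ≤ g i) → ∑ f ≤ ∑ g
∑-mono {zero} h = z≤n
∑-mono {suc k} h = +-mono-≤ (h zero) (∑-mono (h ∘ suc))

∑-zero : ∀ {k} {f : Fin k → ℕ} → (∀ i → f i ≡ 0) → ∑ f ≡ 0
∑-zero {zero} h = refl
∑-zero {suc k} h = cong₂ _+_ (h zero) (∑-zero (h ∘ suc))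

+-interchange : ∀ a b c d → (a + b) + (c + d) ≡ (a + c) + (b + d)
+-interchange = solve-∀

∑-+ : ∀ {k} (f g : Fin k → ℕ) → ∑ (λ i → f i + g i) ≡ ∑ f + ∑ g
∑-+ {zero} f g = refl
∑-+ {suc k} f g = trans (cong ((f zero + g zero) +_) (∑-+ (f ∘ suc) (g ∘ suc)))
                        (+-interchange (f zero) (g zero) (∑ (f ∘ suc)) (∑ (g ∘ suc)))

∑-swap : ∀ {k l} (f : Fin k → Fin l → ℕ) → ∑ (λ i → ∑ (f i)) ≡ ∑ (λ j → ∑ (λ i → f i j))
∑-swap {zero} {l} f = sym (∑-zero {l} {λ _ → 0} (λ _ → refl))
∑-swap {suc k} f = trans (cong (∑ (f zero) +_) (∑-swap (f ∘ suc)))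
                         (sym (∑-+ (f zero) (λ j → ∑ (λ i → f (suc i) j))))

∑-const : ∀ k c → ∑ {k} (λ _ → c) ≡ k * c
∑-const zero c = refl
∑-const (suc k) c = cong (c +_) (∑-const k c)

∑-single : ∀ {k} (j : Fin k) (c : ℕ) → ∑ (λ i → if j == i then c else 0) ≡ c
∑-single {suc k} zero c =
  trans (cong (c +_) (∑-zero {k} {λ i → if zero == suc i then c else 0} (λ i → cong (λ b → if b then c else 0) (==-≢ {u = zero} {suc i} (λ ()))))) (+-identityʳ c)
∑-single {suc k} (suc j) c =
  trans (cong₂ _+_ (cong (λ b → if b then c else 0) (==-≢ {u = suc j} {zero} (λ ())))
                   (∑-cong (λ i → cong (λ b → if b then c else 0) (==-suc j i))))
        (∑-single j c)

∑-pos : ∀ {k} (f : Fin k → ℕ) → ¬ ∑ f ≡ 0 → ∃ λ i → ¬ f i ≡ 0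
∑-pos {zero} f h = ⊥-elim (h refl)
∑-pos {suc k} f h with f zero in e
... | suc _ = zero , λ q → 0≢1+n (trans (sym q) e)
... | zero = let i , p = ∑-pos (f ∘ suc) h in suc i , p

∑-term : ∀ {k} (f : Fin k → ℕ) i → f i ≤ ∑ f
∑-term f zero = m≤m+n _ _
∑-term f (suc i) = ≤-trans (∑-term (f ∘ suc) i) (m≤n+m _ _)

-- Cardinalities

𝟙 : Bool → ℕ
𝟙 b = if b then 1 else 0

# : {k : ℕ} → (Fin k → Bool) → ℕ
# f = ∑ (λ i → if f i then 1 else 0)

infix 4 _⊑_
_⊑_ : ∀ {k} → (Fin k → Bool) → (Fin k → Bool) → Set
f ⊑ g = ∀ i → f i ≡ true → g i ≡ true

infixr 6 _⊓_
infixr 5 _⊔_ _⊖_ _⊕_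
_⊓_ _⊔_ _⊖_ _⊕_ : ∀ {k} → (Fin k → Bool) → (Fin k → Bool) → (Fin k → Bool)
(f ⊓ g) i = f i ∧ g i
(f ⊔ g) i = f i ∨ g i
(f ⊖ g) i = f i ∧ not (g i)
(f ⊕ g) i = f i xor g i

∅ : ∀ {k} → Fin k → Bool
∅ _ = false

∁ : ∀ {k} → (Fin k → Bool) → (Fin k → Bool)
∁ f i = not (f i)

#-cong : ∀ {k} {f g : Fin k → Bool} → (∀ i → f i ≡ g i) → # f ≡ # g
#-cong h = ∑-cong (λ i → cong 𝟙 (h i))

𝟙-mono : ∀ a b → (a ≡ true → b ≡ true) → 𝟙 a ≤ 𝟙 b
𝟙-mono false b h = z≤n
𝟙-mono true b h rewrite h refl = ≤-refl

𝟙≤1 : ∀ a → 𝟙 a ≤ 1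
𝟙≤1 true = ≤-refl
𝟙≤1 false = z≤n

#-mono : ∀ {k} {f g : Fin k → Bool} → f ⊑ g → # f ≤ # g
#-mono h = ∑-mono (λ i → 𝟙-mono _ _ (h i))

#≤k : ∀ {k} (f : Fin k → Bool) → # f ≤ k
#≤k {k} f = ≤-trans (∑-mono (λ i → 𝟙≤1 (f i))) (≤-reflexive (trans (∑-const k 1) (*-identityʳ k)))

#-true : ∀ {k} {f : Fin k → Bool} → (∀ i → f i ≡ true) → # f ≡ k
#-true {k} h = trans (∑-cong (λ i → cong 𝟙 (h i))) (trans (∑-const k 1) (*-identityʳ k))

#-∅ : ∀ {k} {f : Fin k → Bool} → (∀ i → f i ≡ false) → # f ≡ 0
#-∅ h = ∑-zero (λ i → cong 𝟙 (h i))

#-∃ : ∀ {k} (f : Fin k → Bool) → ¬ # f ≡ 0 → ∃ λ i → f i ≡ true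
#-∃ f h with ∑-pos _ h
... | i , p = i , ≢false (λ q → p (cong 𝟙 q))

#-pos : ∀ {k} (f : Fin k → Bool) i → f i ≡ true → 1 ≤ # f
#-pos f i h = ≤-trans (≤-reflexive (sym (cong 𝟙 h))) (∑-term (λ i → 𝟙 (f i)) i)

#-⊔-⊓ : ∀ {k} (f g : Fin k → Bool) → # (f ⊔ g) + # (f ⊓ g) ≡ # f + # g
#-⊔-⊓ f g = trans (sym (∑-+ (𝟙 ∘ (f ⊔ g)) (𝟙 ∘ (f ⊓ g))))
  (trans (∑-cong (λ i → go (f i) (g i))) (∑-+ (𝟙 ∘ f) (𝟙 ∘ g)))
  where
  go : ∀ a b → 𝟙 (a ∨ b) + 𝟙 (a ∧ b) ≡ 𝟙 a + 𝟙 b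
  go true true = refl
  go true false = refl
  go false b = +-identityʳ _

#-⊔-disj : ∀ {k} (f g : Fin k → Bool) → (∀ i → f i ∧ g i ≡ false) → # (f ⊔ g) ≡ # f + # g
#-⊔-disj f g h = trans (sym (trans (cong (# (f ⊔ g) +_) (#-∅ h)) (+-identityʳ _))) (#-⊔-⊓ f g)

#-⊔-≤ : ∀ {k} (f g : Fin k → Bool) → # (f ⊔ g) ≤ # f + # g
#-⊔-≤ f g = ≤-trans (m≤m+n _ (# (f ⊓ g))) (≤-reflexive (#-⊔-⊓ f g))

#-split : ∀ {k} (f g : Fin k → Bool) → # f ≡ # (f ⊓ g) + # (f ⊖ g)
#-split f g = trans (∑-cong (λ i → go (f i) (g i))) (∑-+ (𝟙 ∘ (f ⊓ g)) (𝟙 ∘ (f ⊖ g)))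
  where
  go : ∀ a b → 𝟙 a ≡ 𝟙 (a ∧ b) + 𝟙 (a ∧ not b)
  go true true = refl
  go true false = refl
  go false b = refl

#-⊖ : ∀ {k} (f g : Fin k → Bool) → g ⊑ f → # f ≡ # g + # (f ⊖ g)
#-⊖ f g h = trans (#-split f g) (cong (_+ # (f ⊖ g)) (#-cong (λ i → go (f i) (g i) (h i))))
  where
  go : ∀ a b → (b ≡ true → a ≡ true) → a ∧ b ≡ b
  go true b h = refl
  go false true h = h refl
  go false false h = refl

#-singleton : ∀ {k} (j : Fin k) → # (j ==_) ≡ 1
#-singleton j = ∑-single j 1

#-remove : ∀ {k} (f : Fin k → Bool) j → f j ≡ true → # f ≡ suc (# (f ⊖ (j ==_)))
#-remove f j fj = trans (#-⊖ f (j ==_) (λ i h → subst (λ i → f i ≡ true) (==-≡ h) fj))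
                        (cong (_+ # (f ⊖ (j ==_))) (#-singleton j))

#-mono-< : ∀ {k} {f g : Fin k → Bool} → f ⊑ g → ∀ j → g j ≡ true → f j ≡ false → # f < # g
#-mono-< {f = f} {g} h j gj fj =
  ≤-trans (s≤s (#-mono {f = f} {g = g ⊖ (j ==_)} sub)) (≤-reflexive (sym (#-remove g j gj)))
  where
  sub : f ⊑ (g ⊖ (j ==_))
  sub i fi = ∧-intro (h i fi) (cong not (==-≢ (λ j≡i → true≢false fi (trans (cong f (sym j≡i)) fj))))

odd? : ℕ → Bool
odd? zero = false
odd? (suc k) = not (odd? k)

odd?-+ : ∀ a b → odd? (a + b) ≡ odd? a xor odd? b
odd?-+ zero b = refl
odd?-+ (suc a) b = trans (cong not (odd?-+ a b)) (bool₂ (λ x y → not (x xor y)) (λ x y → not x xor y) (odd? a) (odd? b))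

odd?-𝟙 : ∀ b → odd? (𝟙 b) ≡ b
odd?-𝟙 true = refl
odd?-𝟙 false = refl

odd?-∑ : ∀ {k} (f : Fin k → ℕ) → odd? (∑ f) ≡ ⨁ (λ i → odd? (f i))
odd?-∑ {zero} f = refl
odd?-∑ {suc k} f = trans (odd?-+ (f zero) _) (cong (odd? (f zero) xor_) (odd?-∑ (f ∘ suc)))

odd?-# : ∀ {k} (f : Fin k → Bool) → odd? (# f) ≡ ⨁ f
odd?-# f = trans (odd?-∑ (𝟙 ∘ f)) (⨁-cong (λ i → odd?-𝟙 (f i)))

odd?-%2 : ∀ k → k % 2 ≡ 𝟙 (odd? k)
odd?-%2 0 = refl
odd?-%2 1 = refl
odd?-%2 (suc (suc k)) = trans (odd?-%2 k) (cong 𝟙 (sym (not-involutive (odd? k))))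

-- Deciding existence over all subsets of a finite set

_∷ᵇ_ : ∀ {k} → Bool → (Fin k → Bool) → Fin (suc k) → Bool
(b ∷ᵇ f) zero = b
(b ∷ᵇ f) (suc i) = f i

Respects≗ : ∀ {k} → ((Fin k → Bool) → Set) → Set
Respects≗ P = ∀ {f g} → (∀ i → f i ≡ g i) → P f → P g

abstract
  -- A subset agrees with its head and tail put together again only pointwise, hence the hypothesis
  -- `Respects≗`. Being `abstract`, the search over all subsets is never unfolded during type
  -- checking.
  anyPred? : ∀ {k} {P : (Fin k → Bool) → Set} → Respects≗ P → (∀ f → Dec (P f)) → Dec (∃ P)
  anyPred? {zero} {P} r d = map′ (λ p → ∅ , p) (λ { (f , p) → r {f} {∅} (λ ()) p }) (d ∅)
  anyPred? {suc k} {P} r d =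
    map′ (λ { (inj₁ (f , p)) → (true ∷ᵇ f) , p ; (inj₂ (f , p)) → (false ∷ᵇ f) , p })
         back
         (anyPred? {P = λ f → P (true ∷ᵇ f)} (λ h → r (λ { zero → refl ; (suc i) → h i })) (λ f → d (true ∷ᵇ f))
          ⊎-dec anyPred? {P = λ f → P (false ∷ᵇ f)} (λ h → r (λ { zero → refl ; (suc i) → h i })) (λ f → d (false ∷ᵇ f)))
    where
    back : ∃ P → (∃ λ f → P (true ∷ᵇ f)) ⊎ (∃ λ f → P (false ∷ᵇ f))
    back (f , p) with f zero in e
    ... | true  = inj₁ (f ∘ suc , r (λ { zero → e ; (suc i) → refl }) p)
    ... | false = inj₂ (f ∘ suc , r (λ { zero → e ; (suc i) → refl }) p)

  ⊑? : ∀ {k} (f g : Fin k → Bool) → Dec (f ⊑ g)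
  ⊑? f g = all? (λ i → dec→ (f i ≟ᵇ true) (g i ≟ᵇ true))
    where
    dec→ : ∀ {A B : Set} → Dec A → Dec B → Dec (A → B)
    dec→ _ (yes b) = yes (λ _ → b)
    dec→ (no ¬a) _ = yes (λ a → ⊥-elim (¬a a))
    dec→ (yes a) (no ¬b) = no (λ f → ¬b (f a))

-- Edge sets over F₂

module EvenSets (G : Graph) where
  open Graph G public

  s t : Fin m → Fin n
  s = src G
  t = tgt G

  -- A loop has incidence zero at its own vertex, so loops are invisible to `∂` and every set of
  -- loops is even.
  inc : Fin m → Fin n → Bool
  inc e v = (s e == v) xor (t e == v)

  ∂ : EdgeSet m → Fin n → Bool
  ∂ S v = ⨁ (λ e → S e ∧ inc e v)

  δ : (Fin n → Bool) → Fin m → Bool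
  δ A e = A (s e) xor A (t e)

  -- A record, so that `S` can be inferred from the type; the bare equations would unfold and lose
  -- it.
  record Even (S : EdgeSet m) : Set where
    constructor mkEven
    field ∂0 : ∀ v → ∂ S v ≡ false
  open Even public

  -- A path from `u` to `v` up to an even set. The case `u = v`, where `S` is even, is included, so
  -- that joins compose without side conditions.
  record Join (S : EdgeSet m) (u v : Fin n) : Set where
    constructor mkJoin
    field ∂J : ∀ w → ∂ S w ≡ (u == w) xor (v == w)
  open Join public

  ∂-cong : ∀ {S S′} → (∀ e → S e ≡ S′ e) → ∀ v → ∂ S v ≡ ∂ S′ v
  ∂-cong h v = ⨁-cong (λ e → cong (_∧ inc e v) (h e))

  ∂-⊕ : ∀ S S′ v → ∂ (S ⊕ S′) v ≡ ∂ S v xor ∂ S′ v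
  ∂-⊕ S S′ v = trans (⨁-cong (λ e → ∧-distribʳ-xor (inc e v) (S e) (S′ e)))
                     (⨁-xor (λ e → S e ∧ inc e v) (λ e → S′ e ∧ inc e v))

  ∂-∅ : ∀ {S} → (∀ e → S e ≡ false) → ∀ v → ∂ S v ≡ false
  ∂-∅ h v = ⨁-false (λ e → cong (_∧ inc e v) (h e))

  ∂-edge : ∀ e v → ∂ (e ==_) v ≡ inc e v
  ∂-edge e v = trans (⨁-cong (λ f → cong (_∧ inc f v) (==-sym e f))) (⨁-single e (λ f → inc f v))

  Even-cong : ∀ {S S′} → (∀ e → S e ≡ S′ e) → Even S → Even S′
  Even-cong h ev = mkEven λ v → trans (sym (∂-cong h v)) (∂0 ev v)

  Even-∅ : Even ∅
  Even-∅ = mkEven (∂-∅ {∅} (λ _ → refl))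

  Even-⊕ : ∀ {S S′} → Even S → Even S′ → Even (S ⊕ S′)
  Even-⊕ {S} {S′} a b = mkEven λ v → trans (∂-⊕ S S′ v) (cong₂ _xor_ (∂0 a v) (∂0 b v))

  Join-cong : ∀ {S S′ u v} → (∀ e → S e ≡ S′ e) → Join S u v → Join S′ u v
  Join-cong h j = mkJoin λ w → trans (sym (∂-cong h w)) (∂J j w)

  Join-⊕ : ∀ {S S′ u v w} → Join S u v → Join S′ v w → Join (S ⊕ S′) u w
  Join-⊕ {S} {S′} {u} {v} {w} a b = mkJoin λ x →
    trans (∂-⊕ S S′ x) (trans (cong₂ _xor_ (∂J a x) (∂J b x))
      (bool₃ (λ p q r → (p xor q) xor (q xor r)) (λ p q r → p xor r) (u == x) (v == x) (w == x)))

  Join-sym : ∀ {S u v} → Join S u v → Join S v u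
  Join-sym {u = u} {v} j = mkJoin λ w → trans (∂J j w) (xor-comm (u == w) (v == w))

  Join-edge : ∀ e → Join (e ==_) (s e) (t e)
  Join-edge e = mkJoin (∂-edge e)

  Join-refl : ∀ u → Join ∅ u u
  Join-refl u = mkJoin λ w → trans (∂-∅ {∅} (λ _ → refl) w) (sym (xor-same (u == w)))

  Join⇒Even : ∀ {S u} → Join S u u → Even S
  Join⇒Even {u = u} j = mkEven λ v → trans (∂J j v) (xor-same (u == v))

  Join-Even : ∀ {S S′ u v} → Join S u v → Even S′ → Join (S ⊕ S′) u v
  Join-Even {S} {S′} {u} {v} a b = mkJoin λ x →
    trans (∂-⊕ S S′ x) (trans (cong₂ _xor_ (∂J a x) (∂0 b x)) (xor-identityʳ _))

  ⨁-inc : ∀ A e → ⨁ (λ v → inc e v ∧ A v) ≡ δ A e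
  ⨁-inc A e =
    trans (⨁-cong (λ v → trans (∧-distribʳ-xor (A v) (s e == v) (t e == v))
             (cong₂ _xor_ (cong (_∧ A v) (==-sym (s e) v)) (cong (_∧ A v) (==-sym (t e) v)))))
      (trans (⨁-xor (λ v → (v == s e) ∧ A v) (λ v → (v == t e) ∧ A v))
             (cong₂ _xor_ (⨁-single (s e) A) (⨁-single (t e) A)))

  -- Both sides count, modulo 2, the ends of edges of `S` that lie in `A`; an edge with both ends in
  -- `A` cancels.
  cut-parity : ∀ A S → ⨁ (λ v → A v ∧ ∂ S v) ≡ ⨁ (λ e → S e ∧ δ A e)
  cut-parity A S =
    trans (⨁-cong (λ v → sym (⨁-∧ (A v) (λ e → S e ∧ inc e v))))
      (trans (⨁-swap (λ v e → A v ∧ (S e ∧ inc e v)))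
        (⨁-cong (λ e → trans (⨁-cong (λ v →
             bool₃ (λ a x i → a ∧ (x ∧ i)) (λ a x i → x ∧ (i ∧ a)) (A v) (S e) (inc e v)))
          (trans (⨁-∧ (S e) (λ v → inc e v ∧ A v)) (cong (S e ∧_) (⨁-inc A e))))))

  Even-cut : ∀ A {S} → Even S → ⨁ (λ e → S e ∧ δ A e) ≡ false
  Even-cut A {S} ev = trans (sym (cut-parity A S))
    (⨁-false (λ v → trans (cong (A v ∧_) (∂0 ev v)) (∧-zeroʳ (A v))))

  connTrans : ∀ {F u v w} → Conn G F u v → Conn G F v w → Conn G F u w
  connTrans c here = c
  connTrans c (fwd e a d) = fwd e a (connTrans c d)
  connTrans c (bwd e a d) = bwd e a (connTrans c d)

  connSym : ∀ {F u v} → Conn G F u v → Conn G F v u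
  connSym here = here
  connSym (fwd e a d) = connTrans (bwd e a here) (connSym d)
  connSym (bwd e a d) = connTrans (fwd e a here) (connSym d)

  connMono : ∀ {F F′ u v} → F ⊑ F′ → Conn G F u v → Conn G F′ u v
  connMono h here = here
  connMono h (fwd e a d) = fwd e (h e a) (connMono h d)
  connMono h (bwd e a d) = bwd e (h e a) (connMono h d)

  conn⇒join : ∀ {F u v} → Conn G F u v → ∃ λ S → S ⊑ F × Join S u v
  conn⇒join {F} {u} here = ∅ , (λ _ ()) , Join-refl u
  conn⇒join {F} (fwd e a d) with conn⇒join d
  ... | S , S⊑F , j = S ⊕ (e ==_) , sub , Join-⊕ j (Join-edge e)
    where
    sub : (S ⊕ (e ==_)) ⊑ F
    sub f h with S f in p
    ... | true = S⊑F f p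
    ... | false = subst (λ x → F x ≡ true) (==-≡ h) a
  conn⇒join {F} (bwd e a d) with conn⇒join d
  ... | S , S⊑F , j = S ⊕ (e ==_) , sub , Join-⊕ j (Join-sym (Join-edge e))
    where
    sub : (S ⊕ (e ==_)) ⊑ F
    sub f h with S f in p
    ... | true = S⊑F f p
    ... | false = subst (λ x → F x ≡ true) (==-≡ h) a

  removeEdge : EdgeSet m → Fin m → EdgeSet m
  removeEdge S e = S ⊖ (e ==_)

  remove-⊕ : ∀ S e → S e ≡ true → ∀ f → (S ⊕ (e ==_)) f ≡ removeEdge S e f
  remove-⊕ S e h f with e == f in q
  ... | false = trans (xor-identityʳ (S f)) (sym (∧-identityʳ (S f)))
  ... | true = trans (cong (_xor true) Sf) (sym (∧-zeroʳ (S f)))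
    where Sf = subst (λ x → S x ≡ true) (==-≡ q) h

  -- Unless `u = v`, the vertex `v` is odd and so has an edge of `S`. Removing it leaves a join from
  -- `u` to the other end of that edge.
  join⇒conn : ∀ k {S u v} → # S ≤ k → Join S u v → Conn G S u v
  join⇒conn k {S} {u} {v} le j with u ≟ v
  ... | yes refl = here
  ... | no u≢v with ⨁-∃ (λ e → S e ∧ inc e v) (trans (∂J j v) (cong₂ _xor_ (==-≢ u≢v) (==-refl v)))
  join⇒conn zero {S} le j | no _ | e , h = ⊥-elim (<⇒≱ (#-pos S e (proj₁ (∧-true h))) le)
  join⇒conn (suc k) {S} {u} {v} le j | no _ | e , h = go (s e ≟ v) (t e ≟ v) (proj₂ (∧-true h))
    where
    Se = proj₁ (∧-true h)
    S′ = removeEdge S e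
    le′ : # S′ ≤ k
    le′ = s≤s⁻¹ (≤-trans (≤-reflexive (sym (#-remove S e Se))) le)
    up : S′ ⊑ S
    up f q = proj₁ (∧-true q)
    go : (d₁ : Dec (s e ≡ v)) (d₂ : Dec (t e ≡ v)) → ⌊ d₁ ⌋ xor ⌊ d₂ ⌋ ≡ true → Conn G S u v
    go (yes refl) (no _) _ = bwd e Se (connMono up (join⇒conn k {S′} le′
      (Join-cong (remove-⊕ S e Se) (Join-⊕ j (Join-edge e)))))
    go (no _) (yes refl) _ = fwd e Se (connMono up (join⇒conn k {S′} le′
      (Join-cong (remove-⊕ S e Se) (Join-⊕ j (Join-sym (Join-edge e))))))
    go (yes _) (yes _) ()
    go (no _) (no _) ()

  Join⇒Conn : ∀ {S u v} → Join S u v → Conn G S u v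
  Join⇒Conn {S} = join⇒conn (# S) ≤-refl

  join? : ∀ S u v → Dec (Join S u v)
  join? S u v = map′ mkJoin ∂J (all? (λ w → ∂ S w ≟ᵇ _))

  even? : ∀ S → Dec (Even S)
  even? S = map′ mkEven ∂0 (all? (λ w → ∂ S w ≟ᵇ false))

  abstract
    conn? : ∀ F u v → Dec (Conn G F u v)
    conn? F u v = map′ (λ { (S , sub , j) → connMono sub (Join⇒Conn j) }) conn⇒join
      (anyPred? (λ {S} {S′} h (sub , j) → (λ e q → sub e (trans (h e) q)) , Join-cong h j)
                (λ S → ⊑? S F ×-dec join? S u v))

  reach : EdgeSet m → Fin n → Fin n → Bool
  reach F u v = ⌊ conn? F u v ⌋

  reach-conn : ∀ {F u v} → reach F u v ≡ true → Conn G F u v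
  reach-conn {F} {u} {v} = true-dec (conn? F u v)

  conn-reach : ∀ {F u v} → Conn G F u v → reach F u v ≡ true
  conn-reach {F} {u} {v} = dec-true (conn? F u v)

  reach-refl : ∀ F u → reach F u u ≡ true
  reach-refl F u = conn-reach {F} {u} here

  reach-edge : ∀ F u e → F e ≡ true → reach F u (s e) ≡ reach F u (t e)
  reach-edge F u e a = bool-ext (λ h → conn-reach {F} (fwd e a (reach-conn h)))
                                (λ h → conn-reach {F} (bwd e a (reach-conn h)))

  reach-closed : ∀ F u e → F e ≡ true → δ (reach F u) e ≡ false
  reach-closed F u e a = trans (cong (_xor reach F u (t e)) (reach-edge F u e a)) (xor-same (reach F u (t e)))

  conn-closed : ∀ {F u v} A → (∀ e → F e ≡ true → δ A e ≡ false) → Conn G F u v → A u ≡ A v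
  conn-closed A h here = refl
  conn-closed A h (fwd e a d) = trans (conn-closed A h d) (xor≡false (h e a))
  conn-closed A h (bwd e a d) = trans (conn-closed A h d) (sym (xor≡false (h e a)))

  -- The component of `u` in `J` has an even number of odd vertices.
  odd-partner : ∀ J u → ∂ J u ≡ true → ∃ λ v → ¬ v ≡ u × Conn G J u v × ∂ J v ≡ true
  odd-partner J u h with ⨁-∃₂ (λ v → reach J u v ∧ ∂ J v) u (∧-intro (reach-refl J u) h)
                          (trans (cut-parity (reach J u) J) (⨁-false go))
    where
    go : ∀ e → J e ∧ δ (reach J u) e ≡ false
    go e with J e in q
    ... | true = reach-closed J u e q
    ... | false = refl
  ... | v , v≢u , p = v , v≢u , reach-conn (proj₁ (∧-true p)) , proj₂ (∧-true p)

  comp : EdgeSet m → Fin n → EdgeSet m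
  comp F u e = F e ∧ reach F u (s e)

  inc⇒end : ∀ e v → inc e v ≡ true → s e ≡ v ⊎ t e ≡ v
  inc⇒end e v h with s e ≟ v | t e ≟ v
  ... | yes p | _ = inj₁ p
  ... | no _ | yes q = inj₂ q
  inc⇒end e v () | no _ | no _

  comp-inc : ∀ F u e v → inc e v ≡ true → comp F u e ≡ F e ∧ reach F u v
  comp-inc F u e v i with inc⇒end e v i | F e in q
  ... | _ | false = refl
  ... | inj₁ p | true = cong (reach F u) p
  ... | inj₂ p | true = trans (reach-edge F u e q) (cong (reach F u) p)

  ∂-comp : ∀ F u v → ∂ (comp F u) v ≡ reach F u v ∧ ∂ F v
  ∂-comp F u v = trans (⨁-cong go) (⨁-∧ (reach F u v) (λ e → F e ∧ inc e v))
    where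
    go : ∀ e → comp F u e ∧ inc e v ≡ reach F u v ∧ (F e ∧ inc e v)
    go e with inc e v in i
    ... | true = trans (cong (_∧ true) (comp-inc F u e v i))
                   (bool₂ (λ a b → (a ∧ b) ∧ true) (λ a b → b ∧ (a ∧ true)) (F e) (reach F u v))
    ... | false = bool₃ (λ a b c → a ∧ false) (λ a b c → b ∧ (c ∧ false)) (comp F u e) (reach F u v) (F e)

  comp⊑ : ∀ F u → comp F u ⊑ F
  comp⊑ F u e h = proj₁ (∧-true h)

  Even-comp : ∀ F u → Even F → Even (comp F u)
  Even-comp F u ev = mkEven λ v → trans (∂-comp F u v) (trans (cong (reach F u v ∧_) (∂0 ev v)) (∧-zeroʳ _))

  conn-comp : ∀ {F u v} → Conn G F u v → Conn G (comp F u) u v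
  conn-comp here = here
  conn-comp {F} {u} (fwd e a d) = fwd e (∧-intro a (conn-reach d)) (conn-comp d)
  conn-comp {F} {u} (bwd e a d) =
    bwd e (∧-intro a (trans (reach-edge F u e a) (conn-reach d))) (conn-comp d)

-- The 8-flow theorem

xor-true : ∀ {a b} → a xor b ≡ true → a ≡ true ⊎ b ≡ true
xor-true {true} _ = inj₁ refl
xor-true {false} h = inj₂ h

inner : (G : Graph) → (Fin (Graph.n G) → Bool) → EdgeSet (Graph.m G)
inner G A e = A (src G e) ∧ A (tgt G e)

least-# : ∀ {k} {P : (Fin k → Bool) → Set} → Respects≗ P → (∀ f → Dec (P f)) →
          ∀ b f → # f ≤ b → P f → ∃ λ g → P g × (∀ h → P h → # g ≤ # h)
least-# {P = P} r d b f le p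
  with anyPred? {P = λ g → P g × # g < # f} (λ h (q , l) → r h q , subst (_< # f) (#-cong h) l)
                (λ g → d g ×-dec (# g <? # f))
... | no ¬g = f , p , λ h ph → ≮⇒≥ (λ l → ¬g (h , ph , l))
least-# r d zero f le p | yes (g , pg , l) = ⊥-elim (n≮0 (≤-trans l le))
least-# r d (suc b) f le p | yes (g , pg , l) = least-# r d b g (s≤s⁻¹ (≤-trans l le)) pg

two-elements : ∀ {k} (f : Fin k → Bool) → 2 ≤ # f → ∃ λ i → ∃ λ j → ¬ i ≡ j × f i ≡ true × f j ≡ true
two-elements f le with #-∃ f (λ q → n≮0 (≤-trans (≤-trans (s≤s z≤n) le) (≤-reflexive q)))
... | i , fi with #-∃ (f ⊖ (i ==_)) (λ q → n≮0 (≤-trans (s≤s⁻¹ (≤-trans le (≤-reflexive (#-remove f i fi)))) (≤-reflexive q)))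
... | j , fj = i , j , (λ i≡j → true≢false (proj₂ (∧-true {f j} fj)) (cong not (subst (λ x → (i == x) ≡ true) i≡j (==-refl i)))) , fi , proj₁ (∧-true fj)

-- Connected even sets through two given vertices

module Ears (G : Graph) where
  open EvenSets G

  inner-closed : ∀ A e → inner G A e ≡ true → δ A e ≡ false
  inner-closed A e h = cong₂ _xor_ (proj₁ (∧-true {A (s e)} h)) (proj₂ (∧-true {A (s e)} h))

  conn-inner : ∀ {F B u v} → F ⊑ inner G B → B u ≡ true → Conn G F u v → B v ≡ true
  conn-inner {B = B} sub h c =
    trans (sym (conn-closed B (λ e Fe → inner-closed B e (sub e Fe)) c)) h

  comp⊑inner : ∀ F u → comp F u ⊑ inner G (reach F u)
  comp⊑inner F u e h = let p , q = ∧-true h in ∧-intro q (trans (sym (reach-edge F u e p)) q)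

  ∂-reach : ∀ {J u v} → Join J u v → Join (comp J u) u v
  ∂-reach {J} {u} {v} j = mkJoin λ w → trans (∂-comp J u w) (trans (cong (reach J u w ∧_) (∂J j w)) (go w))
    where
    go : ∀ w → reach J u w ∧ ((u == w) xor (v == w)) ≡ (u == w) xor (v == w)
    go w with u ≟ w | v ≟ w
    ... | yes refl | _ = cong (_∧ _) (reach-refl J u)
    ... | no _ | yes refl = cong (_∧ true) (conn-reach (Join⇒Conn j))
    ... | no _ | no _ = ∧-zeroʳ _

  Join-compl : ∀ {Z L u v} → Even Z → L ⊑ Z → Join L u v → Join (Z ⊖ L) u v
  Join-compl {Z} {L} ev sub j = Join-cong go (Join-Even j ev)
    where
    go : ∀ e → (L ⊕ Z) e ≡ (Z ⊖ L) e
    go e with L e in q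
    ... | true rewrite sub e q = refl
    ... | false = sym (∧-identityʳ (Z e))

  -- A join `L₀` from `v` to `z` inside `Z` and its complement `L′` in `Z` have the same odd
  -- vertices. If `x` reaches `v` in `L′`, then `L′` serves. Otherwise the component `K` of `x` in
  -- `L′` contains neither `v` nor `z` and is therefore even; since `Z` connects `x` to `v`, some
  -- edge of `L₀` touches `K`, and `L₀ ⊕ K` serves.
  join-through : ∀ {Z x v z} → Even Z → Conn G Z x v → Conn G Z x z →
                 ∃ λ L → L ⊑ Z × Join L v z × Conn G L x v
  join-through {Z} {x} {v} {z} ev cv cz with conn⇒join (connTrans (connSym cv) cz)
  ... | L₁ , L₁⊑Z , j₁ = cases
    where
    L₀ = comp L₁ v
    L₀⊑Z : L₀ ⊑ Z
    L₀⊑Z e h = L₁⊑Z e (comp⊑ L₁ v e h)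
    j₀ : Join L₀ v z
    j₀ = ∂-reach j₁
    L′ = Z ⊖ L₀
    L′⊑Z : L′ ⊑ Z
    L′⊑Z e h = proj₁ (∧-true h)
    j′ : Join L′ v z
    j′ = Join-compl ev L₀⊑Z j₀
    A = reach L′ x
    L₀-conn : ∀ e → L₀ e ≡ true → Conn G L₀ v (s e) × Conn G L₀ v (t e)
    L₀-conn e h = let p , q = ∧-true h ; c = conn-comp (reach-conn {L₁} q) in c , fwd e h c
    cases : ∃ λ L → L ⊑ Z × Join L v z × Conn G L x v
    cases with conn? L′ x v
    ... | yes c = L′ , L′⊑Z , j′ , c
    ... | no ¬c with any? (λ e → (L₀ e ∧ (A (s e) ∨ A (t e))) ≟ᵇ true)
    ... | no none = ⊥-elim (¬c (reach-conn (trans (sym (conn-closed A closed cv)) (reach-refl L′ x))))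
      where
      closed : ∀ e → Z e ≡ true → δ A e ≡ false
      closed e Ze with L₀ e in q
      ... | false = reach-closed L′ x e (∧-intro Ze (cong not q))
      ... | true with A (s e) in a | A (t e) in b
      ... | true | _ = ⊥-elim (none (e , ∧-intro q (∨-introˡ a)))
      ... | false | true = ⊥-elim (none (e , ∧-intro q (∨-introʳ b)))
      ... | false | false = refl
    ... | yes (e , h) = L₀ ⊕ K , sub , Join-Even j₀ evK , connTrans (connMono K⊑ (proj₁ (proj₂ touch))) (connMono L₀⊑ (proj₂ (proj₂ touch)))
      where
      K = comp L′ x
      K-L₀ : ∀ f → K f ≡ true → L₀ f ≡ false
      K-L₀ f h = not-true (proj₂ (∧-true {Z f} (proj₁ (∧-true h))))
      sub : (L₀ ⊕ K) ⊑ Z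
      sub f q with xor-true {L₀ f} q
      ... | inj₁ r = L₀⊑Z f r
      ... | inj₂ r = L′⊑Z f (comp⊑ L′ x f r)
      K⊑ : K ⊑ (L₀ ⊕ K)
      K⊑ f q = trans (cong (_xor K f) (K-L₀ f q)) q
      L₀⊑ : L₀ ⊑ (L₀ ⊕ K)
      L₀⊑ f q = trans (cong (L₀ f xor_) (≢true (λ r → true≢false q (K-L₀ f r)))) (trans (xor-identityʳ (L₀ f)) q)
      ¬cz : ¬ Conn G L′ x z
      ¬cz c = ¬c (connTrans c (connSym (Join⇒Conn j′)))
      evK : Even K
      evK = mkEven λ w → trans (∂-comp L′ x w) (go w)
        where
        go : ∀ w → reach L′ x w ∧ ∂ L′ w ≡ false
        go w with reach L′ x w in r
        ... | false = refl
        ... | true = trans (∂J j′ w) (cong₂ _xor_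
            (==-≢ {u = v} {w} (λ { refl → ¬c (reach-conn {L′} r) })) (==-≢ {u = z} {w} (λ { refl → ¬cz (reach-conn {L′} r) })))
      Le = proj₁ (∧-true h)
      touch : ∃ λ p → Conn G K x p × Conn G L₀ p v
      touch with ∨-true {A (s e)} {A (t e)} (proj₂ (∧-true {L₀ e} h))
      ... | inj₁ a = s e , conn-comp (reach-conn {L′} a) , connSym (proj₁ (L₀-conn e Le))
      ... | inj₂ b = t e , conn-comp (reach-conn {L′} b) , connSym (proj₂ (L₀-conn e Le))

  -- The graph induced on `B` is connected and has no bridge.
  TwoConn : (Fin n → Bool) → Set
  TwoConn B = ∀ A → A ⊑ B → ∃ (λ x → A x ≡ true) → ∃ (λ y → B y ≡ true × A y ≡ false) →
              2 ≤ # (inner G B ⊓ δ A)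

  module _ (B : Fin n → Bool) (two : TwoConn B) (x : Fin n) (x∈B : B x ≡ true) where

    Linked : Fin n → EdgeSet m → Set
    Linked y Z = Z ⊑ inner G B × Even Z × Conn G Z x y

    linked? : ∀ y → Dec (∃ (Linked y))
    linked? y = anyPred?
      (λ h (a , b , c) → (λ e q → a e (trans (h e) q)) , Even-cong h b , connMono (λ e q → trans (sym (h e)) q) c)
      (λ Z → ⊑? Z (inner G B) ×-dec (even? Z ×-dec conn? Z x y))

    module Extend (g : Fin m) (v w : Fin n) (jg : Join (g ==_) v w) (v∈B : B v ≡ true) (w∈B : B w ≡ true)
             (g∈B : inner G B g ≡ true) (Z : EdgeSet m) (lk : Linked v Z) (w∉ : ¬ Conn G Z x w) where
      Zx = comp Z x
      S = reach Z x
      Zx-even : Even Zx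
      Zx-even = Even-comp Z x (proj₁ (proj₂ lk))
      F = removeEdge (inner G B) g
      w∉S : S w ≡ false
      w∉S = dec-false (conn? Z x w) w∉
      v∈S : S v ≡ true
      v∈S = conn-reach (proj₂ (proj₂ lk))

      δg : ∀ A → δ A g ≡ A v xor A w
      δg A = trans (sym (⨁-inc A g)) (trans (⨁-cong λ y → trans (cong (_∧ A y) (trans (sym (∂-edge g y)) (∂J jg y)))
               (trans (∧-distribʳ-xor (A y) (v == y) (w == y))
                 (cong₂ (λ a b → (a ∧ A y) xor (b ∧ A y)) (==-sym v y) (==-sym w y))))
               (trans (⨁-xor (λ y → (y == v) ∧ A y) (λ y → (y == w) ∧ A y)) (cong₂ _xor_ (⨁-single v A) (⨁-single w A))))

      not-bridge : Conn G F w v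
      not-bridge with conn? F w v
      ... | yes c = c
      ... | no ¬c = ⊥-elim (<⇒≱ (s≤s (≤-trans (#-mono one) (≤-reflexive (#-singleton g))))
                       (two (reach F w) (λ y r → conn-inner F⊑ w∈B (reach-conn {F} r)) (w , reach-refl F w)
                            (v , v∈B , dec-false (conn? F w v) ¬c)))
        where
        F⊑ : F ⊑ inner G B
        F⊑ e h = proj₁ (∧-true h)
        one : (inner G B ⊓ δ (reach F w)) ⊑ (g ==_)
        one e h with g == e in q
        ... | true = refl
        ... | false = ⊥-elim (true≢false (proj₂ (∧-true {inner G B e} h))
                        (reach-closed F w e (∧-intro (proj₁ (∧-true h)) (cong not q))))

      -- Ear addition. Since `g` is no bridge, a join `Q` leads from `w` back to `v` without `g`.
      -- Deleting the edges inside `S` does not change boundaries outside `S`, so what is left joins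
      -- `w` to some `z` in `S`. Together with `g` this is an ear from `v` to `z`; it is closed by a
      -- join inside the old even set, which `join-through` chooses so that `x` stays connected to
      -- `v`.
      extend : ∃ (Linked w)
      extend with conn⇒join not-bridge
      ... | Q , Q⊑F , jQ = fin
        where
        Q₀ = Q ⊖ inner G S
        ∂Q₀ : ∀ y → S y ≡ false → ∂ Q₀ y ≡ (w == y)
        ∂Q₀ y y∉S = trans (⨁-cong go) (trans (∂J jQ y) (trans (cong ((w == y) xor_) (==-≢ v≢y)) (xor-identityʳ _)))
          where
          v≢y : ¬ v ≡ y
          v≢y refl = true≢false v∈S y∉S
          go : ∀ e → Q₀ e ∧ inc e y ≡ Q e ∧ inc e y
          go e with inc e y in i
          ... | false = bool₂ (λ a b → a ∧ false) (λ a b → b ∧ false) (Q₀ e) (Q e)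
          ... | true = cong (_∧ true) (trans (cong (Q e ∧_) (cong not out)) (∧-identityʳ (Q e)))
            where
            out : inner G S e ≡ false
            out with inc⇒end e y i
            ... | inj₁ p = cong (_∧ S (t e)) (trans (cong S p) y∉S)
            ... | inj₂ p = trans (cong (S (s e) ∧_) (trans (cong S p) y∉S)) (∧-zeroʳ _)
        fin : ∃ (Linked w)
        fin with odd-partner Q₀ w (trans (∂Q₀ w w∉S) (==-refl w))
        ... | z , z≢w , cz , ∂z with conn⇒join cz
        ... | Q₁ , Q₁⊑ , jz with join-through Zx-even (conn-comp (reach-conn {Z} v∈S)) (conn-comp (reach-conn {Z} z∈S))
          where
          z∈S : S z ≡ true
          z∈S with S z in r
          ... | true = refl
          ... | false = ⊥-elim (true≢false ∂z (trans (∂Q₀ z r) (==-≢ (λ p → z≢w (sym p)))))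
        ... | L , L⊑ , jL , cL = Z′ , sub , Join⇒Even (Join-⊕ jE (Join-sym jL)) , connTrans (connMono L⊑Z′ cL) vw
          where
          E = (g ==_) ⊕ Q₁
          jE : Join E v z
          jE = Join-⊕ jg jz
          Z′ = E ⊕ L
          Q₁F : ∀ e → Q₁ e ≡ true → F e ≡ true × inner G S e ≡ false
          Q₁F e h = let a , b = ∧-true {Q e} (Q₁⊑ e h) in Q⊑F e a , not-true b
          L-in : ∀ e → L e ≡ true → inner G S e ≡ true
          L-in e h = comp⊑inner Z x e (L⊑ e h)
          g-out : inner G S g ≡ false
          g-out with inner G S g in q
          ... | false = refl
          ... | true = ⊥-elim (true≢false (trans (δg S) (cong₂ _xor_ v∈S w∉S)) (inner-closed S g q))
          E-out : ∀ e → E e ≡ true → inner G S e ≡ false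
          E-out e h with g == e in q
          ... | true = subst (λ y → inner G S y ≡ false) (==-≡ q) g-out
          ... | false = proj₂ (Q₁F e h)
          E⊑Z′ : E ⊑ Z′
          E⊑Z′ e h = trans (cong (E e xor_) (≢true (λ q → true≢false (L-in e q) (E-out e h))))
                           (trans (xor-identityʳ (E e)) h)
          L⊑Z′ : L ⊑ Z′
          L⊑Z′ e h = trans (cong (_xor L e) (≢true {E e} (λ q → true≢false (L-in e h) (E-out e q)))) h
          g∈E : E g ≡ true
          g∈E with Q₁ g in q
          ... | false = trans (xor-identityʳ _) (==-refl g)
          ... | true = ⊥-elim (true≢false (==-refl g) (not-true (proj₂ (∧-true {inner G B g} (proj₁ (Q₁F g q))))))
          g⊑ : (g ==_) ⊑ Z′
          g⊑ e h = subst (λ y → Z′ y ≡ true) (==-≡ h) (E⊑Z′ g g∈E)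
          vw : Conn G Z′ v w
          vw = connMono g⊑ (Join⇒Conn jg)
          sub : Z′ ⊑ inner G B
          sub e h with xor-true {E e} h
          ... | inj₂ q = proj₁ lk e (comp⊑ Z x e (L⊑ e q))
          ... | inj₁ q with xor-true {g == e} q
          ... | inj₁ r = subst (λ y → inner G B y ≡ true) (==-≡ r) g∈B
          ... | inj₂ r = proj₁ (∧-true (proj₁ (Q₁F e r)))

    -- If some vertex of `B` were not linked to `x`, an edge inside `B` would lead from a linked
    -- vertex to an unlinked one, and `Extend` would link the latter.
    linked : ∀ y → B y ≡ true → ∃ (Linked y)
    linked y y∈B with linked? y
    ... | yes l = l
    ... | no ¬l = ⊥-elim (absurd (two R (λ v h → proj₁ (∧-true h)) (x , x∈R) (y , y∈B , y∉R)))
      where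
      R : Fin n → Bool
      R v = B v ∧ ⌊ linked? v ⌋
      x∈R : R x ≡ true
      x∈R = ∧-intro x∈B (dec-true (linked? x) (∅ , (λ _ ()) , Even-∅ , here))
      y∉R : R y ≡ false
      y∉R = trans (cong (B y ∧_) (dec-false (linked? y) ¬l)) (∧-zeroʳ _)
      step : ∀ g v w → Join (g ==_) v w → R v ≡ true → B w ≡ true → R w ≡ false → inner G B g ≡ true → ⊥
      step g v w jg v∈R w∈B w∉R gB with true-dec (linked? v) (proj₂ (∧-true {B v} v∈R))
      ... | Z , lk with conn? Z x w
      ... | yes c = true≢false (∧-intro w∈B (dec-true (linked? w) (Z , proj₁ lk , proj₁ (proj₂ lk) , c))) w∉R
      ... | no ¬c = true≢false (∧-intro w∈B (dec-true (linked? w)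
                      (Extend.extend g v w jg (proj₁ (∧-true v∈R)) w∈B gB Z lk ¬c))) w∉R
      absurd : 2 ≤ # (inner G B ⊓ δ R) → ⊥
      absurd le with #-∃ _ (λ q → n≮0 (≤-trans le (≤-reflexive q)))
      ... | g , h with ∧-true {inner G B g} h
      ... | gB , δR with R (s g) in p | R (t g) in q
      ... | true | false = step g (s g) (t g) (Join-edge g) p (proj₂ (∧-true gB)) q gB
      ... | false | true = step g (t g) (s g) (Join-sym (Join-edge g)) q (proj₁ (∧-true gB)) p gB
      absurd le | g , h | gB , () | true | true
      absurd le | g , h | gB , () | false | false

∧-when : ∀ a {x y} → (a ≡ true → x ≡ y) → a ∧ x ≡ a ∧ y
∧-when true h = h refl
∧-when false _ = refl

-- Extending a flow of a contraction

module Growth (G : Graph) where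
  open EvenSets G
  open Ears G

  inner⊥inc : ∀ A e v → A v ≡ false → inner G A e ≡ true → inc e v ≡ false
  inner⊥inc A e v v∉ h with inc e v in i
  ... | false = refl
  ... | true with inc⇒end e v i
  ... | inj₁ p = ⊥-elim (true≢false (proj₁ (∧-true {A (s e)} h)) (trans (cong A p) v∉))
  ... | inj₂ p = ⊥-elim (true≢false (proj₂ (∧-true {A (s e)} h)) (trans (cong A p) v∉))

  ∂-off : ∀ A {S S′} → (∀ e → inner G A e ≡ false → S e ≡ S′ e) → ∀ v → A v ≡ false → ∂ S v ≡ ∂ S′ v
  ∂-off A {S} {S′} h v v∉ = ⨁-cong go
    where
    go : ∀ e → S e ∧ inc e v ≡ S′ e ∧ inc e v
    go e with inner G A e in q
    ... | false = cong (_∧ inc e v) (h e q)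
    ... | true = trans (trans (cong (S e ∧_) i) (∧-zeroʳ (S e))) (sym (trans (cong (S′ e ∧_) i) (∧-zeroʳ (S′ e))))
      where i = inner⊥inc A e v v∉ q

  -- Moving a defect of even total size to the root x along Z cancels it.
  balance : ∀ (S : Fin n → Bool) (x : Fin n) (Z χ : EdgeSet m) → (∀ v → S v ≡ true → Conn G Z x v) → ⨁ (λ v → S v ∧ ∂ χ v) ≡ false →
            ∃ λ D → D ⊑ Z × (∀ w → ∂ (χ ⊕ D) w ≡ ∂ χ w xor (S w ∧ ∂ χ w))
  balance S x Z χ conn zero-sum = D , D⊑Z , λ w → trans (∂-⊕ χ D w) (cong (∂ χ w xor_) (∂D w))
    where
    c : Fin n → Bool
    c v = S v ∧ ∂ χ v
    path : ∀ v → ∃ λ L → L ⊑ Z × (S v ≡ true → Join L x v)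
    path v with S v in q
    ... | true = let L , sub , j = conn⇒join (conn v q) in L , sub , λ _ → j
    ... | false = ∅ , (λ _ ()) , λ ()
    L : Fin n → EdgeSet m
    L v = proj₁ (path v)
    D : EdgeSet m
    D e = ⨁ (λ v → c v ∧ L v e)
    D⊑Z : D ⊑ Z
    D⊑Z e h with ⨁-∃ (λ v → c v ∧ L v e) h
    ... | v , q = proj₁ (proj₂ (path v)) e (proj₂ (∧-true {c v} q))
    cL : ∀ v w → c v ∧ ∂ (L v) w ≡ c v ∧ ((x == w) xor (v == w))
    cL v w = ∧-when (c v) (λ h → ∂J (proj₂ (proj₂ (path v)) (proj₁ (∧-true h))) w)
    ∂D : ∀ w → ∂ D w ≡ c w
    ∂D w = trans (⨁-cong λ e → trans (∧-comm (D e) (inc e w)) (sym (⨁-∧ (inc e w) (λ v → c v ∧ L v e))))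
      (trans (⨁-swap (λ e v → inc e w ∧ (c v ∧ L v e)))
      (trans (⨁-cong λ v → trans (⨁-cong λ e → bool₃ (λ i c l → i ∧ (c ∧ l)) (λ i c l → c ∧ (l ∧ i)) (inc e w) (c v) (L v e))
                                 (trans (⨁-∧ (c v) (λ e → L v e ∧ inc e w)) (cL v w)))
      (trans (⨁-cong λ v → bool₃ (λ c a b → c ∧ (a xor b)) (λ c a b → (a ∧ c) xor (b ∧ c)) (c v) (x == w) (v == w))
      (trans (⨁-xor (λ v → (x == w) ∧ c v) (λ v → (v == w) ∧ c v))
      (cong₂ _xor_ (trans (⨁-∧ (x == w) c) (trans (cong ((x == w) ∧_) zero-sum) (∧-zeroʳ (x == w)))) (⨁-single w c))))))

  -- (φ₁, φ₂) is a flow of the contraction G/U that vanishes only on edges of X.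
  record Cover (U : Fin n → Bool) : Set where
    constructor mkCover
    field
      X φ₁ φ₂ : EdgeSet m
      X-even  : Even X
      X-off   : X ⊑ inner G (∁ U)
      cons₁   : ∀ v → U v ≡ false → ∂ φ₁ v ≡ false
      cons₂   : ∀ v → U v ≡ false → ∂ φ₂ v ≡ false
      covers  : ∀ e → inner G U e ≡ false → X e ∨ (φ₁ e ∨ φ₂ e) ≡ true

  -- sp are the edges between U and S whose value in F₂² is chosen last; the other new edges
  -- outside Z get the value (1,0).
  record Repair (U S : Fin n → Bool) (sp : EdgeSet m) : Set where
    field
      sp-cross : ∀ e → sp e ≡ true → δ S e ≡ true × inner G (U ⊔ S) e ≡ true
      solve : ∀ ψ₁ ψ₂ → (∀ v → (U ⊔ S) v ≡ false → ∂ ψ₁ v ≡ false) → (∀ v → (U ⊔ S) v ≡ false → ∂ ψ₂ v ≡ false) →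
              ∃ λ a₁ → ∃ λ a₂ → a₁ ⊑ sp × a₂ ⊑ sp × (∀ e → sp e ≡ true → a₁ e ∨ a₂ e ≡ true) ×
              ⨁ (λ e → a₁ e ∧ δ S e) ≡ ⨁ (λ v → S v ∧ ∂ ψ₁ v) ×
              ⨁ (λ e → a₂ e ∧ δ S e) ≡ ⨁ (λ v → S v ∧ ∂ ψ₂ v)

  module Step (U S : Fin n → Bool) (disj : ∀ v → S v ≡ true → U v ≡ false)
              (x : Fin n) (Z : EdgeSet m) (Z-even : Even Z) (Z⊑ : Z ⊑ inner G S)
              (conn : ∀ v → S v ≡ true → Conn G Z x v)
              (sp : EdgeSet m) (rep : Repair U S sp) (ih : Cover (U ⊔ S)) where
    open Cover ih renaming (X to X′; φ₁ to φ₁′; φ₂ to φ₂′; X-even to X′-even; X-off to X′-off;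
                            cons₁ to cons₁′; cons₂ to cons₂′; covers to covers′)
    open Repair rep
    U′ = U ⊔ S
    I = inner G U′

    S⊑U′ : inner G S ⊑ I
    S⊑U′ e h = let a , b = ∧-true {S (s e)} h in ∧-intro (∨-introʳ {U (s e)} a) (∨-introʳ {U (t e)} b)

    ψ₁ ψ₂ : EdgeSet m
    ψ₁ e = if I e then not (Z e) ∧ not (sp e) else φ₁′ e
    ψ₂ e = if I e then false else φ₂′ e

    ψ₁-off : ∀ e → I e ≡ false → ψ₁ e ≡ φ₁′ e
    ψ₁-off e q rewrite q = refl
    ψ₂-off : ∀ e → I e ≡ false → ψ₂ e ≡ φ₂′ e
    ψ₂-off e q rewrite q = refl

    sol = solve ψ₁ ψ₂ (λ v q → trans (∂-off U′ {ψ₁} {φ₁′} ψ₁-off v q) (cons₁′ v q))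
                      (λ v q → trans (∂-off U′ {ψ₂} {φ₂′} ψ₂-off v q) (cons₂′ v q))
    a₁ a₂ : EdgeSet m
    a₁ = proj₁ sol
    a₂ = proj₁ (proj₂ sol)
    a₁⊑ : a₁ ⊑ sp
    a₁⊑ = proj₁ (proj₂ (proj₂ sol))
    a₂⊑ : a₂ ⊑ sp
    a₂⊑ = proj₁ (proj₂ (proj₂ (proj₂ sol)))
    a-cov : ∀ e → sp e ≡ true → a₁ e ∨ a₂ e ≡ true
    a-cov = proj₁ (proj₂ (proj₂ (proj₂ (proj₂ sol))))
    sum₁ = proj₁ (proj₂ (proj₂ (proj₂ (proj₂ (proj₂ sol)))))
    sum₂ = proj₂ (proj₂ (proj₂ (proj₂ (proj₂ (proj₂ sol)))))

    χ₁ χ₂ : EdgeSet m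
    χ₁ = ψ₁ ⊕ a₁
    χ₂ = ψ₂ ⊕ a₂

    zero-sum : ∀ (ψ a : EdgeSet m) → ⨁ (λ e → a e ∧ δ S e) ≡ ⨁ (λ v → S v ∧ ∂ ψ v) → ⨁ (λ v → S v ∧ ∂ (ψ ⊕ a) v) ≡ false
    zero-sum ψ a h = trans (⨁-cong λ v → trans (cong (S v ∧_) (∂-⊕ ψ a v)) (∧-distribˡ-xor (S v) (∂ ψ v) (∂ a v)))
      (trans (⨁-xor (λ v → S v ∧ ∂ ψ v) (λ v → S v ∧ ∂ a v))
        (trans (cong₂ _xor_ (sym h) (cut-parity S a)) (xor-same (⨁ (λ e → a e ∧ δ S e)))))

    D₁ = balance S x Z χ₁ conn (zero-sum ψ₁ a₁ sum₁)
    D₂ = balance S x Z χ₂ conn (zero-sum ψ₂ a₂ sum₂)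

    Φ₁ Φ₂ : EdgeSet m
    Φ₁ = χ₁ ⊕ proj₁ D₁
    Φ₂ = χ₂ ⊕ proj₁ D₂

    D-off : ∀ {D : EdgeSet m} → D ⊑ Z → ∀ e → I e ≡ false → D e ≡ false
    D-off sub e q = ≢true (λ h → true≢false (S⊑U′ e (Z⊑ e (sub e h))) q)
    a-off : ∀ {a : EdgeSet m} → a ⊑ sp → ∀ e → I e ≡ false → a e ≡ false
    a-off sub e q = ≢true (λ h → true≢false (proj₂ (sp-cross e (sub e h))) q)

    Φ-off : ∀ (ψ φ a D : EdgeSet m) → (∀ e → I e ≡ false → ψ e ≡ φ e) → a ⊑ sp → D ⊑ Z → ∀ e → I e ≡ false → ((ψ ⊕ a) ⊕ D) e ≡ φ e
    Φ-off ψ φ a D h sa sD e q =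
      trans (cong₂ (λ p r → (ψ e xor p) xor r) (a-off sa e q) (D-off sD e q))
        (trans (xor-identityʳ _) (trans (xor-identityʳ _) (h e q)))

    cons : ∀ (ψ φ a : EdgeSet m) (D : ∃ λ D → D ⊑ Z × (∀ w → ∂ ((ψ ⊕ a) ⊕ D) w ≡ ∂ (ψ ⊕ a) w xor (S w ∧ ∂ (ψ ⊕ a) w))) →
           (∀ e → I e ≡ false → ψ e ≡ φ e) → a ⊑ sp → (∀ v → U′ v ≡ false → ∂ φ v ≡ false) →
           ∀ v → U v ≡ false → ∂ ((ψ ⊕ a) ⊕ proj₁ D) v ≡ false
    cons ψ φ a (D , sD , h) off sa old v v∉U with S v in q
    ... | true = trans (h v) (trans (cong (λ b → ∂ (ψ ⊕ a) v xor (b ∧ ∂ (ψ ⊕ a) v)) q) (xor-same (∂ (ψ ⊕ a) v)))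
    ... | false = trans (∂-off U′ {(ψ ⊕ a) ⊕ D} {φ} (Φ-off ψ φ a D off sa sD) v out) (old v out)
      where
      out : U′ v ≡ false
      out = cong₂ _∨_ v∉U q

    -- A new edge is covered by `Z`, by its value on `sp`, or by (1,0). The values on `sp` make the
    -- total defect over `S` vanish. Cancelling the defect then changes values only along `Z`, where
    -- coverage does not depend on them.
    result : Cover U
    result = mkCover (X′ ⊕ Z) Φ₁ Φ₂ (Even-⊕ X′-even Z-even) X-off
      (cons ψ₁ φ₁′ a₁ D₁ ψ₁-off a₁⊑ cons₁′) (cons ψ₂ φ₂′ a₂ D₂ ψ₂-off a₂⊑ cons₂′) cov
      where
      X-off : (X′ ⊕ Z) ⊑ inner G (∁ U)
      X-off e h with xor-true {X′ e} h
      ... | inj₁ p = let a , b = ∧-true {not (U′ (s e))} (X′-off e p) in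
                     ∧-intro (go (U (s e)) a) (go (U (t e)) b)
        where
        go : ∀ u {v} → not (u ∨ v) ≡ true → not u ≡ true
        go false _ = refl
      ... | inj₂ p = let a , b = ∧-true {S (s e)} (Z⊑ e p) in
                     ∧-intro (cong not (disj _ a)) (cong not (disj _ b))
      cov : ∀ e → inner G U e ≡ false → (X′ ⊕ Z) e ∨ (Φ₁ e ∨ Φ₂ e) ≡ true
      cov e q with bool-split (I e)
      ... | inj₂ i = subst (λ b → b ≡ true) (sym (cong₂ _∨_
              (trans (cong (X′ e xor_) (D-off {Z} (λ _ h → h) e i)) (xor-identityʳ (X′ e)))
              (cong₂ _∨_ (Φ-off ψ₁ φ₁′ a₁ (proj₁ D₁) ψ₁-off a₁⊑ (proj₁ (proj₂ D₁)) e i)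
                         (Φ-off ψ₂ φ₂′ a₂ (proj₁ D₂) ψ₂-off a₂⊑ (proj₁ (proj₂ D₂)) e i)))) (covers′ e i)
      ... | inj₁ i with bool-split (Z e)
      ... | inj₁ z = ∨-introˡ (cong₂ _xor_ X′e z)
        where
        X′e : X′ e ≡ false
        X′e = ≢true (λ h → true≢false (proj₁ (∧-true {U′ (s e)} i)) (not-true (proj₁ (∧-true {not (U′ (s e))} (X′-off e h)))))
      ... | inj₂ z with bool-split (sp e)
      ... | inj₁ p = ∨-introʳ {(X′ ⊕ Z) e} (trans (cong₂ _∨_ (val₁ a₁ (proj₁ D₁) (proj₁ (proj₂ D₁))) (val₂ a₂ (proj₁ D₂) (proj₁ (proj₂ D₂)))) (a-cov e p))
        where
        ¬D : ∀ (D : EdgeSet m) → D ⊑ Z → D e ≡ false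
        ¬D D sub = ≢true (λ h → true≢false (sub e h) z)
        val₁ : ∀ a D → D ⊑ Z → ((ψ₁ ⊕ a) ⊕ D) e ≡ a e
        val₁ a D sub = trans (cong₂ (λ y d → (y xor a e) xor d) ψe (¬D D sub)) (xor-identityʳ _)
          where
          ψe : ψ₁ e ≡ false
          ψe rewrite i | p = ∧-zeroʳ (not (Z e))
        val₂ : ∀ a D → D ⊑ Z → ((ψ₂ ⊕ a) ⊕ D) e ≡ a e
        val₂ a D sub = trans (cong₂ (λ y d → (y xor a e) xor d) ψe (¬D D sub)) (xor-identityʳ _)
          where
          ψe : ψ₂ e ≡ false
          ψe rewrite i = refl
      ... | inj₂ p = ∨-introʳ {(X′ ⊕ Z) e} (∨-introˡ (trans (cong₂ (λ y d → (ψ₁ e xor y) xor d) ¬a ¬D)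
                       (trans (xor-identityʳ _) (trans (xor-identityʳ _) ψe))))
        where
        ¬D : proj₁ D₁ e ≡ false
        ¬D = ≢true (λ h → true≢false (proj₁ (proj₂ D₁) e h) z)
        ¬a : a₁ e ≡ false
        ¬a = ≢true (λ h → true≢false (a₁⊑ e h) p)
        ψe : ψ₁ e ≡ true
        ψe rewrite i | z | p = refl

-- A smallest set with at most one edge to the rest

data Place : Set where
  used rest low high : Place

all-places : (Place → Bool) → Bool
all-places p = (p used ∧ p rest) ∧ (p low ∧ p high)

all-places-sound : ∀ p → T (all-places p) → ∀ a → T (p a)
all-places-sound p h a with p used in e₁ | p rest in e₂ | p low in e₃ | p high in e₄
all-places-sound p h used | true | true | true | true = subst T (sym e₁) tt
all-places-sound p h rest | true | true | true | true = subst T (sym e₂) tt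
all-places-sound p h low  | true | true | true | true = subst T (sym e₃) tt
all-places-sound p h high | true | true | true | true = subst T (sym e₄) tt

isUsed isLow isHigh isB : Place → Bool
isUsed used = true
isUsed _ = false
isLow low = true
isLow _ = false
isHigh high = true
isHigh _ = false
isB p = isLow p ∨ isHigh p

leaving : (G : Graph) → (U A : Fin (Graph.n G) → Bool) → EdgeSet (Graph.m G)
leaving G U A e = (A (src G e) xor A (tgt G e)) ∧ (not (U (src G e)) ∧ not (U (tgt G e)))

-- Here `used` stands for `U`, `low` and `high` for the two parts of `B`, and `rest` for the
-- remaining vertices. An edge between the two parts leaves both of them; any other edge that leaves
-- a part and avoids `U` leaves `B`. The sixteen positions of the two ends are checked by
-- evaluation.
leaving-split : ∀ p q →
  𝟙 ((isLow p xor isLow q) ∧ (not (isUsed p) ∧ not (isUsed q)))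
  + 𝟙 ((isHigh p xor isHigh q) ∧ (not (isUsed p) ∧ not (isUsed q)))
  ≤ (𝟙 ((isB p ∧ isB q) ∧ (isLow p xor isLow q)) + 𝟙 ((isB p ∧ isB q) ∧ (isLow p xor isLow q)))
    + 𝟙 ((isB p xor isB q) ∧ (not (isUsed p) ∧ not (isUsed q)))
leaving-split p q = ≤ᵇ⇒≤ _ _ (all-places-sound (λ q → f p q ≤ᵇ g p q)
  (all-places-sound (λ p → all-places (λ q → f p q ≤ᵇ g p q)) tt p) q)
  where
  f g : Place → Place → ℕ
  f p q = 𝟙 ((isLow p xor isLow q) ∧ (not (isUsed p) ∧ not (isUsed q)))
          + 𝟙 ((isHigh p xor isHigh q) ∧ (not (isUsed p) ∧ not (isUsed q)))
  g p q = (𝟙 ((isB p ∧ isB q) ∧ (isLow p xor isLow q)) + 𝟙 ((isB p ∧ isB q) ∧ (isLow p xor isLow q)))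
          + 𝟙 ((isB p xor isB q) ∧ (not (isUsed p) ∧ not (isUsed q)))

module GrowthStep (G : Graph) where
  open EvenSets G
  open Ears G
  open Growth G

  -- Every component is 3-edge-connected.
  Thick : Set
  Thick = ∀ A → # (δ A) ≡ 0 ⊎ 3 ≤ # (δ A)

  -- The complement of `U` is a candidate, because no edge leaves it while avoiding `U`. Hence a
  -- smallest candidate exists.
  Cand : (U B : Fin n → Bool) → Set
  Cand U B = (∀ v → B v ≡ true → U v ≡ false) × ∃ (λ v → B v ≡ true) × # (leaving G U B) ≤ 1

  cand? : ∀ U B → Dec (Cand U B)
  cand? U B = disj? ×-dec (any? (λ v → B v ≟ᵇ true) ×-dec (# (leaving G U B) ≤? 1))
    where
    disj? = map′ (λ h v q → not-true (h v q)) (λ h v q → cong not (h v q)) (⊑? B (∁ U))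

  cand-resp : ∀ U → Respects≗ (Cand U)
  cand-resp U {f} {g} h (a , (v , b) , c) = (λ w q → a w (trans (h w) q)) , (v , trans (sym (h v)) b) ,
    subst (_≤ 1) (#-cong (λ e → cong₂ (λ x y → (x xor y) ∧ _) (h (s e)) (h (t e)))) c

  module _ (U B : Fin n → Bool) (cand : Cand U B) (least : ∀ B′ → Cand U B′ → # B ≤ # B′) where
    B∩U : ∀ v → B v ≡ true → U v ≡ false
    B∩U = proj₁ cand

    -- Each part of a proper split of `B` is smaller than `B`, so by minimality at least two edges
    -- leave it while avoiding `U`. With at most one edge between the parts, `leaving-split` would
    -- give 2 + 2 ≤ 1 + 1 + 1.
    two-conn : TwoConn B
    two-conn A A⊑B (x , x∈A) (y , y∈B , y∉A) with 2 ≤? # (inner G B ⊓ δ A)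
    ... | yes p = p
    ... | no ¬p = ⊥-elim (<⇒≱ (s≤s bound) (+-mono-≤ big-A big-H))
      where
      H : Fin n → Bool
      H = B ⊖ A
      big : ∀ A′ → A′ ⊑ B → ∃ (λ v → A′ v ≡ true) → (∃ λ w → B w ≡ true × A′ w ≡ false) → 2 ≤ # (leaving G U A′)
      big A′ sub ne (w , w∈B , w∉A′) with # (leaving G U A′) ≤? 1
      ... | no ¬l = ≰⇒> ¬l
      ... | yes l = ⊥-elim (<⇒≱ (#-mono-< sub w w∈B w∉A′)
                      (least A′ ((λ v q → B∩U v (sub v q)) , ne , l)))
      big-A = big A A⊑B (x , x∈A) (y , y∈B , y∉A)
      big-H = big H (λ v h → proj₁ (∧-true h)) (y , ∧-intro y∈B (cong not y∉A))
                (x , A⊑B x x∈A , trans (cong (λ b → B x ∧ not b) x∈A) (∧-zeroʳ (B x)))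
      place : Fin n → Place
      place v = if U v then used else (if A v then low else (if B v then high else rest))
      pU : ∀ v → isUsed (place v) ≡ U v
      pU v with U v | A v | B v
      ... | true | _ | _ = refl
      ... | false | true | _ = refl
      ... | false | false | true = refl
      ... | false | false | false = refl
      pA : ∀ v → isLow (place v) ≡ A v
      pA v with U v in p | A v in q | B v in r
      ... | true | true | true = ⊥-elim (true≢false p (B∩U v r))
      ... | true | true | false = ⊥-elim (true≢false (A⊑B v q) r)
      ... | true | false | _ = refl
      ... | false | true | _ = refl
      ... | false | false | true = refl
      ... | false | false | false = refl
      pH : ∀ v → isHigh (place v) ≡ H v
      pH v with U v in p | A v in q | B v in r
      ... | true | _ | true = ⊥-elim (true≢false p (B∩U v r))
      ... | true | true | false = refl
      ... | true | false | false = refl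
      ... | false | true | true = refl
      ... | false | true | false = refl
      ... | false | false | true = refl
      ... | false | false | false = refl
      pB : ∀ v → isB (place v) ≡ B v
      pB v = trans (cong₂ _∨_ (pA v) (pH v)) (go (A v) (B v) (A⊑B v))
        where
        go : ∀ a b → (a ≡ true → b ≡ true) → a ∨ (b ∧ not a) ≡ b
        go true b h = sym (h refl)
        go false b h = ∧-identityʳ b
      pointwise : ∀ e → 𝟙 (leaving G U A e) + 𝟙 (leaving G U H e)
                  ≤ (𝟙 ((inner G B ⊓ δ A) e) + 𝟙 ((inner G B ⊓ δ A) e)) + 𝟙 (leaving G U B e)
      pointwise e = subst₂ _≤_
        (cong₂ _+_ (cong 𝟙 (cong₂ _∧_ (cong₂ _xor_ (pA (s e)) (pA (t e))) nn))
                   (cong 𝟙 (cong₂ _∧_ (cong₂ _xor_ (pH (s e)) (pH (t e))) nn)))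
        (cong₂ _+_ (cong (λ b → 𝟙 b + 𝟙 b) (cong₂ _∧_ (cong₂ _∧_ (pB (s e)) (pB (t e))) (cong₂ _xor_ (pA (s e)) (pA (t e)))))
                   (cong 𝟙 (cong₂ _∧_ (cong₂ _xor_ (pB (s e)) (pB (t e))) nn)))
        (leaving-split (place (s e)) (place (t e)))
        where
        nn = cong₂ (λ x y → not x ∧ not y) (pU (s e)) (pU (t e))
      bound : # (leaving G U A) + # (leaving G U H) ≤ 3
      bound = ≤-trans (≤-reflexive (sym (∑-+ (𝟙 ∘ leaving G U A) (𝟙 ∘ leaving G U H))))
        (≤-trans (∑-mono pointwise)
        (≤-trans (≤-reflexive (trans (∑-+ (λ e → 𝟙 (c e) + 𝟙 (c e)) (𝟙 ∘ leaving G U B))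
                   (cong (_+ # (leaving G U B)) (∑-+ (𝟙 ∘ c) (𝟙 ∘ c)))))
          (+-mono-≤ (+-mono-≤ c≤ c≤) (proj₂ (proj₂ cand)))))
        where
        c = inner G B ⊓ δ A
        c≤ : # c ≤ 1
        c≤ = s≤s⁻¹ (≰⇒> ¬p)

    to-U : EdgeSet m
    to-U e = δ B e ∧ (U (s e) ∨ U (t e))

    δB-split : # (δ B) ≡ # to-U + # (leaving G U B)
    δB-split = trans (#-split (δ B) (λ e → U (s e) ∨ U (t e)))
      (cong (# to-U +_) (#-cong (λ e → bool₃ (λ d a b → d ∧ not (a ∨ b)) (λ d a b → d ∧ (not a ∧ not b)) (δ B e) (U (s e)) (U (t e)))))

    to-U-ends : ∀ e → to-U e ≡ true → (B (s e) ≡ true × U (t e) ≡ true) ⊎ (B (t e) ≡ true × U (s e) ≡ true)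
    to-U-ends e h with ∧-true {δ B e} h
    ... | d , u with B (s e) in p | B (t e) in q | ∨-true {U (s e)} u
    ... | true | false | inj₂ ut = inj₁ (refl , ut)
    ... | true | false | inj₁ us = ⊥-elim (true≢false us (B∩U _ p))
    ... | false | true | inj₁ us = inj₂ (refl , us)
    ... | false | true | inj₂ ut = ⊥-elim (true≢false ut (B∩U _ q))
    to-U-ends e h | () , u | true | true | _
    to-U-ends e h | () , u | false | false | _

    endB : ∀ e → to-U e ≡ true → Fin n
    endB e h with to-U-ends e h
    ... | inj₁ _ = s e
    ... | inj₂ _ = t e

    endB∈ : ∀ e h → B (endB e h) ≡ true
    endB∈ e h with to-U-ends e h
    ... | inj₁ (p , _) = p
    ... | inj₂ (p , _) = p

    Progress : Set
    Progress = (∀ S → ∃ (λ v → S v ≡ true) → (∀ v → S v ≡ true → U v ≡ false) → Cover (U ⊔ S)) → Cover U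

    -- One vertex `z` of `B` is added to `U`, with empty `Z` and no edge left to choose.
    -- Conservation at `z` follows from that at the other vertices of `B`, since no edge leaves `B`.
    closed-progress : # (δ B) ≡ 0 → Progress
    closed-progress h rec = Step.result U S disj z ∅ Even-∅ (λ _ ()) conn ∅ rep (rec S (z , ==-refl z) disj)
      where
      z = proj₁ (proj₁ (proj₂ cand))
      z∈B = proj₂ (proj₁ (proj₂ cand))
      S = z ==_
      disj : ∀ v → (z == v) ≡ true → U v ≡ false
      disj v q = subst (λ v → U v ≡ false) (==-≡ q) (B∩U z z∈B)
      conn : ∀ v → (z == v) ≡ true → Conn G ∅ z v
      conn v q with ==-≡ {u = z} q
      ... | refl = here
      δB : ∀ e → δ B e ≡ false
      δB e = ≢true (λ q → n≮0 (≤-trans (#-pos (δ B) e q) (≤-reflexive h)))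
      sumz : ∀ ψ → (∀ v → (U ⊔ S) v ≡ false → ∂ ψ v ≡ false) → ⨁ (λ v → S v ∧ ∂ ψ v) ≡ false
      sumz ψ cons = trans (⨁-cong go) (trans (cut-parity B ψ) (⨁-false (λ e → trans (cong (ψ e ∧_) (δB e)) (∧-zeroʳ (ψ e)))))
        where
        go : ∀ v → S v ∧ ∂ ψ v ≡ B v ∧ ∂ ψ v
        go v with z ≟ v | B v in b
        ... | yes refl | true = refl
        ... | yes refl | false = ⊥-elim (true≢false z∈B b)
        ... | no _ | false = refl
        ... | no z≢v | true = sym (cons v (cong₂ _∨_ (B∩U v b) (==-≢ z≢v)))
      rep : Repair U S ∅
      rep = record
        { sp-cross = λ _ ()
        ; solve = λ ψ₁ ψ₂ c₁ c₂ → ∅ , ∅ , (λ _ ()) , (λ _ ()) , (λ _ ()) ,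
            trans (⨁-false {m} {λ _ → false} (λ _ → refl)) (sym (sumz ψ₁ c₁)) ,
            trans (⨁-false {m} {λ _ → false} (λ _ → refl)) (sym (sumz ψ₂ c₂)) }

    -- F₂² has four elements, so a value avoiding both 0 and b exists.
    avoid : ∀ b₁ b₂ → ∃ λ α₁ → ∃ λ α₂ → α₁ ∨ α₂ ≡ true × (α₁ xor b₁) ∨ (α₂ xor b₂) ≡ true
    avoid false false = true , false , refl , refl
    avoid true false = false , true , refl , refl
    avoid false true = true , false , refl , refl
    avoid true true = true , false , refl , refl

    -- The ends in `B` of two edges to `U` lie on a common connected even set, whose vertices are
    -- added to `U`. The total defect of these vertices is repaired on the two edges alone: they get
    -- values α and α + b in F₂² for the prescribed sum b, both nonzero by `avoid`.
    open-progress : 2 ≤ # to-U → Progress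
    open-progress le rec with two-elements to-U le
    ... | e₁ , e₂ , e₁≢e₂ , h₁ , h₂ with linked B two-conn (endB e₁ h₁) (endB∈ e₁ h₁) (endB e₂ h₂) (endB∈ e₂ h₂)
    ... | Z₀ , Z₀⊑ , Z₀-even , c₁₂ =
      Step.result U S disj x Z (Even-comp Z₀ x Z₀-even) (comp⊑inner Z₀ x)
        (λ v h → conn-comp (reach-conn {Z₀} h)) sp rep (rec S (x , reach-refl Z₀ x) disj)
      where
      x = endB e₁ h₁
      Z = comp Z₀ x
      S = reach Z₀ x
      S⊑B : S ⊑ B
      S⊑B v h = conn-inner Z₀⊑ (endB∈ e₁ h₁) (reach-conn {Z₀} h)
      disj : ∀ v → S v ≡ true → U v ≡ false
      disj v h = B∩U v (S⊑B v h)
      sp : EdgeSet m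
      sp e = (e₁ == e) ∨ (e₂ == e)
      cross : ∀ e h → S (endB e h) ≡ true → δ S e ≡ true × inner G (U ⊔ S) e ≡ true
      cross e h r with to-U-ends e h
      ... | inj₁ (_ , u) = cong₂ _xor_ r (≢true (λ q → true≢false u (disj _ q))) , ∧-intro (∨-introʳ {U (s e)} r) (∨-introˡ u)
      ... | inj₂ (_ , u) = cong₂ _xor_ (≢true (λ q → true≢false u (disj _ q))) r , ∧-intro (∨-introˡ u) (∨-introʳ {U (t e)} r)
      cross₁ = cross e₁ h₁ (reach-refl Z₀ x)
      cross₂ = cross e₂ h₂ (conn-reach c₁₂)
      spread : Bool → Bool → EdgeSet m
      spread α β e = ((e == e₁) ∧ α) xor ((e == e₂) ∧ β)
      spread⊑ : ∀ α β → spread α β ⊑ sp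
      spread⊑ α β e h with xor-true {(e == e₁) ∧ α} h
      ... | inj₁ q = ∨-introˡ (trans (==-sym e₁ e) (proj₁ (∧-true q)))
      ... | inj₂ q = ∨-introʳ {e₁ == e} (trans (==-sym e₂ e) (proj₁ (∧-true q)))
      spread₁ : ∀ α β → spread α β e₁ ≡ α
      spread₁ α β = trans (cong₂ (λ p q → (p ∧ α) xor (q ∧ β)) (==-refl e₁) (==-≢ e₁≢e₂)) (xor-identityʳ α)
      spread₂ : ∀ α β → spread α β e₂ ≡ β
      spread₂ α β = cong₂ (λ p q → (p ∧ α) xor (q ∧ β)) (==-≢ (λ q → e₁≢e₂ (sym q))) (==-refl e₂)
      sum-spread : ∀ α b → ⨁ (λ e → spread α (α xor b) e ∧ δ S e) ≡ b
      sum-spread α b = trans (⨁-cong λ e →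
           trans (∧-distribʳ-xor (δ S e) ((e == e₁) ∧ α) ((e == e₂) ∧ (α xor b)))
             (cong₂ _xor_ (∧-assoc (e == e₁) α (δ S e)) (∧-assoc (e == e₂) (α xor b) (δ S e))))
        (trans (⨁-xor (λ e → (e == e₁) ∧ (α ∧ δ S e)) (λ e → (e == e₂) ∧ ((α xor b) ∧ δ S e)))
        (trans (cong₂ _xor_ (⨁-single e₁ (λ e → α ∧ δ S e)) (⨁-single e₂ (λ e → (α xor b) ∧ δ S e)))
        (trans (cong₂ (λ p q → (α ∧ p) xor ((α xor b) ∧ q)) (proj₁ cross₁) (proj₁ cross₂))
          (bool₂ (λ α b → (α ∧ true) xor ((α xor b) ∧ true)) (λ α b → b) α b))))
      rep : Repair U S sp
      rep = record { sp-cross = sc ; solve = sv }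
        where
        sc : ∀ e → sp e ≡ true → δ S e ≡ true × inner G (U ⊔ S) e ≡ true
        sc e h with ∨-true {e₁ == e} h
        ... | inj₁ q = subst (λ e → δ S e ≡ true × inner G (U ⊔ S) e ≡ true) (==-≡ q) cross₁
        ... | inj₂ q = subst (λ e → δ S e ≡ true × inner G (U ⊔ S) e ≡ true) (==-≡ q) cross₂
        sv : ∀ ψ₁ ψ₂ → _ → _ → _
        sv ψ₁ ψ₂ _ _ with avoid (⨁ (λ v → S v ∧ ∂ ψ₁ v)) (⨁ (λ v → S v ∧ ∂ ψ₂ v))
        ... | α₁ , α₂ , p , q = spread α₁ (α₁ xor b₁) , spread α₂ (α₂ xor b₂) ,
            spread⊑ α₁ (α₁ xor b₁) , spread⊑ α₂ (α₂ xor b₂) , cov , sum-spread α₁ b₁ , sum-spread α₂ b₂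
          where
          b₁ = ⨁ (λ v → S v ∧ ∂ ψ₁ v)
          b₂ = ⨁ (λ v → S v ∧ ∂ ψ₂ v)
          cov : ∀ e → sp e ≡ true → spread α₁ (α₁ xor b₁) e ∨ spread α₂ (α₂ xor b₂) e ≡ true
          cov e h with ∨-true {e₁ == e} h
          ... | inj₁ r with ==-≡ {u = e₁} r
          ... | refl = trans (cong₂ _∨_ (spread₁ α₁ (α₁ xor b₁)) (spread₁ α₂ (α₂ xor b₂))) p
          cov e h | inj₂ r with ==-≡ {u = e₂} r
          ... | refl = trans (cong₂ _∨_ (spread₂ α₁ (α₁ xor b₁)) (spread₂ α₂ (α₂ xor b₂))) q

    progress : Thick → Progress
    progress thick with thick B
    ... | inj₁ h = closed-progress h
    -- At least three edges leave `B` and at most one of them avoids `U`, so at least two lead to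
    -- `U`.
    ... | inj₂ h = open-progress (+-cancelʳ-≤ 1 2 (# to-U)
                     (≤-trans (≤-trans h (≤-reflexive δB-split)) (+-monoʳ-≤ (# to-U) (proj₂ (proj₂ cand)))))

  grow : Thick → ∀ k U → # (∁ U) ≤ k → Cover U
  grow thick k U le with any? (λ v → U v ≟ᵇ false)
  ... | no none = mkCover ∅ ∅ ∅ Even-∅ (λ _ ()) (λ v q → ⊥-elim (none (v , q))) (λ v q → ⊥-elim (none (v , q)))
                    (λ e q → ⊥-elim (true≢false (∧-intro (full (s e)) (full (t e))) q))
    where
    full : ∀ v → U v ≡ true
    full v = ≢false (λ q → none (v , q))
  grow thick zero U le | yes (z , z∉) = ⊥-elim (<⇒≱ (#-pos (∁ U) z (cong not z∉)) le)
  grow thick (suc k) U le | yes (z , z∉)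
    with least-# (cand-resp U) (cand? U) (# (∁ U)) (∁ U) ≤-refl
           ((λ v q → not-true q) , (z , cong not z∉) , ≤-trans (≤-reflexive (#-∅ none)) z≤n)
    where
    none : ∀ e → leaving G U (∁ U) e ≡ false
    none e = bool₂ (λ a b → (not a xor not b) ∧ (not a ∧ not b)) (λ _ _ → false) (U (s e)) (U (t e))
  ... | B , cand , least = progress U B cand least thick rec
    where
    rec : ∀ S → ∃ (λ v → S v ≡ true) → (∀ v → S v ≡ true → U v ≡ false) → Cover (U ⊔ S)
    rec S (v , v∈S) disj = grow thick k (U ⊔ S) (s≤s⁻¹ (≤-trans (#-mono-< sub v (cong not (disj v v∈S)) vv) le))
      where
      sub : ∁ (U ⊔ S) ⊑ ∁ U
      sub w h with U w
      ... | false = refl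
      ... | true = h
      vv : ∁ (U ⊔ S) v ≡ false
      vv = cong not (∨-introʳ {U v} v∈S)

-- Removing cuts of size two by contraction

EverywhereEven : Graph → Set
EverywhereEven G = ∀ e → ∃ λ S → EvenSets.Even G S × S e ≡ true

record EightFlow (G : Graph) : Set where
  constructor mkFlow
  field
    V₁ V₂ V₃ : EdgeSet (Graph.m G)
    even₁ : EvenSets.Even G V₁
    even₂ : EvenSets.Even G V₂
    even₃ : EvenSets.Even G V₃
    covered : ∀ e → V₁ e ∨ (V₂ e ∨ V₃ e) ≡ true

nonloop : (G : Graph) → EdgeSet (Graph.m G)
nonloop G e = not (src G e == tgt G e)

relabel : ∀ {n} → Fin n → Fin n → Fin n → Fin n
relabel a b w = if w == a then b else w

module Contract (G : Graph) (e : Fin (Graph.m G)) (e-nonloop : nonloop G e ≡ true) where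
  open EvenSets G
  a b : Fin n
  a = s e
  b = t e

  a≢b : ¬ a ≡ b
  a≢b p = true≢false e-nonloop (cong not (trans (cong (_== t e) p) (==-refl (t e))))

  -- The vertex `a` is kept as an isolated one and `e` as a loop, so edge sets of both graphs have
  -- the same type. Progress is measured by the number of edges that are not loops.
  G/e : Graph
  G/e = record { n = n ; m = m ; ends = λ f → relabel a b (s f) , relabel a b (t f) }

  module C = EvenSets G/e

  relabel-== : ∀ x w → (relabel a b x == w) ≡ (not (w == a) ∧ ((x == w) xor ((w == b) ∧ (x == a))))
  relabel-== x w with x ≟ a | w ≟ a
  ... | yes refl | yes refl = ==-≢ (λ p → a≢b (sym p))
  ... | no x≢a | yes refl = ==-≢ x≢a
  ... | yes refl | no w≢a = trans (==-sym b w) (sym (trans (cong (_xor ((w == b) ∧ true)) (==-≢ (λ p → w≢a (sym p)))) (∧-identityʳ (w == b))))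
  ... | no x≢a | no w≢a = sym (trans (cong ((x == w) xor_) (∧-zeroʳ (w == b))) (xor-identityʳ (x == w)))

  C-inc : ∀ f w → C.inc f w ≡ not (w == a) ∧ (inc f w xor ((w == b) ∧ inc f a))
  C-inc f w = trans (cong₂ _xor_ (relabel-== (s f) w) (relabel-== (t f) w)) (go (not (w == a)) (s f == w) (t f == w) (w == b) (s f == a) (t f == a))
    where
    go : ∀ k p q r x y → (k ∧ (p xor (r ∧ x))) xor (k ∧ (q xor (r ∧ y))) ≡ k ∧ ((p xor q) xor (r ∧ (x xor y)))
    go false _ _ _ _ _ = refl
    go true p q false x y = bool₂ (λ p q → (p xor false) xor (q xor false)) (λ p q → (p xor q) xor false) p q
    go true p q true x y = bool₄ (λ p q x y → (p xor x) xor (q xor y)) (λ p q x y → (p xor q) xor (x xor y)) p q x y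

  C-∂ : ∀ S w → C.∂ S w ≡ not (w == a) ∧ (∂ S w xor ((w == b) ∧ ∂ S a))
  C-∂ S w = trans (⨁-cong λ f → trans (cong (S f ∧_) (C-inc f w)) (go (S f) (not (w == a)) (inc f w) (w == b) (inc f a)))
    (trans (⨁-∧ (not (w == a)) (λ f → (S f ∧ inc f w) xor ((w == b) ∧ (S f ∧ inc f a))))
      (cong (not (w == a) ∧_) (trans (⨁-xor (λ f → S f ∧ inc f w) (λ f → (w == b) ∧ (S f ∧ inc f a)))
        (cong (∂ S w xor_) (⨁-∧ (w == b) (λ f → S f ∧ inc f a))))))
    where
    go : ∀ x k i r j → x ∧ (k ∧ (i xor (r ∧ j))) ≡ k ∧ ((x ∧ i) xor (r ∧ (x ∧ j)))
    go true k i r j = refl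
    go false k i r j = bool₂ (λ _ _ → false) (λ k r → k ∧ (false xor (r ∧ false))) k r

  Even⇒C : ∀ {S} → Even S → C.Even S
  Even⇒C {S} ev = C.mkEven λ w → trans (C-∂ S w) (trans (cong₂ (λ x y → not (w == a) ∧ (x xor ((w == b) ∧ y))) (∂0 ev w) (∂0 ev a))
    (bool₂ (λ k r → not k ∧ (false xor (r ∧ false))) (λ _ _ → false) (w == a) (w == b)))

  -- Contraction merges the boundaries at `a` and `b`. The value on `e` is changed so that the
  -- boundary at `a` vanishes; the one at `b` then vanishes as well.
  lift : EdgeSet m → EdgeSet m
  lift S f = S f xor ((f == e) ∧ ∂ S a)

  ∂-lift : ∀ S w → ∂ (lift S) w ≡ ∂ S w xor (inc e w ∧ ∂ S a)
  ∂-lift S w = trans (∂-⊕ S (λ f → (f == e) ∧ ∂ S a) w) (cong (∂ S w xor_)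
    (trans (⨁-cong λ f → bool₃ (λ p x i → (p ∧ x) ∧ i) (λ p x i → p ∧ (i ∧ x)) (f == e) (∂ S a) (inc f w))
           (⨁-single e (λ f → inc f w ∧ ∂ S a))))

  lift-even : ∀ {S} → C.Even S → Even (lift S)
  lift-even {S} ev = mkEven λ w → trans (∂-lift S w) (go w (C.∂0 ev w))
    where
    go : ∀ w → C.∂ S w ≡ false → ∂ S w xor (((a == w) xor (b == w)) ∧ ∂ S a) ≡ false
    go w h with a ≟ w
    ... | yes refl = trans (cong (λ k → ∂ S a xor ((true xor k) ∧ ∂ S a)) (==-≢ (λ p → a≢b (sym p)))) (xor-same (∂ S a))
    ... | no a≢w = trans (cong (λ k → ∂ S w xor (k ∧ ∂ S a)) (==-sym b w))
                     (trans (cong (_∧ (∂ S w xor ((w == b) ∧ ∂ S a))) (cong not (sym (==-≢ (λ p → a≢w (sym p)))))) (trans (sym (C-∂ S w)) h))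

  lift-≢ : ∀ S f → ¬ f ≡ e → lift S f ≡ S f
  lift-≢ S f f≢e = trans (cong (λ k → S f xor (k ∧ ∂ S a)) (==-≢ f≢e)) (xor-identityʳ (S f))

  nonloop-< : # (nonloop G/e) < # (nonloop G)
  nonloop-< = #-mono-< sub e e-nonloop (cong not (trans (cong₂ _==_ ra rb) (==-refl b)))
    where
    ra : relabel a b a ≡ b
    ra = cong (λ k → if k then b else a) (==-refl a)
    rb : relabel a b b ≡ b
    rb = cong (λ k → if k then b else b) (==-≢ (λ p → a≢b (sym p)))
    sub : nonloop G/e ⊑ nonloop G
    sub f h = cong not (==-≢ (λ p → true≢false h (cong not (trans (cong (λ x → relabel a b x == relabel a b (t f)) p) (==-refl (relabel a b (t f)))))))

-- No even set separates `e` from `f`. After contracting `e`, every lifted even set therefore takes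
-- on `e` its value on `f`, and covering `f` covers `e`.
Series : (G : Graph) → Fin (Graph.m G) → Fin (Graph.m G) → Set
Series G e f = nonloop G e ≡ true × ¬ e ≡ f × ¬ (∃ λ S → EvenSets.Even G S × ¬ S e ≡ S f)

module _ (G : Graph) (all-even : EverywhereEven G) where
  open EvenSets G
  open GrowthStep G

  series? : ∀ e f → Dec (Series G e f)
  series? e f = (nonloop G e ≟ᵇ true) ×-dec (¬? (e ≟ f) ×-dec ¬? (anyPred?
    (λ h (ev , ne) → Even-cong h ev , λ q → ne (trans (h e) (trans q (sym (h f)))))
    (λ S → even? S ×-dec ¬? (S e ≟ᵇ S f))))

  -- Even sets meet cuts evenly. A cut of one edge contradicts the even set through that edge; a cut
  -- of two edges that are not in series contradicts an even set containing just one of them.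
  no-series⇒thick : (∀ e f → ¬ Series G e f) → Thick
  no-series⇒thick none A with # (δ A) in q
  ... | 0 = inj₁ refl
  ... | suc (suc (suc k)) = inj₂ (s≤s (s≤s (s≤s z≤n)))
  ... | 1 with #-∃ (δ A) (λ z → 0≢1+n (trans (sym z) q))
  ... | e , de with all-even e
  ... | S , ev , Se = ⊥-elim (true≢false total (Even-cut A ev))
    where
    only : ∀ f → δ A f ≡ true → f ≡ e
    only f df with f ≟ e
    ... | yes p = p
    ... | no f≢e = ⊥-elim (<⇒≱ (#-pos (δ A ⊖ (e ==_)) f (∧-intro df (cong not (==-≢ (λ p → f≢e (sym p))))))
                     (≤-reflexive (suc-injective (trans (sym (#-remove (δ A) e de)) q))))
    total : ⨁ (λ f → S f ∧ δ A f) ≡ true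
    total = trans (⨁-cong go) (trans (⨁-single e (λ f → S f ∧ δ A f)) (∧-intro Se de))
      where
      go : ∀ f → S f ∧ δ A f ≡ (f == e) ∧ (S f ∧ δ A f)
      go f with δ A f in d
      ... | false = bool₂ (λ x y → x ∧ false) (λ x y → y ∧ (x ∧ false)) (S f) (f == e)
      ... | true = sym (cong (_∧ (S f ∧ true)) (trans (cong (_== e) (only f d)) (==-refl e)))
  no-series⇒thick none A | 2 with two-elements (δ A) (≤-reflexive (sym q))
  ... | e , f , e≢f , de , df with anyPred? {P = λ S → Even S × ¬ S e ≡ S f}
    (λ h (ev , ne) → Even-cong h ev , λ q → ne (trans (h e) (trans q (sym (h f)))))
    (λ S → even? S ×-dec ¬? (S e ≟ᵇ S f))
  ... | no none′ = ⊥-elim (none e f (nl , e≢f , none′))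
    where
    nl : nonloop G e ≡ true
    nl = cong not (==-≢ (λ p → true≢false de (trans (cong (λ x → A x xor A (t e)) p) (xor-same (A (t e))))))
  ... | yes (S , ev , ne) = ⊥-elim (ne (xor≡false (trans (sym total) (Even-cut A ev))))
    where
    only : ∀ g → δ A g ≡ true → ¬ g ≡ e → ¬ g ≡ f → ⊥
    only g dg g≢e g≢f = <⇒≱ (#-pos ((δ A ⊖ (e ==_)) ⊖ (f ==_)) g
        (∧-intro (∧-intro dg (cong not (==-≢ (λ p → g≢e (sym p))))) (cong not (==-≢ (λ p → g≢f (sym p))))))
      (≤-reflexive (suc-injective (trans (sym (#-remove (δ A ⊖ (e ==_)) f (∧-intro df (cong not (==-≢ e≢f)))))
         (suc-injective (trans (sym (#-remove (δ A) e de)) q)))))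
    total : ⨁ (λ g → S g ∧ δ A g) ≡ S e xor S f
    total = trans (⨁-cong go) (trans (⨁-xor (λ g → (g == e) ∧ S g) (λ g → (g == f) ∧ S g))
              (cong₂ _xor_ (⨁-single e S) (⨁-single f S)))
      where
      go : ∀ g → S g ∧ δ A g ≡ ((g == e) ∧ S g) xor ((g == f) ∧ S g)
      go g with g ≟ e | g ≟ f
      ... | yes refl | yes refl = ⊥-elim (e≢f refl)
      ... | yes refl | no _ = trans (cong (S g ∧_) de) (bool₁ (λ x → x ∧ true) (λ x → x xor false) (S g))
      ... | no _ | yes refl = trans (cong (S g ∧_) df) (∧-identityʳ (S g))
      ... | no g≢e | no g≢f = trans (cong (S g ∧_) (≢true (λ dg → only g dg g≢e g≢f))) (∧-zeroʳ (S g))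

  thick-flow : Thick → EightFlow G
  thick-flow thick with any? {P = λ (v : Fin n) → ⊤} (λ _ → yes tt)
  ... | no none = mkFlow ∅ ∅ ∅ Even-∅ Even-∅ Even-∅ (λ e → ⊥-elim (none (s e , tt)))
  ... | yes (v₀ , _) = mkFlow X Φ φ₂ X-even (mkEven (even Φ consΦ)) (mkEven (even φ₂ cons₂)) cov
    where
    U = v₀ ==_
    open Growth G using (Cover; mkCover; ∂-off)
    open Cover (grow thick (# (∁ U)) U ≤-refl)
    Φ : EdgeSet m
    -- The edges not yet covered are loops at `v₀`, and adding loops changes no boundary outside
    -- `v₀`. Conservation at `v₀` itself follows because all boundaries sum to zero.
    Φ = φ₁ ⊔ inner G U
    consΦ : ∀ v → U v ≡ false → ∂ Φ v ≡ false
    consΦ v q = trans (∂-off U {Φ} {φ₁} (λ e i → trans (cong (φ₁ e ∨_) i) (∨-identityʳ (φ₁ e))) v q) (cons₁ v q)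
    even : ∀ φ → (∀ v → U v ≡ false → ∂ φ v ≡ false) → ∀ v → ∂ φ v ≡ false
    even φ cons v with v₀ ≟ v in d
    ... | no v≢ = cons v (cong ⌊_⌋ d)
    ... | yes refl = trans (sym (⨁-single v₀ (∂ φ))) (trans (⨁-cong go)
                       (trans (cut-parity (λ _ → true) φ) (⨁-false (λ e → ∧-zeroʳ (φ e)))))
      where
      go : ∀ w → (w == v₀) ∧ ∂ φ w ≡ true ∧ ∂ φ w
      go w with w ≟ v₀
      ... | yes _ = refl
      ... | no w≢ = sym (cons w (==-≢ (λ p → w≢ (sym p))))
    cov : ∀ e → X e ∨ (Φ e ∨ φ₂ e) ≡ true
    cov e with inner G U e in i
    ... | true = ∨-introʳ {X e} (∨-introˡ (∨-zeroʳ (φ₁ e)))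
    ... | false = trans (cong (λ k → X e ∨ (k ∨ φ₂ e)) (∨-identityʳ (φ₁ e))) (covers e i)

eight-flow-rec : ∀ k G → # (nonloop G) ≤ k → EverywhereEven G → EightFlow G
eight-flow-rec k G le ae with any? (λ e → any? (λ f → series? G ae e f))
... | no none = thick-flow G ae (no-series⇒thick G ae (λ e f x → none (e , f , x)))
eight-flow-rec zero G le ae | yes (e , f , nl , _) = ⊥-elim (<⇒≱ (#-pos (nonloop G) e nl) le)
eight-flow-rec (suc k) G le ae | yes (e , f , nl , e≢f , same)
  with eight-flow-rec k (Contract.G/e G e nl) (s≤s⁻¹ (≤-trans (Contract.nonloop-< G e nl) le))
         (λ g → let S , ev , Sg = ae g in S , Contract.Even⇒C G e nl ev , Sg)
... | mkFlow V₁ V₂ V₃ e₁ e₂ e₃ cov =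
  mkFlow (lift V₁) (lift V₂) (lift V₃) (lift-even e₁) (lift-even e₂) (lift-even e₃) cov′
  where
  open Contract G e nl
  eq : ∀ {S} → C.Even S → lift S e ≡ S f
  eq {S} ev with lift S e ≟ᵇ lift S f
  ... | yes p = trans p (lift-≢ S f (λ q → e≢f (sym q)))
  ... | no ¬p = ⊥-elim (same (lift S , lift-even ev , ¬p))
  cov′ : ∀ g → lift V₁ g ∨ (lift V₂ g ∨ lift V₃ g) ≡ true
  cov′ g = go g (g ≟ e)
    where
    go : ∀ g → Dec (g ≡ e) → lift V₁ g ∨ (lift V₂ g ∨ lift V₃ g) ≡ true
    go g (yes refl) = trans (cong₂ _∨_ (eq e₁) (cong₂ _∨_ (eq e₂) (eq e₃))) (cov f)
    go g (no g≢e) = trans (cong₂ _∨_ (lift-≢ V₁ g g≢e) (cong₂ _∨_ (lift-≢ V₂ g g≢e) (lift-≢ V₃ g g≢e))) (cov g)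

abstract
  eight-flow : ∀ G → EverywhereEven G → EightFlow G
  eight-flow G = eight-flow-rec (# (nonloop G)) G ≤-refl

-- Averaging over the span of a flow

min-index : ∀ {k} (f : Fin (suc k) → ℕ) → ∃ λ i → ∀ j → f i ≤ f j
min-index {zero} f = zero , λ { zero → ≤-refl }
min-index {suc k} f with min-index (f ∘ suc)
... | i , h with f zero ≤? f (suc i)
... | yes p = zero , λ { zero → ≤-refl ; (suc j) → ≤-trans p (h j) }
... | no ¬p = suc i , λ { zero → <⇒≤ (≰⇒> ¬p) ; (suc j) → h j }

abstract
  ∑-average : ∀ {k} (f : Fin (suc k) → ℕ) → ∃ λ i → suc k * f i ≤ ∑ f
  ∑-average {k} f with min-index f
  ... | i , h = i , ≤-trans (≤-reflexive (sym (∑-const (suc k) (f i)))) (∑-mono h)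

combo : Fin 8 → Bool → Bool → Bool → Bool
combo zero a b c = false
combo (suc zero) a b c = a
combo (suc (suc zero)) a b c = b
combo (suc (suc (suc zero))) a b c = c
combo (suc (suc (suc (suc zero)))) a b c = a xor b
combo (suc (suc (suc (suc (suc zero))))) a b c = b xor c
combo (suc (suc (suc (suc (suc (suc zero)))))) a b c = a xor (b xor c)
combo (suc (suc (suc (suc (suc (suc (suc zero))))))) a b c = a xor c

-- A nonzero vector of F₂³ takes the value 1 under exactly four of the eight linear forms; adding
-- `w` can only exchange the two halves.
combo-average : ∀ w a b c → a ∨ (b ∨ c) ≡ true → ∑ (λ i → 𝟙 (w xor combo i a b c)) ≡ 4
combo-average w false false false ()
combo-average true  false false true  _ = refl
combo-average true  false true  false _ = refl
combo-average true  false true  true  _ = refl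
combo-average true  true  false false _ = refl
combo-average true  true  false true  _ = refl
combo-average true  true  true  false _ = refl
combo-average true  true  true  true  _ = refl
combo-average false false false true  _ = refl
combo-average false false true  false _ = refl
combo-average false false true  true  _ = refl
combo-average false true  false false _ = refl
combo-average false true  false true  _ = refl
combo-average false true  true  false _ = refl
combo-average false true  true  true  _ = refl

next : Fin 7 → Fin 7
next zero = suc zero
next (suc zero) = suc (suc zero)
next (suc (suc zero)) = suc (suc (suc zero))
next (suc (suc (suc zero))) = suc (suc (suc (suc zero)))
next (suc (suc (suc (suc zero)))) = suc (suc (suc (suc (suc zero))))
next (suc (suc (suc (suc (suc zero))))) = suc (suc (suc (suc (suc (suc zero)))))
next (suc (suc (suc (suc (suc (suc zero)))))) = zero

-- The nonzero combinations are listed as the powers of a generator of the field with eight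
-- elements, so that three consecutive ones form a basis.
basis-cover : ∀ i a b c → a ∨ (b ∨ c) ≡ true →
  combo (suc i) a b c ∨ (combo (suc (next i)) a b c ∨ combo (suc (next (next i))) a b c) ≡ true
basis-cover i false false false ()
basis-cover i a b c h = check i a b c h
  where
  f : Fin 7 → Bool → Bool → Bool → Bool
  f i a b c = combo (suc i) a b c ∨ (combo (suc (next i)) a b c ∨ combo (suc (next (next i))) a b c)
  eqn : ∀ i → (∀ a b c → f i a b c ≡ a ∨ (b ∨ c))
  eqn zero = bool₃ (f zero) (λ a b c → a ∨ (b ∨ c))
  eqn (suc zero) = bool₃ (f (suc zero)) (λ a b c → a ∨ (b ∨ c))
  eqn (suc (suc zero)) = bool₃ (f (suc (suc zero))) (λ a b c → a ∨ (b ∨ c))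
  eqn (suc (suc (suc zero))) = bool₃ (f (suc (suc (suc zero)))) (λ a b c → a ∨ (b ∨ c))
  eqn (suc (suc (suc (suc zero)))) = bool₃ (f (suc (suc (suc (suc zero))))) (λ a b c → a ∨ (b ∨ c))
  eqn (suc (suc (suc (suc (suc zero))))) = bool₃ (f (suc (suc (suc (suc (suc zero)))))) (λ a b c → a ∨ (b ∨ c))
  eqn (suc (suc (suc (suc (suc (suc zero)))))) = bool₃ (f (suc (suc (suc (suc (suc (suc zero))))))) (λ a b c → a ∨ (b ∨ c))
  check : ∀ i a b c → a ∨ (b ∨ c) ≡ true → f i a b c ≡ true
  check i a b c h = trans (eqn i a b c) h

-- Each of the seven nonzero forms occurs in three of the cyclic triples, and four of the forms are
-- 1 at a given nonzero vector. This is the origin of 12/7.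
basis-average : ∀ a b c →
  ∑ (λ i → 𝟙 (combo (suc i) a b c) + (𝟙 (combo (suc (next i)) a b c) + 𝟙 (combo (suc (next (next i))) a b c)))
  ≤ 12 * 𝟙 (a ∨ (b ∨ c))
basis-average false false false = ≤-refl
basis-average false false true  = ≤-refl
basis-average false true  false = ≤-refl
basis-average false true  true  = ≤-refl
basis-average true  false false = ≤-refl
basis-average true  false true  = ≤-refl
basis-average true  true  false = ≤-refl
basis-average true  true  true  = ≤-refl

∑-*ˡ : ∀ {k} c (f : Fin k → ℕ) → ∑ (λ i → c * f i) ≡ c * ∑ f
∑-*ˡ {zero} c f = sym (*-zeroʳ c)
∑-*ˡ {suc k} c f = trans (cong (c * f zero +_) (∑-*ˡ c (f ∘ suc))) (sym (*-distribˡ-+ c (f zero) (∑ (f ∘ suc))))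

record ShortFlow (G : Graph) (H : EdgeSet (Graph.m G)) : Set where
  open EvenSets G
  field
    C₁ C₂ C₃ : EdgeSet m
    even₁ : Even C₁
    even₂ : Even C₂
    even₃ : Even C₃
    C₁⊑ : C₁ ⊑ H
    C₂⊑ : C₂ ⊑ H
    C₃⊑ : C₃ ⊑ H
    covered : ∀ e → H e ≡ true → C₁ e ∨ (C₂ e ∨ C₃ e) ≡ true
    short : 7 * (# C₁ + (# C₂ + # C₃)) ≤ 12 * # H
    shift : ∀ W → ∃ λ V → Even V × V ⊑ H × 2 * # ((W ⊕ V) ⊓ H) ≤ # H

cancel-4 : ∀ x y → 8 * x ≤ 4 * y → 2 * x ≤ y
cancel-4 x y h = *-cancelˡ-≤ 4 (≤-trans (≤-reflexive (sym (*-assoc 4 2 x))) h)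

module Averages (G : Graph) (H A₁ A₂ A₃ : EdgeSet (Graph.m G))
                (ev₁ : EvenSets.Even G A₁) (ev₂ : EvenSets.Even G A₂) (ev₃ : EvenSets.Even G A₃)
                (A⊑ : ∀ e → A₁ e ∨ (A₂ e ∨ A₃ e) ≡ true → H e ≡ true)
                (cov : ∀ e → H e ≡ true → A₁ e ∨ (A₂ e ∨ A₃ e) ≡ true) where
  open EvenSets G

  V : Fin 8 → EdgeSet m
  V i e = combo i (A₁ e) (A₂ e) (A₃ e)

  evenV : ∀ i → Even (V i)
  evenV zero = Even-∅
  evenV (suc zero) = ev₁
  evenV (suc (suc zero)) = ev₂
  evenV (suc (suc (suc zero))) = ev₃
  evenV (suc (suc (suc (suc zero)))) = Even-⊕ ev₁ ev₂
  evenV (suc (suc (suc (suc (suc zero))))) = Even-⊕ ev₂ ev₃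
  evenV (suc (suc (suc (suc (suc (suc zero)))))) = Even-⊕ ev₁ (Even-⊕ ev₂ ev₃)
  evenV (suc (suc (suc (suc (suc (suc (suc zero))))))) = Even-⊕ ev₁ ev₃

  combo-support : ∀ i a b c → combo i a b c ≡ true → a ∨ (b ∨ c) ≡ true
  combo-support i true b c h = refl
  combo-support i false true c h = refl
  combo-support i false false true h = refl
  combo-support i false false false h = ⊥-elim (true≢false h (zeros i))
    where
    zeros : ∀ i → combo i false false false ≡ false
    zeros zero = refl
    zeros (suc zero) = refl
    zeros (suc (suc zero)) = refl
    zeros (suc (suc (suc zero))) = refl
    zeros (suc (suc (suc (suc zero)))) = refl
    zeros (suc (suc (suc (suc (suc zero))))) = refl
    zeros (suc (suc (suc (suc (suc (suc zero)))))) = refl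
    zeros (suc (suc (suc (suc (suc (suc (suc zero))))))) = refl

  V⊑ : ∀ i → V i ⊑ H
  V⊑ i e h = A⊑ e (combo-support i (A₁ e) (A₂ e) (A₃ e) h)

  C : Fin 7 → EdgeSet m
  C i = V (suc i)

  size₃ : Fin 7 → ℕ
  size₃ i = # (C i) + (# (C (next i)) + # (C (next (next i))))

  point₃ : Fin 7 → Fin m → ℕ
  point₃ i e = 𝟙 (C i e) + (𝟙 (C (next i) e) + 𝟙 (C (next (next i)) e))

  size₃-point : ∀ i → size₃ i ≡ ∑ (point₃ i)
  size₃-point i = sym (trans (∑-+ (𝟙 ∘ C i) (λ e → 𝟙 (C (next i) e) + 𝟙 (C (next (next i)) e)))
    (cong (# (C i) +_) (∑-+ (𝟙 ∘ C (next i)) (𝟙 ∘ C (next (next i))))))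

  total : ∑ size₃ ≤ 12 * # H
  total = ≤-trans (≤-reflexive (trans (∑-cong {f = size₃} {g = λ i → ∑ (point₃ i)} size₃-point) (∑-swap point₃)))
    (≤-trans (∑-mono {f = λ e → ∑ (λ i → point₃ i e)} {g = λ e → 12 * 𝟙 (H e)}
       (λ e → ≤-trans (basis-average (A₁ e) (A₂ e) (A₃ e)) (*-monoʳ-≤ 12 (𝟙-mono _ _ (A⊑ e)))))
      (≤-reflexive (∑-*ˡ 12 (𝟙 ∘ H))))

  abstract
    best : ∃ λ i → 7 * size₃ i ≤ ∑ size₃
    best = ∑-average size₃

  shifted : EdgeSet m → Fin 8 → ℕ
  shifted W i = # ((W ⊕ V i) ⊓ H)

  shift-point : ∀ W e → ∑ (λ i → 𝟙 (((W ⊕ V i) ⊓ H) e)) ≡ 4 * 𝟙 (H e)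
  shift-point W e with H e | cov e
  ... | true | c = trans (∑-cong {f = λ i → 𝟙 ((W e xor V i e) ∧ true)} {g = λ i → 𝟙 (W e xor V i e)}
                           (λ i → cong 𝟙 (∧-identityʳ (W e xor V i e))))
                     (combo-average (W e) (A₁ e) (A₂ e) (A₃ e) (c refl))
  ... | false | _ = ∑-zero {f = λ i → 𝟙 ((W e xor V i e) ∧ false)} (λ i → cong 𝟙 (∧-zeroʳ (W e xor V i e)))

  shift-total : ∀ W → ∑ (shifted W) ≡ 4 * # H
  shift-total W = trans (∑-swap (λ i e → 𝟙 (((W ⊕ V i) ⊓ H) e)))
    (trans (∑-cong {f = λ e → ∑ (λ i → 𝟙 (((W ⊕ V i) ⊓ H) e))} {g = λ e → 4 * 𝟙 (H e)} (shift-point W)) (∑-*ˡ 4 (𝟙 ∘ H)))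

  shift : ∀ W → ∃ λ V′ → Even V′ × V′ ⊑ H × 2 * # ((W ⊕ V′) ⊓ H) ≤ # H
  shift W with ∑-average (shifted W)
  ... | i , le = V i , evenV i , V⊑ i , cancel-4 (shifted W i) (# H) (subst (8 * shifted W i ≤_) (shift-total W) le)

  shortFlow : ShortFlow G H
  shortFlow = record
    { C₁ = C j ; C₂ = C (next j) ; C₃ = C (next (next j))
    ; even₁ = evenV (suc j) ; even₂ = evenV (suc (next j)) ; even₃ = evenV (suc (next (next j)))
    ; C₁⊑ = V⊑ (suc j) ; C₂⊑ = V⊑ (suc (next j)) ; C₃⊑ = V⊑ (suc (next (next j)))
    ; covered = λ e h → basis-cover j (A₁ e) (A₂ e) (A₃ e) (cov e h)
    ; short = ≤-trans (proj₂ best) total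
    ; shift = shift }
    where j = proj₁ best

-- The union of the cycles of an edge set

module _ (G : Graph) (F : EdgeSet (Graph.m G)) where
  open EvenSets G

  abstract
    cyclic? : ∀ e → Dec (∃ λ S → S ⊑ F × Even S × S e ≡ true)
    cyclic? e = anyPred? (λ h (a , b , c) → (λ f q → a f (trans (h f) q)) , Even-cong h b , trans (sym (h e)) c)
                  (λ S → ⊑? S F ×-dec (even? S ×-dec (S e ≟ᵇ true)))

  core : EdgeSet m
  core e = ⌊ cyclic? e ⌋

  core⊑ : core ⊑ F
  core⊑ e h with true-dec (cyclic? e) h
  ... | S , sub , _ , Se = sub e Se

  even⊑core : ∀ {S} → Even S → S ⊑ F → S ⊑ core
  even⊑core {S} ev sub e Se = dec-true (cyclic? e) (S , sub , ev , Se)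

  -- Edges outside the core become loops, which are even by themselves and do not affect boundaries.
  -- So the 8-flow theorem for a whole graph yields one for the core.
  looped : Graph
  looped = record { n = n ; m = m ; ends = λ e → s e , (if core e then t e else s e) }

  module L = EvenSets looped

  L-∂ : ∀ S v → L.∂ S v ≡ ∂ (S ⊓ core) v
  L-∂ S v = ⨁-cong go
    where
    go : ∀ e → S e ∧ L.inc e v ≡ (S e ∧ core e) ∧ inc e v
    go e with core e
    ... | true = cong (_∧ inc e v) (sym (∧-identityʳ (S e)))
    ... | false = trans (cong (S e ∧_) (xor-same (s e == v))) (trans (∧-zeroʳ (S e)) (sym (cong (_∧ inc e v) (∧-zeroʳ (S e)))))

  ⊓-core : ∀ {S} → S ⊑ core → ∀ e → S e ≡ (S ⊓ core) e
  ⊓-core {S} sub e with S e in q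
  ... | true = sym (sub e q)
  ... | false = refl

  L-even : ∀ {S} → L.Even S → Even (S ⊓ core)
  L-even {S} ev = mkEven λ v → trans (sym (L-∂ S v)) (L.∂0 ev v)

  even-L : ∀ {S} → Even S → S ⊑ core → L.Even S
  even-L {S} ev sub = L.mkEven λ v → trans (L-∂ S v) (trans (sym (∂-cong (⊓-core sub) v)) (∂0 ev v))

  looped-even : EverywhereEven looped
  looped-even e with bool-split (core e)
  ... | inj₁ h with true-dec (cyclic? e) h
  ... | S , sub , ev , Se = S , even-L ev (even⊑core ev sub) , Se
  looped-even e | inj₂ h = (_== e) , L.mkEven (λ v → trans (⨁-single e (λ f → L.inc f v))
      (trans (cong (λ k → (s e == v) xor ((if k then t e else s e) == v)) h) (xor-same (s e == v)))) , ==-refl e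

  abstract
    short-flow : ShortFlow G core
    short-flow = Averages.shortFlow G core (U₁ ⊓ core) (U₂ ⊓ core) (U₃ ⊓ core) (L-even e₁) (L-even e₂) (L-even e₃) back cov′
      where
      open EightFlow (eight-flow looped looped-even) renaming
        (V₁ to U₁; V₂ to U₂; V₃ to U₃; even₁ to e₁; even₂ to e₂; even₃ to e₃; covered to cov)
      distrib : ∀ e → (U₁ ⊓ core) e ∨ ((U₂ ⊓ core) e ∨ (U₃ ⊓ core) e) ≡ (U₁ e ∨ (U₂ e ∨ U₃ e)) ∧ core e
      distrib e = bool₄ (λ k a b c → (a ∧ k) ∨ ((b ∧ k) ∨ (c ∧ k))) (λ k a b c → (a ∨ (b ∨ c)) ∧ k)
                    (core e) (U₁ e) (U₂ e) (U₃ e)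
      back : ∀ e → (U₁ ⊓ core) e ∨ ((U₂ ⊓ core) e ∨ (U₃ ⊓ core) e) ≡ true → core e ≡ true
      back e h = proj₂ (∧-true {U₁ e ∨ (U₂ e ∨ U₃ e)} (trans (sym (distrib e)) h))
      cov′ : ∀ e → core e ≡ true → (U₁ ⊓ core) e ∨ ((U₂ ⊓ core) e ∨ (U₃ ⊓ core) e) ≡ true
      cov′ e h = trans (distrib e) (∧-intro (cov e) h)

-- Cycles in cubic graphs

module Cubics (G : Graph) (σ : Fin (Graph.m G) → Sign) (cubic : Cubic G) where
  open EvenSets G public
  open Ears G using (comp⊑inner) public

  dg : EdgeSet m → Fin n → ℕ
  dg S v = deg G S v

  half : Bool → Bool → Bool → ℕ
  half x a b = if x then (if a then 1 else 0) + (if b then 1 else 0) else 0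

  dg-parity : ∀ S v → odd? (dg S v) ≡ ∂ S v
  dg-parity S v = trans (odd?-∑ (λ e → half (S e) (s e == v) (t e == v))) (⨁-cong (λ e → go (S e) (s e == v) (t e == v)))
    where
    go : ∀ x a b → odd? (half x a b) ≡ x ∧ (a xor b)
    go true true true = refl
    go true true false = refl
    go true false true = refl
    go true false false = refl
    go false _ _ = refl

  half-mono : ∀ x y a b → (x ≡ true → y ≡ true) → half x a b ≤ half y a b
  half-mono false y a b h = z≤n
  half-mono true y a b h rewrite h refl = ≤-refl

  dg-mono : ∀ {S S′} v → S ⊑ S′ → dg S v ≤ dg S′ v
  dg-mono {S} {S′} v h = ∑-mono (λ e → half-mono (S e) (S′ e) (s e == v) (t e == v) (h e))

  dg≤3 : ∀ S v → dg S v ≤ 3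
  dg≤3 S v = ≤-trans (dg-mono {S} v (λ _ _ → refl)) (≤-reflexive (cubic v))

  dg-⊔ : ∀ S S′ v → (∀ e → S e ∧ S′ e ≡ false) → dg (S ⊔ S′) v ≡ dg S v + dg S′ v
  dg-⊔ S S′ v h = trans (∑-cong (λ e → go (S e) (S′ e) (s e == v) (t e == v) (h e)))
      (∑-+ (λ e → half (S e) (s e == v) (t e == v)) (λ e → half (S′ e) (s e == v) (t e == v)))
    where
    go : ∀ x y a b → x ∧ y ≡ false → half (x ∨ y) a b ≡ half x a b + half y a b
    go true false a b _ = sym (+-identityʳ (half true a b))
    go false y a b _ = refl

  dg-cong : ∀ {S S′} → (∀ e → S e ≡ S′ e) → ∀ v → dg S v ≡ dg S′ v
  dg-cong h v = ∑-cong (λ e → cong (λ x → half x (s e == v) (t e == v)) (h e))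

  vert : EdgeSet m → Fin n → Bool
  vert S v = not (dg S v ≡ᵇ 0)

  vert-∉ : ∀ {S v} → vert S v ≡ false → dg S v ≡ 0
  vert-∉ {S} {v} h with dg S v
  ... | zero = refl

  ∉-vert : ∀ {S v} → dg S v ≡ 0 → vert S v ≡ false
  ∉-vert h = cong (λ k → not (k ≡ᵇ 0)) h

  vert-∈ : ∀ {S v} → vert S v ≡ true → ¬ dg S v ≡ 0
  vert-∈ {S} h p = true≢false h (∉-vert {S} p)

  ∈-vert : ∀ {S v} → ¬ dg S v ≡ 0 → vert S v ≡ true
  ∈-vert {S} h = ≢false (λ q → h (vert-∉ {S} q))

  edge-dg : ∀ S e v → S e ≡ true → s e ≡ v ⊎ t e ≡ v → 1 ≤ dg S v
  edge-dg S e v Se end = ≤-trans (go end) (∑-term (λ e → half (S e) (s e == v) (t e == v)) e)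
    where
    go : s e ≡ v ⊎ t e ≡ v → 1 ≤ half (S e) (s e == v) (t e == v)
    go (inj₁ p) rewrite Se | p | ==-refl v = s≤s z≤n
    go (inj₂ p) rewrite Se | p | ==-refl v = m≤n+m 1 (𝟙 (s e == v))

  vert-s : ∀ S e → S e ≡ true → vert S (s e) ≡ true
  vert-s S e h = ∈-vert {S} (λ p → n≮0 (≤-trans (edge-dg S e (s e) h (inj₁ refl)) (≤-reflexive p)))

  vert-t : ∀ S e → S e ≡ true → vert S (t e) ≡ true
  vert-t S e h = ∈-vert {S} (λ p → n≮0 (≤-trans (edge-dg S e (t e) h (inj₂ refl)) (≤-reflexive p)))

  vert-∃ : ∀ S v → ¬ dg S v ≡ 0 → ∃ λ e → S e ≡ true × (s e ≡ v ⊎ t e ≡ v)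
  vert-∃ S v h with ∑-pos (λ e → half (S e) (s e == v) (t e == v)) h
  ... | e , p with S e in q | s e ≟ v | t e ≟ v
  ... | true | yes r | _ = e , q , inj₁ r
  ... | true | no _ | yes r = e , q , inj₂ r
  ... | true | no _ | no _ = ⊥-elim (p refl)
  ... | false | _ | _ = ⊥-elim (p refl)

  vert-mono : ∀ {S S′} → S ⊑ S′ → vert S ⊑ vert S′
  vert-mono {S} {S′} h v q = ∈-vert {S′} (λ p → vert-∈ {S} q (n≤0⇒n≡0 (≤-trans (dg-mono v h) (≤-reflexive p))))

  even-02 : ∀ {S} → Even S → ∀ v → dg S v ≡ 0 ⊎ dg S v ≡ 2
  even-02 {S} ev v with dg S v | dg≤3 S v | dg-parity S v
  ... | 0 | _ | _ = inj₁ refl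
  ... | 1 | _ | q = ⊥-elim (true≢false (sym q) (∂0 ev v))
  ... | 2 | _ | _ = inj₂ refl
  ... | 3 | _ | q = ⊥-elim (true≢false (sym q) (∂0 ev v))
  ... | suc (suc (suc (suc _))) | s≤s (s≤s (s≤s ())) | _

  handshake : ∀ S → ∑ (dg S) ≡ 2 * # S
  handshake S = trans (∑-swap (λ v e → half (S e) (s e == v) (t e == v)))
    (trans (∑-cong (λ e → go e (S e))) (∑-*ˡ 2 (𝟙 ∘ S)))
    where
    go : ∀ e x → ∑ (λ v → half x (s e == v) (t e == v)) ≡ 2 * 𝟙 x
    go e true = trans (∑-+ (λ v → 𝟙 (s e == v)) (λ v → 𝟙 (t e == v))) (cong₂ _+_ (∑-single (s e) 1) (∑-single (t e) 1))
    go e false = ∑-zero {n} {λ _ → 0} (λ _ → refl)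

  2m≡3n : 2 * m ≡ 3 * n
  2m≡3n = trans (cong (2 *_) (sym (#-true {f = allEdges G} (λ _ → refl))))
    (trans (sym (handshake (allEdges G))) (trans (∑-cong cubic) (trans (∑-const n 3) (*-comm n 3))))

  -- All degrees in an even set are 0 or 2, so it has as many vertices as edges. This turns
  -- statements about distances and vertex counts into ones about lengths of cycles.
  vert-size : ∀ {S} → Even S → # (vert S) ≡ # S
  vert-size {S} ev = *-cancelˡ-≡ _ _ 2 (trans (sym (∑-*ˡ 2 (𝟙 ∘ vert S))) (trans (∑-cong go) (handshake S)))
    where
    go : ∀ v → 2 * 𝟙 (vert S v) ≡ dg S v
    go v with dg S v | even-02 ev v
    ... | _ | inj₁ refl = refl
    ... | _ | inj₂ refl = refl

  Even≤n : ∀ {S} → Even S → # S ≤ n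
  Even≤n {S} ev = ≤-trans (≤-reflexive (sym (vert-size ev))) (#≤k (vert S))

  neg : Fin m → Bool
  neg = isNeg G σ

  par : EdgeSet m → Bool
  par S = ⨁ (S ⊓ neg)

  par-count : ∀ S → negCount G σ S % 2 ≡ 𝟙 (par S)
  par-count S = trans (odd?-%2 (negCount G σ S)) (cong 𝟙 (odd?-# (S ⊓ neg)))

  par-⊕ : ∀ S S′ → par (S ⊕ S′) ≡ par S xor par S′
  par-⊕ S S′ = trans (⨁-cong (λ e → ∧-distribʳ-xor (neg e) (S e) (S′ e))) (⨁-xor (S ⊓ neg) (S′ ⊓ neg))

  par-cong : ∀ {S S′} → (∀ e → S e ≡ S′ e) → par S ≡ par S′
  par-cong h = ⨁-cong (λ e → cong (_∧ neg e) (h e))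

  record Cyc (C : EdgeSet m) : Set where
    constructor mkCyc
    field
      cycle : IsCycle G σ C
      even  : Even C
  open Cyc public

  comp-cyc : ∀ {S} e → Even S → S e ≡ true → Cyc (comp S (s e))
  comp-cyc {S} e ev Se = mkCyc ((e , ∧-intro Se (reach-refl S (s e))) , even-02 evC , conn) evC
    where
    C = comp S (s e)
    evC = Even-comp S (s e) ev
    to : ∀ u → _∈V_ G u C → Conn G C (s e) u
    to u h with vert-∃ C u h
    ... | f , Cf , inj₁ refl = conn-comp (reach-conn {S} (proj₂ (∧-true {S f} Cf)))
    ... | f , Cf , inj₂ refl = fwd f Cf (conn-comp (reach-conn {S} (proj₂ (∧-true {S f} Cf))))
    conn : ∀ u v → _∈V_ G u C → _∈V_ G v C → Conn G C u v
    conn u v hu hv = connTrans (connSym (to u hu)) (to v hv)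

  VDisj : EdgeSet m → EdgeSet m → Set
  VDisj A B = ∀ v → vert A v ≡ true → vert B v ≡ false

  comp-VDisj : ∀ S u C′ → C′ ⊑ (S ⊖ comp S u) → VDisj (comp S u) C′
  comp-VDisj S u C′ sub v hv with vert C′ v in q
  ... | false = refl
  ... | true with vert-∃ (comp S u) v (vert-∈ {comp S u} hv) | vert-∃ C′ v (vert-∈ {C′} q)
  ... | f , Cf , fv | g , C′g , gv = ⊥-elim (true≢false (∧-intro Sg (at g Sg gv)) (not-true (proj₂ (∧-true {S g} (sub g C′g)))))
    where
    Sg = proj₁ (∧-true {S g} (sub g C′g))
    Sf = proj₁ (∧-true {S f} Cf)
    rv : reach S u v ≡ true
    rv = go fv
      where
      go : s f ≡ v ⊎ t f ≡ v → reach S u v ≡ true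
      go (inj₁ p) = subst (λ w → reach S u w ≡ true) p (proj₂ (∧-true {S f} Cf))
      go (inj₂ p) = subst (λ w → reach S u w ≡ true) p (trans (sym (reach-edge S u f Sf)) (proj₂ (∧-true {S f} Cf)))
    at : ∀ g → S g ≡ true → s g ≡ v ⊎ t g ≡ v → reach S u (s g) ≡ true
    at g Sg (inj₁ p) = subst (λ w → reach S u w ≡ true) (sym p) rv
    at g Sg (inj₂ p) = trans (reach-edge S u g Sg) (subst (λ w → reach S u w ≡ true) (sym p) rv)

  record Signed (b : Bool) (C : EdgeSet m) : Set where
    constructor mkSigned
    field
      cyc : Cyc C
      parity : par C ≡ b
  open Signed public

  total : List (EdgeSet m) → ℕ
  total Cs = sum (map # Cs)

  record Parts (S : EdgeSet m) : Set where
    field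
      pos negs : List (EdgeSet m)
      pos-ok : All (Signed false) pos
      negs-ok : All (Signed true) negs
      negs-disj : AllPairs VDisj negs
      pos⊑ : All (_⊑ S) pos
      negs⊑ : All (_⊑ S) negs
      cover : ∀ e → S e ≡ true → Any (λ C → C e ≡ true) pos ⊎ Any (λ C → C e ≡ true) negs
      size-eq : total pos + total negs ≡ # S
      par-eq : odd? (length negs) ≡ par S

  All-⊑ : ∀ {S S′ : EdgeSet m} {Cs : List (EdgeSet m)} → S ⊑ S′ → All (_⊑ S) Cs → All (_⊑ S′) Cs
  All-⊑ h [] = []
  All-⊑ h (p ∷ ps) = (λ e q → h e (p e q)) ∷ All-⊑ h ps

  All-VDisj : ∀ S u {Cs} → All (_⊑ (S ⊖ comp S u)) Cs → All (VDisj (comp S u)) Cs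
  All-VDisj S u [] = []
  All-VDisj S u {C ∷ _} (p ∷ ps) = comp-VDisj S u C p ∷ All-VDisj S u ps

  parts-rec : ∀ k S → # S ≤ k → Even S → Parts S
  parts-rec k S le ev with any? (λ e → S e ≟ᵇ true)
  ... | no none = record { pos = [] ; negs = [] ; pos-ok = [] ; negs-ok = [] ; negs-disj = [] ; pos⊑ = [] ; negs⊑ = []
      ; cover = λ e h → ⊥-elim (none (e , h)) ; size-eq = sym (#-∅ empty)
      ; par-eq = sym (⨁-false (λ e → cong (_∧ neg e) (empty e))) }
    where
    empty : ∀ e → S e ≡ false
    empty e = ≢true (λ h → none (e , h))
  parts-rec zero S le ev | yes (e , Se) = ⊥-elim (<⇒≱ (#-pos S e Se) le)
  parts-rec (suc k) S le ev | yes (e , Se) = add (par C) refl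
    where
    u = s e
    C = comp S u
    S′ = S ⊖ C
    Ce : C e ≡ true
    Ce = ∧-intro Se (reach-refl S u)
    C⊑S = comp⊑ S u
    S′⊑S : S′ ⊑ S
    S′⊑S f h = proj₁ (∧-true h)
    eq : ∀ f → (S ⊕ C) f ≡ S′ f
    eq f = go (S f) (reach S u (s f))
      where
      go : ∀ a b → a xor (a ∧ b) ≡ a ∧ not (a ∧ b)
      go true b = refl
      go false b = refl
    le′ : # S′ ≤ k
    le′ = s≤s⁻¹ (≤-trans (#-mono-< S′⊑S e Se (trans (cong (λ x → S e ∧ not x) Ce) (∧-zeroʳ (S e)))) le)
    open Parts (parts-rec k S′ le′ (Even-cong eq (Even-⊕ ev (Even-comp S u ev))))
    sz : # S ≡ # C + # S′
    sz = #-⊖ S C C⊑S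
    pr : par S ≡ par C xor par S′
    pr = trans (bool₂ (λ a b → a) (λ a b → b xor (a xor b)) (par S) (par C))
           (cong (par C xor_) (trans (sym (par-⊕ S C)) (par-cong eq)))
    cov′ : ∀ f → S f ≡ true → C f ≡ true ⊎ S′ f ≡ true
    cov′ f h with C f in q
    ... | true = inj₁ refl
    ... | false = inj₂ (∧-intro h refl)
    add : ∀ b → par C ≡ b → Parts S
    add false q = record { pos = C ∷ pos ; negs = negs ; pos-ok = mkSigned (comp-cyc e ev Se) q ∷ pos-ok
      ; negs-ok = negs-ok ; negs-disj = negs-disj ; pos⊑ = C⊑S ∷ All-⊑ S′⊑S pos⊑ ; negs⊑ = All-⊑ S′⊑S negs⊑
      ; cover = c
      ; size-eq = trans (+-assoc (# C) (total pos) (total negs)) (trans (cong (# C +_) size-eq) (sym sz))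
      ; par-eq = trans par-eq (sym (trans pr (cong (_xor par S′) q))) }
      where
      c : ∀ f → S f ≡ true → Any (λ X → X f ≡ true) (C ∷ pos) ⊎ Any (λ X → X f ≡ true) negs
      c f h with cov′ f h
      ... | inj₁ p = inj₁ (here p)
      ... | inj₂ p with cover f p
      ... | inj₁ x = inj₁ (there x)
      ... | inj₂ x = inj₂ x
    add true q = record { pos = pos ; negs = C ∷ negs ; pos-ok = pos-ok
      ; negs-ok = mkSigned (comp-cyc e ev Se) q ∷ negs-ok ; negs-disj = All-VDisj S u negs⊑ ∷ negs-disj
      ; pos⊑ = All-⊑ S′⊑S pos⊑ ; negs⊑ = C⊑S ∷ All-⊑ S′⊑S negs⊑
      ; cover = c
      ; size-eq = trans (trans (sym (+-assoc (total pos) (# C) (total negs))) (trans (cong (_+ total negs) (+-comm (total pos) (# C)))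
                    (+-assoc (# C) (total pos) (total negs)))) (trans (cong (# C +_) size-eq) (sym sz))
      ; par-eq = trans (cong not par-eq) (sym (trans pr (cong (_xor par S′) q))) }
      where
      c : ∀ f → S f ≡ true → Any (λ X → X f ≡ true) pos ⊎ Any (λ X → X f ≡ true) (C ∷ negs)
      c f h with cov′ f h
      ... | inj₁ p = inj₂ (here p)
      ... | inj₂ p with cover f p
      ... | inj₁ x = inj₁ x
      ... | inj₂ x = inj₂ (there x)

  abstract
    parts : ∀ S → Even S → Parts S
    parts S = parts-rec (# S) S ≤-refl

-- Barbells

module Barbells (G : Graph) (σ : Fin (Graph.m G) → Sign) (cubic : Cubic G) where
  open Cubics G σ cubic public
  open Ears G using (∂-reach; inner-closed)

  comp-conn : ∀ S u x y → _∈V_ G x (comp S u) → _∈V_ G y (comp S u) → Conn G (comp S u) x y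
  comp-conn S u x y hx hy = connTrans (connSym (to x hx)) (to y hy)
    where
    to : ∀ v → _∈V_ G v (comp S u) → Conn G (comp S u) u v
    to v h with vert-∃ (comp S u) v h
    ... | f , Cf , inj₁ p = subst (Conn G (comp S u) u) p (conn-comp (reach-conn {S} (proj₂ (∧-true {S f} Cf))))
    ... | f , Cf , inj₂ p = subst (Conn G (comp S u) u) p (fwd f Cf (conn-comp (reach-conn {S} (proj₂ (∧-true {S f} Cf)))))

  -- The cycle uses two of the three edges at `v`.
  dg-≤1 : ∀ {C P v} → Even C → (∀ e → C e ∧ P e ≡ false) → vert C v ≡ true → dg P v ≤ 1
  dg-≤1 {C} {P} {v} ev dis h with even-02 ev v
  ... | inj₁ z = ⊥-elim (vert-∈ {C} h z)
  ... | inj₂ two = +-cancelˡ-≤ 2 (dg P v) 1 (≤-trans (≤-reflexive (trans (cong (_+ dg P v) (sym two)) (sym (dg-⊔ C P v dis)))) (dg≤3 (C ⊔ P) v))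

  odd-≤1 : ∀ {P v} → dg P v ≤ 1 → ∂ P v ≡ true → dg P v ≡ 1
  odd-≤1 {P} {v} le h with dg P v | dg-parity P v
  odd-≤1 le h | 0 | q = ⊥-elim (true≢false h (sym q))
  odd-≤1 le h | 1 | q = refl
  odd-≤1 (s≤s ()) h | suc (suc _) | q

  even-≤1 : ∀ {P v} → dg P v ≤ 1 → ∂ P v ≡ false → dg P v ≡ 0
  even-≤1 {P} {v} le h with dg P v | dg-parity P v
  even-≤1 le h | 0 | q = refl
  even-≤1 le h | 1 | q = ⊥-elim (true≢false (sym q) h)
  even-≤1 (s≤s ()) h | suc (suc _) | q

  even-at : ∀ {P} v → ∂ P v ≡ false → dg P v ≡ 0 ⊎ dg P v ≡ 2
  even-at {P} v h with dg P v | dg≤3 P v | dg-parity P v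
  ... | 0 | _ | _ = inj₁ refl
  ... | 1 | _ | q = ⊥-elim (true≢false (sym q) h)
  ... | 2 | _ | _ = inj₂ refl
  ... | 3 | _ | q = ⊥-elim (true≢false (sym q) h)
  ... | suc (suc (suc (suc _))) | s≤s (s≤s (s≤s ())) | _

  VDisj-sym : ∀ {A B} → VDisj A B → VDisj B A
  VDisj-sym {A} {B} d v h with vert A v in q
  ... | false = refl
  ... | true = ⊥-elim (true≢false h (d v q))

  VDisj-edge : ∀ {A B} → VDisj A B → ∀ e → A e ∧ B e ≡ false
  VDisj-edge {A} {B} d e with A e in p | B e in q
  ... | true | true = ⊥-elim (true≢false (vert-s B e q) (d (s e) (vert-s A e p)))
  ... | true | false = refl
  ... | false | _ = refl

  ⊕⊖ : ∀ {Q S : EdgeSet m} → S ⊑ Q → ∀ e → (Q ⊕ S) e ≡ (Q ⊖ S) e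
  ⊕⊖ {Q} {S} h e = go (Q e) (S e) (h e)
    where
    go : ∀ a b → (b ≡ true → a ≡ true) → a xor b ≡ a ∧ not b
    go true b h = refl
    go false true h = sym (h refl)
    go false false h = refl

  unionBell : (C₁ C₂ P : EdgeSet m) → EdgeSet m
  unionBell C₁ C₂ P e = C₁ e ∨ (C₂ e ∨ P e)

  negativeCycle : ∀ {C} → Signed true C → NegativeCycle G σ C
  negativeCycle {C} sc = cycle (cyc sc) , trans (par-count C) (cong 𝟙 (parity sc))

  positiveCycle : ∀ {C} → Signed false C → PositiveCycle G σ C
  positiveCycle {C} sc = cycle (cyc sc) , trans (par-count C) (cong 𝟙 (parity sc))

  module _ {C₁ C₂ : EdgeSet m} (sc₁ : Signed true C₁) (sc₂ : Signed true C₂) (disj : VDisj C₁ C₂) where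
    ev₁ = even (cyc sc₁)
    ev₂ = even (cyc sc₂)

    -- An odd number of odd vertices on `C₁`, and none away from the two cycles. Unlike being a join
    -- from one cycle to the other, this survives the removal of a join between two vertices of
    -- `C₁`.
    Odd₁ Off : EdgeSet m → Set
    Odd₁ Q = ⨁ (λ v → vert C₁ v ∧ ∂ Q v) ≡ true
    Off Q = ∀ v → vert C₁ v ≡ false → vert C₂ v ≡ false → ∂ Q v ≡ false

    Bar : EdgeSet m → Set
    Bar Q = ∃ λ P → P ⊑ Q × IsBarbell G σ (unionBell C₁ C₂ P)

    Apart : EdgeSet m → Set
    Apart Q = (∀ e → C₁ e ∧ Q e ≡ false) × (∀ e → C₂ e ∧ Q e ≡ false)

    -- The component `P` of the join has at most one edge at any vertex of the cycles. By parity it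
    -- has exactly one at `u` and at `z`, none at the other cycle vertices, and degree 0 or 2
    -- elsewhere; so it is a path that touches the cycles only at its ends.
    bell-end : ∀ Q u z S → Apart Q → S ⊑ Q → Join S u z → ¬ z ≡ u → vert C₁ u ≡ true → vert C₂ z ≡ true → Bar Q
    bell-end Q u z S (d₁ , d₂) S⊑Q j z≢u u∈ z∈ = P , P⊑Q ,
        (C₁ , C₂ , P , negativeCycle sc₁ , negativeCycle sc₂ , VDisj-edge {C₁} {C₂} disj , (λ _ → refl) ,
         inj₂ (u , z , path , vert-∈ {C₁} u∈ , vert-∈ {C₂} z∈ , apart , meet₁ , meet₂))
      where
      P = comp S u
      P⊑Q : P ⊑ Q
      P⊑Q e h = S⊑Q e (comp⊑ S u e h)
      jP : Join P u z
      jP = ∂-reach j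
      z∉ : vert C₁ z ≡ false
      z∉ = VDisj-sym {C₁} {C₂} disj z z∈
      off₁ : ∀ e → C₁ e ∧ P e ≡ false
      off₁ e = ≢true (λ h → true≢false (∧-intro (proj₁ (∧-true {C₁ e} h)) (P⊑Q e (proj₂ (∧-true {C₁ e} h)))) (d₁ e))
      off₂ : ∀ e → C₂ e ∧ P e ≡ false
      off₂ e = ≢true (λ h → true≢false (∧-intro (proj₁ (∧-true {C₂ e} h)) (P⊑Q e (proj₂ (∧-true {C₂ e} h)))) (d₂ e))
      ∂Pu : ∂ P u ≡ true
      ∂Pu = trans (∂J jP u) (cong₂ _xor_ (==-refl u) (==-≢ z≢u))
      ∂Pz : ∂ P z ≡ true
      ∂Pz = trans (∂J jP z) (cong₂ _xor_ (==-≢ (λ p → z≢u (sym p))) (==-refl z))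
      ∂Pw : ∀ w → ¬ w ≡ u → ¬ w ≡ z → ∂ P w ≡ false
      ∂Pw w a b = trans (∂J jP w) (cong₂ _xor_ (==-≢ (λ p → a (sym p))) (==-≢ (λ p → b (sym p))))
      dPu : dg P u ≡ 1
      dPu = odd-≤1 {P} (dg-≤1 {C₁} {P} ev₁ off₁ u∈) ∂Pu
      dPz : dg P z ≡ 1
      dPz = odd-≤1 {P} (dg-≤1 {C₂} {P} ev₂ off₂ z∈) ∂Pz
      nonempty : ∃ λ e → P e ≡ true
      nonempty = let e , Pe , _ = vert-∃ P u (λ p → 0≢1+n (trans (sym p) dPu)) in e , Pe
      path : IsPath G σ P u z
      path = (λ p → z≢u (sym p)) , nonempty , dPu , dPz , (λ w a b → even-at {P} w (∂Pw w a b)) , comp-conn S u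
      meet₁ : ∀ w → _∈V_ G w P → _∈V_ G w C₁ → w ≡ u
      meet₁ w p a with w ≟ u
      ... | yes e = e
      ... | no w≢u = ⊥-elim (p (even-≤1 {P} (dg-≤1 {C₁} {P} ev₁ off₁ (∈-vert {C₁} a))
                       (∂Pw w w≢u λ e → true≢false (subst (λ x → vert C₁ x ≡ true) e (∈-vert {C₁} a)) z∉)))
      meet₂ : ∀ w → _∈V_ G w P → _∈V_ G w C₂ → w ≡ z
      meet₂ w p a with w ≟ z
      ... | yes e = e
      ... | no w≢z = ⊥-elim (p (even-≤1 {P} (dg-≤1 {C₂} {P} ev₂ off₂ (∈-vert {C₂} a))
                       (∂Pw w (λ e → true≢false (subst (λ x → vert C₂ x ≡ true) e (∈-vert {C₂} a)) (disj u u∈)) w≢z)))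
      apart : ∀ w → _∈V_ G w C₁ → ¬ _∈V_ G w C₂
      apart w a b = true≢false (∈-vert {C₂} b) (disj w (∈-vert {C₁} a))

    join-nonempty : ∀ {S u z} → Join S u z → ¬ z ≡ u → ∃ λ e → S e ≡ true
    join-nonempty {S} {u} {z} j z≢u =
      let e , h = ⨁-∃ (λ e → S e ∧ inc e u) (trans (∂J j u) (cong₂ _xor_ (==-refl u) (==-≢ z≢u))) in e , proj₁ (∧-true {S e} h)

    drop-join : ∀ {Q u z S} → S ⊑ Q → Join S u z → vert C₁ u ≡ true → vert C₁ z ≡ true → Odd₁ Q → Off Q →
                Odd₁ (Q ⊖ S) × Off (Q ⊖ S)
    drop-join {Q} {u} {z} {S} S⊑Q j u∈ z∈ odd off = odd′ , off′
      where
      ∂′ : ∀ v → ∂ (Q ⊖ S) v ≡ ∂ Q v xor ((u == v) xor (z == v))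
      ∂′ v = trans (sym (∂-cong (⊕⊖ S⊑Q) v)) (trans (∂-⊕ Q S v) (cong (∂ Q v xor_) (∂J j v)))
      odd′ : Odd₁ (Q ⊖ S)
      odd′ = trans (⨁-cong (λ v → trans (cong (vert C₁ v ∧_) (∂′ v))
               (trans (bool₄ (λ c q a b → c ∧ (q xor (a xor b))) (λ c q a b → (c ∧ q) xor ((a ∧ c) xor (b ∧ c)))
                        (vert C₁ v) (∂ Q v) (u == v) (z == v))
                 (cong₂ (λ a b → (vert C₁ v ∧ ∂ Q v) xor ((a ∧ vert C₁ v) xor (b ∧ vert C₁ v))) (==-sym u v) (==-sym z v)))))
             (trans (⨁-xor (λ v → vert C₁ v ∧ ∂ Q v) (λ v → ((v == u) ∧ vert C₁ v) xor ((v == z) ∧ vert C₁ v)))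
             (trans (cong₂ _xor_ odd (trans (⨁-xor (λ v → (v == u) ∧ vert C₁ v) (λ v → (v == z) ∧ vert C₁ v))
                (cong₂ _xor_ (trans (⨁-single u (vert C₁)) u∈) (trans (⨁-single z (vert C₁)) z∈)))) refl))
      off′ : Off (Q ⊖ S)
      off′ v a b = trans (∂′ v) (cong₂ _xor_ (off v a b) (cong₂ _xor_
        (==-≢ (λ e → true≢false u∈ (trans (cong (vert C₁) e) a))) (==-≢ (λ e → true≢false z∈ (trans (cong (vert C₁) e) a)))))

    -- The partner in `Q` of an odd vertex on `C₁` lies on one of the two cycles. On `C₂` it ends
    -- the path sought; on `C₁` the join between the two is deleted, which makes `Q` smaller.
    bell-path : ∀ k Q → # Q ≤ k → Apart Q → Odd₁ Q → Off Q → Bar Q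
    bell-path k Q le ap odd off = start (⨁-∃ (λ v → vert C₁ v ∧ ∂ Q v) odd)
      where
      shorter : ∀ k → # Q ≤ k → ∀ u z S → S ⊑ Q → Join S u z → ¬ z ≡ u → vert C₁ u ≡ true → vert C₁ z ≡ true → Bar Q
      shorter zero le u z S S⊑Q j z≢u u∈ z∈ =
        let e , Se = join-nonempty j z≢u in ⊥-elim (<⇒≱ (#-pos Q e (S⊑Q e Se)) le)
      shorter (suc k) le u z S S⊑Q j z≢u u∈ z∈ =
        let e , Se = join-nonempty j z≢u
            o , f = drop-join S⊑Q j u∈ z∈ odd off
            P , P⊑ , bar = bell-path k (Q ⊖ S)
              (s≤s⁻¹ (≤-trans (#-mono-< (λ f p → proj₁ (∧-true p)) e (S⊑Q e Se) (trans (cong (λ x → Q e ∧ not x) Se) (∧-zeroʳ (Q e)))) le))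
              ((λ e → sub (C₁ e) (Q e) (S e) (proj₁ ap e)) , (λ e → sub (C₂ e) (Q e) (S e) (proj₂ ap e))) o f
        in P , (λ e h → proj₁ (∧-true (P⊑ e h))) , bar
        where
        sub : ∀ c x y → c ∧ x ≡ false → c ∧ (x ∧ not y) ≡ false
        sub c x y h = trans (sym (∧-assoc c x (not y))) (cong (_∧ not y) h)
      decide : ∀ u z S → S ⊑ Q → Join S u z → ¬ z ≡ u → vert C₁ u ≡ true → ∂ Q z ≡ true →
               (vert C₁ z ≡ true ⊎ vert C₁ z ≡ false) → (vert C₂ z ≡ true ⊎ vert C₂ z ≡ false) → Bar Q
      decide u z S S⊑Q j z≢u u∈ ∂z (inj₁ p) _ = shorter k le u z S S⊑Q j z≢u u∈ p
      decide u z S S⊑Q j z≢u u∈ ∂z (inj₂ _) (inj₁ q) = bell-end Q u z S ap S⊑Q j z≢u u∈ q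
      decide u z S S⊑Q j z≢u u∈ ∂z (inj₂ p) (inj₂ q) = ⊥-elim (true≢false ∂z (off z p q))
      start : (∃ λ v → vert C₁ v ∧ ∂ Q v ≡ true) → Bar Q
      start (u , hu) =
        let u∈ , ∂u = ∧-true {vert C₁ u} hu
            z , z≢u , cuz , ∂z = odd-partner Q u ∂u
            S , S⊑Q , j = conn⇒join cuz
        in decide u z S S⊑Q j z≢u u∈ ∂z (bool-split (vert C₁ z)) (bool-split (vert C₂ z))

    -- The edges of the cycles are first deleted from `Q`. They neither cross the cut around the
    -- vertices of `C₁` nor meet vertices off the cycles, so both parity conditions persist.
    barbell : ∀ Q → Odd₁ Q → Off Q → Bar Q
    barbell Q odd off =
      let P , P⊑ , bell = bell-path (# Q′) Q′ ≤-refl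
            ((λ e → bool₃ (λ a b q → a ∧ (q ∧ not (a ∨ b))) (λ _ _ _ → false) (C₁ e) (C₂ e) (Q e)) ,
             (λ e → bool₃ (λ a b q → b ∧ (q ∧ not (a ∨ b))) (λ _ _ _ → false) (C₁ e) (C₂ e) (Q e))) odd′ off′
      in P , (λ e h → proj₁ (∧-true (P⊑ e h))) , bell
      where
      Q′ = Q ⊖ (C₁ ⊔ C₂)
      odd′ : Odd₁ Q′
      odd′ = trans (cut-parity (vert C₁) Q′) (trans (⨁-cong (λ e → go e (bool-split (C₁ e)) (bool-split (C₂ e)))) (trans (sym (cut-parity (vert C₁) Q)) odd))
        where
        inside : ∀ e → δ (vert C₁) e ≡ false → Q′ e ∧ δ (vert C₁) e ≡ Q e ∧ δ (vert C₁) e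
        inside e h = trans (cong (Q′ e ∧_) h) (trans (∧-zeroʳ (Q′ e)) (sym (trans (cong (Q e ∧_) h) (∧-zeroʳ (Q e)))))
        go : ∀ e → C₁ e ≡ true ⊎ C₁ e ≡ false → C₂ e ≡ true ⊎ C₂ e ≡ false → Q′ e ∧ δ (vert C₁) e ≡ Q e ∧ δ (vert C₁) e
        go e (inj₁ p) _ = inside e (cong₂ _xor_ (vert-s C₁ e p) (vert-t C₁ e p))
        go e (inj₂ _) (inj₁ q) = inside e (cong₂ _xor_ (VDisj-sym {C₁} {C₂} disj _ (vert-s C₂ e q)) (VDisj-sym {C₁} {C₂} disj _ (vert-t C₂ e q)))
        go e (inj₂ p) (inj₂ q) = cong (_∧ δ (vert C₁) e) (trans (cong₂ (λ x y → Q e ∧ not (x ∨ y)) p q) (∧-identityʳ (Q e)))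
      off′ : Off Q′
      off′ v a b = trans (⨁-cong (λ e → go e (bool-split (inc e v)))) (off v a b)
        where
        go : ∀ e → inc e v ≡ true ⊎ inc e v ≡ false → Q′ e ∧ inc e v ≡ Q e ∧ inc e v
        go e (inj₂ i) = trans (cong (Q′ e ∧_) i) (trans (∧-zeroʳ (Q′ e)) (sym (trans (cong (Q e ∧_) i) (∧-zeroʳ (Q e)))))
        go e (inj₁ i) = cong (_∧ inc e v) (trans (cong₂ (λ x y → Q e ∧ not (x ∨ y)) (out C₁ a) (out C₂ b)) (∧-identityʳ (Q e)))
          where
          out : ∀ C → vert C v ≡ false → C e ≡ false
          out C a = ≢true (λ h → true≢false (at (inc⇒end e v i) h) a)
            where
            at : s e ≡ v ⊎ t e ≡ v → C e ≡ true → vert C v ≡ true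
            at (inj₁ p) h = subst (λ w → vert C w ≡ true) p (vert-s C e h)
            at (inj₂ p) h = subst (λ w → vert C w ≡ true) p (vert-t C e h)

  -- The heart consists of the two cycles of a barbell.  Being even it meets every 2-edge cut evenly,
  -- whereas the path of the barbell need not.
  record Bell (B : EdgeSet m) : Set where
    field
      circuit : IsCircuit G σ B
      heart odd-part : EdgeSet m
      heart-even : Even heart
      heart⊑ : heart ⊑ B
      odd-ok : Signed true odd-part
      odd⊑ : odd-part ⊑ heart

  join-bell : ∀ {C₁ C₂ u v S} → Signed true C₁ → Signed true C₂ → VDisj C₁ C₂ →
              vert C₁ u ≡ true → vert C₂ v ≡ true → Join S u v →
              ∃ λ B → Bell B × C₁ ⊑ B × C₂ ⊑ B × # B ≤ # C₁ + (# C₂ + # S)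
  join-bell {C₁} {C₂} {u} {v} {S} sc₁ sc₂ disj u∈ v∈ j = build (barbell sc₁ sc₂ disj S odd off)
    where
    odd : ⨁ (λ w → vert C₁ w ∧ ∂ S w) ≡ true
    odd = trans (⨁-cong (λ w → trans (cong (vert C₁ w ∧_) (∂J j w))
             (trans (bool₃ (λ c a b → c ∧ (a xor b)) (λ c a b → (a ∧ c) xor (b ∧ c)) (vert C₁ w) (u == w) (v == w))
               (cong₂ (λ a b → (a ∧ vert C₁ w) xor (b ∧ vert C₁ w)) (==-sym u w) (==-sym v w)))))
          (trans (⨁-xor (λ w → (w == u) ∧ vert C₁ w) (λ w → (w == v) ∧ vert C₁ w))
            (cong₂ _xor_ (trans (⨁-single u (vert C₁)) u∈) (trans (⨁-single v (vert C₁)) (VDisj-sym {C₁} {C₂} disj v v∈))))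
    off : ∀ w → vert C₁ w ≡ false → vert C₂ w ≡ false → ∂ S w ≡ false
    off w a b = trans (∂J j w) (cong₂ _xor_ (==-≢ (λ e → true≢false u∈ (trans (cong (vert C₁) e) a))) (==-≢ (λ e → true≢false v∈ (trans (cong (vert C₂) e) b))))
    assoc : ∀ a b c → (a ∨ b) ∨ c ≡ a ∨ (b ∨ c)
    assoc = bool₃ (λ a b c → (a ∨ b) ∨ c) (λ a b c → a ∨ (b ∨ c))
    eq : ∀ e → (C₁ ⊕ C₂) e ≡ (C₁ ⊔ C₂) e
    eq e = go (C₁ e) (C₂ e) (VDisj-edge {C₁} {C₂} disj e)
      where
      go : ∀ a b → a ∧ b ≡ false → a xor b ≡ a ∨ b
      go true false _ = refl
      go false b _ = refl
    build : (∃ λ P → P ⊑ S × IsBarbell G σ (unionBell C₁ C₂ P)) →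
            ∃ λ B → Bell B × C₁ ⊑ B × C₂ ⊑ B × # B ≤ # C₁ + (# C₂ + # S)
    build (P , P⊑ , bell) = unionBell C₁ C₂ P , record
      { circuit = inj₂ bell ; heart = C₁ ⊔ C₂ ; odd-part = C₁
      ; heart-even = Even-cong eq (Even-⊕ (even (cyc sc₁)) (even (cyc sc₂)))
      ; heart⊑ = λ e h → trans (sym (assoc (C₁ e) (C₂ e) (P e))) (∨-introˡ h)
      ; odd-ok = sc₁ ; odd⊑ = λ e h → ∨-introˡ h } ,
      (λ e h → ∨-introˡ h) , (λ e h → ∨-introʳ {C₁ e} (∨-introˡ h)) ,
      ≤-trans (#-⊔-≤ C₁ (C₂ ⊔ P)) (+-monoʳ-≤ (# C₁) (≤-trans (#-⊔-≤ C₂ P) (+-monoʳ-≤ (# C₂) (#-mono P⊑))))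

-- Pairing negative cycles

module Pairings (G : Graph) (σ : Fin (Graph.m G) → Sign) (cubic : Cubic G) where
  open Barbells G σ cubic public

  Rooted : Set
  Rooted = EdgeSet m × Fin n

  rootsum : List Rooted → Fin n → Bool
  rootsum [] v = false
  rootsum ((C , r) ∷ xs) v = (r == v) xor rootsum xs v

  RootOk : Rooted → Set
  RootOk (C , r) = Signed true C × vert C r ≡ true

  RDisj : Rooted → Rooted → Set
  RDisj x y = VDisj (proj₁ x) (proj₁ y)

  data Pick : List Rooted → Rooted → List Rooted → Set where
    first : ∀ {x xs} → Pick (x ∷ xs) x xs
    later : ∀ {x y xs ys} → Pick xs x ys → Pick (y ∷ xs) x (y ∷ ys)

  pick-root : ∀ xs z → rootsum xs z ≡ true → ∃ λ C → ∃ λ ys → Pick xs (C , z) ys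
  pick-root ((C , r) ∷ xs) z h = go (r ≟ z)
    where
    go : Dec (r ≡ z) → ∃ λ C′ → ∃ λ ys → Pick ((C , r) ∷ xs) (C′ , z) ys
    go (yes refl) = C , xs , first
    go (no r≢z) =
      let C′ , ys , p = pick-root xs z (trans (cong (_xor rootsum xs z) (sym (==-≢ r≢z))) h)
      in C′ , (C , r) ∷ ys , later p

  rootsum-pick : ∀ {xs x ys} → Pick xs x ys → ∀ v → rootsum xs v ≡ (proj₂ x == v) xor rootsum ys v
  rootsum-pick first v = refl
  rootsum-pick {y ∷ xs} {x} {_ ∷ ys} (later p) v = trans (cong ((proj₂ y == v) xor_) (rootsum-pick p v))
    (bool₃ (λ a b c → a xor (b xor c)) (λ a b c → b xor (a xor c)) (proj₂ y == v) (proj₂ x == v) (rootsum ys v))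

  All-pick : ∀ {P : Rooted → Set} {xs x ys} → Pick xs x ys → All P xs → P x × All P ys
  All-pick first (p ∷ ps) = p , ps
  All-pick (later q) (p ∷ ps) = let a , b = All-pick q ps in a , p ∷ b

  Disj-pick : ∀ {xs x ys} → Pick xs x ys → AllPairs RDisj xs → All (RDisj x) ys × AllPairs RDisj ys
  Disj-pick first (p ∷ ps) = p , ps
  Disj-pick {y ∷ _} {x} (later q) (p ∷ ps) =
    let a , b = Disj-pick q ps ; c , d = All-pick q p in (VDisj-sym {proj₁ y} {proj₁ x} c ∷ a) , d ∷ b

  size-of : List Rooted → ℕ
  size-of xs = total (map proj₁ xs)

  size-pick : ∀ {xs x ys} → Pick xs x ys → size-of xs ≡ # (proj₁ x) + size-of ys
  size-pick first = refl
  size-pick {y ∷ _} {x} {_ ∷ ys} (later q) = trans (cong (# (proj₁ y) +_) (size-pick q))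
    (trans (sym (+-assoc (# (proj₁ y)) (# (proj₁ x)) (size-of ys))) (trans (cong (_+ size-of ys) (+-comm (# (proj₁ y)) (# (proj₁ x))))
      (+-assoc (# (proj₁ x)) (# (proj₁ y)) (size-of ys))))

  length-pick : ∀ {xs x ys} → Pick xs x ys → length xs ≡ suc (length ys)
  length-pick first = refl
  length-pick (later q) = cong suc (length-pick q)

  Any-pick : ∀ {P : Rooted → Set} {xs x ys} → Pick xs x ys → Any P xs → P x ⊎ Any P ys
  Any-pick first (here p) = inj₁ p
  Any-pick first (there p) = inj₂ p
  Any-pick (later q) (here p) = inj₂ (here p)
  Any-pick (later q) (there p) with Any-pick q p
  ... | inj₁ a = inj₁ a
  ... | inj₂ b = inj₂ (there b)

  rootsum-off : ∀ {C r xs} → vert C r ≡ true → All (RDisj (C , r)) xs → All RootOk xs → rootsum xs r ≡ false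
  rootsum-off h [] [] = refl
  rootsum-off {C} {r} {(D , q) ∷ xs} h (d ∷ ds) (ok ∷ oks) =
    cong₂ _xor_ (==-≢ (λ e → true≢false (subst (λ w → vert D w ≡ true) e (proj₂ ok)) (d r h))) (rootsum-off h ds oks)

  record Pairing (xs : List Rooted) (J : EdgeSet m) : Set where
    constructor mkPairing
    field
      bells : List (EdgeSet m)
      bells-ok : All Bell bells
      covers : ∀ e → Any (λ x → proj₁ x e ≡ true) xs → Any (λ B → B e ≡ true) bells
      size≤ : total bells ≤ size-of xs + # J
      count : length xs ≡ 2 * length bells

  size-arith : ∀ b c₁ c₂ s t z j → b ≤ c₁ + (c₂ + s) → t ≤ z + j → b + t ≤ (c₁ + (c₂ + z)) + (s + j)
  size-arith b c₁ c₂ s t z j p q = ≤-trans (+-mono-≤ p q) (≤-reflexive (lem c₁ c₂ s z j))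
    where
    lem : ∀ c₁ c₂ s z j → (c₁ + (c₂ + s)) + (z + j) ≡ (c₁ + (c₂ + z)) + (s + j)
    lem = solve-∀

  -- Each path is taken out of `J` before the next one is sought, so all paths together cost at most
  -- |J|.
  pairing-rec : ∀ k xs J → length xs ≤ k → All RootOk xs → AllPairs RDisj xs →
                (∀ v → ∂ J v ≡ rootsum xs v) → Pairing xs J
  pairing-rec k [] J le ok dis h = mkPairing [] [] (λ e ()) z≤n refl
  pairing-rec (suc k) ((C , r) ∷ xs) J (s≤s le) ((sc , r∈) ∷ oks) (d ∷ dis) h =
    partner (odd-partner J r (trans (h r) (cong₂ _xor_ (==-refl r) others)))
    where
    others : rootsum xs r ≡ false
    others = rootsum-off {C} r∈ d oks
    partner : (∃ λ z → ¬ z ≡ r × Conn G J r z × ∂ J z ≡ true) → Pairing ((C , r) ∷ xs) J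
    partner (z , z≢r , c , ∂z) =
      let C′ , ys , p = pick-root xs z (trans (cong (_xor rootsum xs z) (sym (==-≢ (λ e → z≢r (sym e))))) (trans (sym (h z)) ∂z))
          S , S⊑J , j = conn⇒join c
      in finish z C′ ys p S S⊑J j
      where
      finish : ∀ z C′ ys → Pick xs (C′ , z) ys → ∀ S → S ⊑ J → Join S r z → Pairing ((C , r) ∷ xs) J
      finish z C′ ys p S S⊑J j =
        let ok′ , oks′ = All-pick p oks
            d′ , _ = All-pick p d
            _ , dis′ = Disj-pick p dis
            B , bell , C⊑ , C′⊑ , sz = join-bell sc (proj₁ ok′) d′ r∈ (proj₂ ok′) j
            mkPairing bs bs-ok cov size cnt = pairing-rec k ys (J ⊖ S)
              (≤-trans (≤-trans (n≤1+n _) (≤-reflexive (sym (length-pick p)))) le) oks′ dis′ (λ v →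
                trans (sym (∂-cong (⊕⊖ S⊑J) v)) (trans (∂-⊕ J S v) (trans (cong₂ _xor_ (trans (h v) (cong ((r == v) xor_) (rootsum-pick p v))) (∂J j v))
                  (bool₃ (λ a b c → (a xor (b xor c)) xor (a xor b)) (λ a b c → c) (r == v) (z == v) (rootsum ys v)))))
        in mkPairing (B ∷ bs) (bell ∷ bs-ok) (λ e a → cov′ e B C⊑ C′⊑ bs (cov e) a)
             (≤-trans (size-arith (# B) (# C) (# C′) (# S) (total bs) (size-of ys) (# (J ⊖ S)) sz size)
               (≤-reflexive (cong₂ _+_ (cong (# C +_) (sym (size-pick p))) (sym (#-⊖ J S S⊑J)))))
             (trans (cong suc (trans (length-pick p) (cong suc cnt))) (double (length bs)))
        where
        double : ∀ k → suc (suc (2 * k)) ≡ 2 * suc k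
        double = solve-∀
        cov′ : ∀ e B → C ⊑ B → C′ ⊑ B → ∀ bs → (Any (λ x → proj₁ x e ≡ true) ys → Any (λ B → B e ≡ true) bs) →
               Any (λ x → proj₁ x e ≡ true) ((C , r) ∷ xs) → Any (λ B → B e ≡ true) (B ∷ bs)
        cov′ e B C⊑ C′⊑ bs f (here q) = here (C⊑ e q)
        cov′ e B C⊑ C′⊑ bs f (there a) with Any-pick p a
        ... | inj₁ q = here (C′⊑ e q)
        ... | inj₂ a′ = there (f a′)

  abstract
    pairing : ∀ xs J → All RootOk xs → AllPairs RDisj xs → (∀ v → ∂ J v ≡ rootsum xs v) → Pairing xs J
    pairing xs J = pairing-rec (length xs) xs J ≤-refl

  -- The choice of roots is a parameter: any vertex does for averaged joins, while joins inside a
  -- central cycle need roots on that cycle.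
  module Roots (choose : ∀ {C} → Signed true C → ∃ λ v → vert C v ≡ true) where

    roots : ∀ {Cs} → All (Signed true) Cs → List Rooted
    roots [] = []
    roots {C ∷ _} (sc ∷ scs) = (C , proj₁ (choose sc)) ∷ roots scs

    roots-ok : ∀ {Cs} (scs : All (Signed true) Cs) → All RootOk (roots scs)
    roots-ok [] = []
    roots-ok (sc ∷ scs) = (sc , proj₂ (choose sc)) ∷ roots-ok scs

    map-roots : ∀ {Cs} (scs : All (Signed true) Cs) → map proj₁ (roots scs) ≡ Cs
    map-roots [] = refl
    map-roots (_ ∷ scs) = cong (_ ∷_) (map-roots scs)

    length-roots : ∀ {Cs} (scs : All (Signed true) Cs) → length (roots scs) ≡ length Cs
    length-roots [] = refl
    length-roots (_ ∷ scs) = cong suc (length-roots scs)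

    roots-All : ∀ {P : EdgeSet m → Set} {Cs} (scs : All (Signed true) Cs) → All P Cs → All (P ∘ proj₁) (roots scs)
    roots-All [] [] = []
    roots-All (_ ∷ scs) (p ∷ ps) = p ∷ roots-All scs ps

    roots-disj : ∀ {Cs} (scs : All (Signed true) Cs) → AllPairs VDisj Cs → AllPairs RDisj (roots scs)
    roots-disj [] [] = []
    roots-disj (_ ∷ scs) (p ∷ ps) = roots-All scs p ∷ roots-disj scs ps

    roots-Any : ∀ {P : EdgeSet m → Set} {Cs} (scs : All (Signed true) Cs) → Any P Cs → Any (P ∘ proj₁) (roots scs)
    roots-Any (_ ∷ scs) (here p) = here p
    roots-Any (_ ∷ scs) (there a) = there (roots-Any scs a)

    roots-in : ∀ {P : Fin n → Set} → (∀ {C} (sc : Signed true C) → P (proj₁ (choose sc))) →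
               ∀ {Cs} (scs : All (Signed true) Cs) → All (P ∘ proj₂) (roots scs)
    roots-in h [] = []
    roots-in h (sc ∷ scs) = h sc ∷ roots-in h scs

    size-roots : ∀ {Cs} (scs : All (Signed true) Cs) → size-of (roots scs) ≡ total Cs
    size-roots scs = cong total (map-roots scs)

  -- The sum of joins from `x` to all roots. The vertex `x` is an end of each of them, which
  -- accounts for the last term.
  root-join : ∀ {H} (A : Fin n → Bool) x → (∀ v → A v ≡ true → Conn G H x v) → ∀ xs → All (λ y → A (proj₂ y) ≡ true) xs →
              ∃ λ J → J ⊑ H × (∀ v → ∂ J v ≡ rootsum xs v xor (odd? (length xs) ∧ (x == v)))
  root-join A x c [] [] = ∅ , (λ _ ()) , ∂-∅ {∅} (λ _ → refl)
  root-join {H} A x c ((C , r) ∷ xs) (p ∷ ps) =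
    let J , J⊑ , h = root-join A x c xs ps
        S , S⊑ , j = conn⇒join (c r p)
    in S ⊕ J , (λ e q → [ S⊑ e , J⊑ e ]′ (xor-true {S e} q)) , λ v →
       trans (∂-⊕ S J v) (trans (cong₂ _xor_ (∂J j v) (h v))
         (bool₄ (λ x r y o → (x xor r) xor (y xor (o ∧ x))) (λ x r y o → (r xor y) xor (not o ∧ x))
            (x == v) (r == v) (rootsum xs v) (odd? (length xs))))

-- Balls in a 2-edge-connected cubic graph

at-most-one : ∀ {k} (f : Fin k → Bool) → (∀ i j → f i ≡ true → f j ≡ true → i ≡ j) → # f ≤ 1
at-most-one f h with any? (λ i → f i ≟ᵇ true)
... | no none = ≤-trans (≤-reflexive (#-∅ (λ i → ≢true (λ q → none (i , q))))) z≤n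
... | yes (i , fi) = ≤-trans (#-mono (λ j fj → subst (λ x → (i == x) ≡ true) (h i j fi fj) (==-refl i))) (≤-reflexive (#-singleton i))

disjoint-family : ∀ {k n} (B : Fin k → Fin n → Bool) →
                  (∀ i j v → B i v ≡ true → B j v ≡ true → i ≡ j) → ∑ (λ i → # (B i)) ≤ n
disjoint-family {k} {n} B h = ≤-trans (≤-reflexive (∑-swap (λ i v → 𝟙 (B i v))))
  (≤-trans (∑-mono (λ v → at-most-one (λ i → B i v) (λ i j → h i j v)))
    (≤-reflexive (trans (∑-const n 1) (*-identityʳ n))))

#-⊕-≤ : ∀ {k} (f g : Fin k → Bool) → # (f ⊕ g) ≤ # f + # g
#-⊕-≤ f g = ≤-trans (#-mono {f = f ⊕ g} {g = f ⊔ g} (λ i h → go (f i) (g i) h)) (#-⊔-≤ f g)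
  where
  go : ∀ a b → a xor b ≡ true → a ∨ b ≡ true
  go true b _ = refl
  go false b h = h

module Balls (G : Graph) (σ : Fin (Graph.m G) → Sign) (cubic : Cubic G) (tec : TwoEdgeConnected G) where
  open Pairings G σ cubic public

  cut≥2 : ∀ A {x y} → A x ≡ true → A y ≡ false → 2 ≤ # (δ A)
  cut≥2 A {x} {y} Ax Ay with 2 ≤? # (δ A)
  ... | yes p = p
  ... | no ¬p = ⊥-elim (search (any? (λ e → δ A e ≟ᵇ true)))
    where
    search : Dec (∃ λ e → δ A e ≡ true) → ⊥
    search (no none) = true≢false (trans (sym (conn-closed A (λ e _ → ≢true (λ q → none (e , q))) (proj₁ tec x y))) Ax) Ay
    search (yes (e , de)) = true≢false (trans (sym (conn-closed A closed (proj₂ tec e x y))) Ax) Ay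
      where
      closed : ∀ f → not ⌊ f ≟ e ⌋ ≡ true → δ A f ≡ false
      closed f ne = ≢true (λ df → ¬p (≤-trans (s≤s (#-pos (δ A ⊖ (e ==_)) f
          (∧-intro df (trans (cong not (==-sym e f)) ne)))) (≤-reflexive (sym (#-remove (δ A) e de)))))

  touches : (Fin n → Bool) → Fin n → Fin m → Bool
  touches A v e = (A (s e) ∧ (t e == v)) ∨ (A (t e) ∧ (s e == v))

  grow : (Fin n → Bool) → Fin n → Bool
  grow A v = A v ∨ ⌊ any? (λ e → touches A v e ≟ᵇ true) ⌋

  grow-edge : ∀ A e → A (s e) ≡ true ⊎ A (t e) ≡ true → grow A (s e) ≡ true × grow A (t e) ≡ true
  grow-edge A e (inj₁ p) = ∨-introˡ p ,
    ∨-introʳ {A (t e)} (dec-true (any? _) (e , ∨-introˡ (∧-intro p (==-refl (t e)))))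
  grow-edge A e (inj₂ p) =
    ∨-introʳ {A (s e)} (dec-true (any? _) (e , ∨-introʳ {A (s e) ∧ (t e == s e)} (∧-intro p (==-refl (s e))))) , ∨-introˡ p

  δ-end : ∀ A e → δ A e ≡ true → A (s e) ≡ true ⊎ A (t e) ≡ true
  δ-end A e h = xor-true {A (s e)} h

  -- Suppose `v` is the only new vertex. Every edge leaving `A` then ends at `v`, and every edge
  -- leaving `grow A` starts there. The two cuts would share the three half-edges at `v`, although
  -- each has at least two edges.
  grow-≥2 : ∀ A {x y} → A x ≡ true → grow A y ≡ false → # A + 2 ≤ # (grow A)
  grow-≥2 A {x} {y} Ax By with 2 ≤? # (grow A ⊖ A)
  ... | yes p = ≤-trans (+-monoʳ-≤ (# A) p) (≤-reflexive (sym (#-⊖ (grow A) A (λ v h → ∨-introˡ h))))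
  ... | no ¬p = ⊥-elim (search (any? (λ v → (grow A ⊖ A) v ≟ᵇ true)))
    where
    B = grow A
    Ay : A y ≡ false
    Ay = ≢true (λ h → true≢false (∨-introˡ h) By)
    2≤A = cut≥2 A Ax Ay
    search : Dec (∃ λ v → (B ⊖ A) v ≡ true) → ⊥
    search (no none) = <⇒≱ 2≤A (≤-trans (≤-reflexive (#-∅ closed)) z≤n)
      where
      inA : ∀ v → B v ≡ true → A v ≡ true
      inA v h = ≢false (λ q → none (v , ∧-intro h (cong not q)))
      closed : ∀ e → δ A e ≡ false
      closed e = ≢true (λ d → let a , b = grow-edge A e (δ-end A e d) in
        true≢false d (cong₂ _xor_ (inA (s e) a) (inA (t e) b)))
    search (yes (v , hv)) = <⇒≱ (s≤s total≤) (+-mono-≤ 2≤A (cut≥2 B (∨-introˡ Ax) By))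
      where
      Av : A v ≡ false
      Av = not-true (proj₂ (∧-true {B v} hv))
      Bv : B v ≡ true
      Bv = proj₁ (∧-true {B v} hv)
      only : ∀ w → B w ≡ true → A w ≡ false → v ≡ w
      only w b a with v ≟ w
      ... | yes e = e
      ... | no v≢w = ⊥-elim (¬p (≤-trans (s≤s (#-pos ((B ⊖ A) ⊖ (v ==_)) w (∧-intro (∧-intro b (cong not a)) (cong not (==-≢ v≢w)))))
                        (≤-reflexive (sym (#-remove (B ⊖ A) v hv)))))
      A⇒B : ∀ w → A w ≡ true → B w ≡ true
      A⇒B w h = ∨-introˡ h
      point : ∀ e → 𝟙 (δ A e) + 𝟙 (δ B e) ≤ half true (s e == v) (t e == v)
      point e = go (bool-split (A (s e))) (bool-split (A (t e))) (bool-split (B (s e))) (bool-split (B (t e)))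
        where
        eqs : ∀ {a b c d} → A (s e) ≡ a → A (t e) ≡ b → B (s e) ≡ c → B (t e) ≡ d →
              𝟙 (a xor b) + 𝟙 (c xor d) ≤ half true (s e == v) (t e == v) →
              𝟙 (δ A e) + 𝟙 (δ B e) ≤ half true (s e == v) (t e == v)
        eqs refl refl refl refl h = h
        sv : s e ≡ v → 1 ≤ half true (s e == v) (t e == v)
        sv p = ≤-trans (≤-reflexive (sym (cong 𝟙 (trans (cong (_== v) p) (==-refl v))))) (m≤m+n (𝟙 (s e == v)) (𝟙 (t e == v)))
        tv : t e ≡ v → 1 ≤ half true (s e == v) (t e == v)
        tv p = ≤-trans (≤-reflexive (sym (cong 𝟙 (trans (cong (_== v) p) (==-refl v))))) (m≤n+m (𝟙 (t e == v)) (𝟙 (s e == v)))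
        go : A (s e) ≡ true ⊎ A (s e) ≡ false → A (t e) ≡ true ⊎ A (t e) ≡ false →
             B (s e) ≡ true ⊎ B (s e) ≡ false → B (t e) ≡ true ⊎ B (t e) ≡ false →
             𝟙 (δ A e) + 𝟙 (δ B e) ≤ half true (s e == v) (t e == v)
        go (inj₁ a) (inj₁ b) _ _ = eqs a b (A⇒B _ a) (A⇒B _ b) z≤n
        go (inj₁ a) (inj₂ b) _ _ = let p , q = grow-edge A e (inj₁ a) in eqs a b p q (tv (sym (only (t e) q b)))
        go (inj₂ a) (inj₁ b) _ _ = let p , q = grow-edge A e (inj₂ b) in eqs a b p q (sv (sym (only (s e) p a)))
        go (inj₂ a) (inj₂ b) (inj₁ c) (inj₁ d) = eqs a b c d z≤n
        go (inj₂ a) (inj₂ b) (inj₂ c) (inj₂ d) = eqs a b c d z≤n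
        go (inj₂ a) (inj₂ b) (inj₁ c) (inj₂ d) = eqs a b c d (sv (sym (only (s e) c a)))
        go (inj₂ a) (inj₂ b) (inj₂ c) (inj₁ d) = eqs a b c d (tv (sym (only (t e) d b)))
      total≤ : # (δ A) + # (δ B) ≤ 3
      total≤ = ≤-trans (≤-reflexive (sym (∑-+ (𝟙 ∘ δ A) (𝟙 ∘ δ B)))) (≤-trans (∑-mono point) (≤-reflexive (cubic v)))

  ball : (Fin n → Bool) → ℕ → Fin n → Bool
  ball A zero = A
  ball A (suc r) = grow (ball A r)

  ball-⊇ : ∀ A r v → A v ≡ true → ball A r v ≡ true
  ball-⊇ A zero v h = h
  ball-⊇ A (suc r) v h = ∨-introˡ (ball-⊇ A r v h)

  ball-size : ∀ A {x y} r → A x ≡ true → ball A r y ≡ false → # A + 2 * r ≤ # (ball A r)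
  ball-size A zero Ax h = ≤-reflexive (+-identityʳ (# A))
  ball-size A {x} {y} (suc r) Ax h = ≤-trans (≤-reflexive (lem (# A) r))
      (≤-trans (+-monoˡ-≤ 2 (ball-size A r Ax (≢true (λ q → true≢false (∨-introˡ q) h)))) (grow-≥2 (ball A r) (ball-⊇ A r x Ax) h))
    where
    lem : ∀ a r → a + 2 * suc r ≡ (a + 2 * r) + 2
    lem = solve-∀

  ball-join : ∀ A r v → ball A r v ≡ true → ∃ λ u → A u ≡ true × ∃ λ S → Join S u v × # S ≤ r
  ball-join A zero v h = v , h , ∅ , Join-refl v , ≤-reflexive (#-∅ {f = ∅ {m}} (λ _ → refl))
  ball-join A (suc r) v h = go (∨-true {ball A r v} h)
    where
    Goal = ∃ λ u → A u ≡ true × ∃ λ S → Join S u v × # S ≤ suc r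
    via : ∀ w e → ball A r w ≡ true → Join (e ==_) w v → Goal
    via w e hw je = let u , Au , S , j , le = ball-join A r w hw in
      u , Au , S ⊕ (e ==_) , Join-⊕ j je ,
      ≤-trans (#-⊕-≤ S (e ==_)) (≤-trans (+-mono-≤ le (≤-reflexive (#-singleton e))) (≤-reflexive (+-comm r 1)))
    go : ball A r v ≡ true ⊎ ⌊ any? (λ e → touches (ball A r) v e ≟ᵇ true) ⌋ ≡ true → Goal
    go (inj₁ p) = let u , Au , S , j , le = ball-join A r v p in u , Au , S , j , ≤-trans le (n≤1+n r)
    go (inj₂ p) = edge (true-dec (any? (λ e → touches (ball A r) v e ≟ᵇ true)) p)
      where
      edge : (∃ λ e → touches (ball A r) v e ≡ true) → Goal
      edge (e , q) = which (∨-true {ball A r (s e) ∧ (t e == v)} q)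
        where
        which : ball A r (s e) ∧ (t e == v) ≡ true ⊎ ball A r (t e) ∧ (s e == v) ≡ true → Goal
        which (inj₁ x) = let a , b = ∧-true {ball A r (s e)} x in via (s e) e a (subst (Join (e ==_) (s e)) (==-≡ b) (Join-edge e))
        which (inj₂ x) = let a , b = ∧-true {ball A r (t e)} x in via (t e) e a (subst (Join (e ==_) (t e)) (==-≡ b) (Join-sym (Join-edge e)))

  -- When the ball of radius `r + 1` first meets `B`, the one of radius `r` is disjoint from `B` and
  -- has at least |A| + 2r vertices. The path has length at most `r + 1`, whence the summand 2.
  near-rec : ∀ A B {x y} → A x ≡ true → B y ≡ true → ∀ k r → n ≤ r + k → (∀ v → ball A r v ≡ true → B v ≡ false) →
             ∃ λ u → ∃ λ v → A u ≡ true × B v ≡ true × ∃ λ S → Join S u v × 2 * # S + (# A + # B) ≤ n + 2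
  near-rec A B {x} {y} Ax By k r fuel dis = go (any? (λ v → (ball A (suc r) v ∧ B v) ≟ᵇ true)) k fuel
    where
    y∉ : ball A r y ≡ false
    y∉ = ≢true (λ h → true≢false By (dis y h))
    room : # (ball A r) + # B ≤ n
    room = ≤-trans (≤-reflexive (sym (#-⊔-disj (ball A r) B (λ v → go′ (ball A r v) (B v) (dis v))))) (#≤k _)
      where
      go′ : ∀ a b → (a ≡ true → b ≡ false) → a ∧ b ≡ false
      go′ true b h = h refl
      go′ false b h = refl
    fits : (# A + 2 * r) + # B ≤ n
    fits = ≤-trans (+-monoˡ-≤ (# B) (ball-size A r Ax y∉)) room
    Goal = ∃ λ u → ∃ λ v → A u ≡ true × B v ≡ true × ∃ λ S → Join S u v × 2 * # S + (# A + # B) ≤ n + 2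
    go : Dec (∃ λ v → ball A (suc r) v ∧ B v ≡ true) → ∀ k → n ≤ r + k → Goal
    go (yes (v , h)) k fuel =
      let a , b = ∧-true {ball A (suc r) v} h
          u , Au , S , j , le = ball-join A (suc r) v a
      in u , v , Au , b , S , j , ≤-trans (+-monoˡ-≤ (# A + # B) (*-monoʳ-≤ 2 le))
           (≤-trans (≤-reflexive (lem r (# A) (# B))) (+-monoˡ-≤ 2 fits))
      where
      lem : ∀ r a b → 2 * suc r + (a + b) ≡ ((a + 2 * r) + b) + 2
      lem = solve-∀
    go (no none) (suc k) fuel = near-rec A B Ax By k (suc r) (≤-trans fuel (≤-reflexive (+-suc r k)))
      (λ v h → ≢true (λ q → none (v , ∧-intro h q)))
    go (no none) zero fuel = ⊥-elim (<⇒≱ (s≤s (≤-trans fuel (≤-reflexive (+-identityʳ r))))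
      (≤-trans (≤-trans (s≤s (m≤m+n r (r + 0))) (+-monoˡ-≤ (2 * r) (#-pos A x Ax))) (≤-trans (m≤m+n (# A + 2 * r) (# B)) fits)))

  near : ∀ A B {x y} → A x ≡ true → B y ≡ true → (∀ v → A v ≡ true → B v ≡ false) →
         ∃ λ u → ∃ λ v → A u ≡ true × B v ≡ true × ∃ λ S → Join S u v × 2 * # S + (# A + # B) ≤ n + 2
  near A B Ax By dis = near-rec A B Ax By n 0 ≤-refl dis

  -- Among k disjoint sets, with kℓ > n, two are close.  The radii (ℓ + 1 − |A|)/2 favour small sets.
  module _ {k : ℕ} (A : Fin k → Fin n → Bool) (pt : ∀ i → ∃ λ x → A i x ≡ true)
           (dis : ∀ i j → ¬ i ≡ j → ∀ v → A i v ≡ true → A j v ≡ false)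
           (ℓ : ℕ) (big : n < k * ℓ) where

    radius : Fin k → ℕ
    radius i = (suc ℓ ∸ # (A i)) / 2

    two-radius : ∀ i → 2 * radius i ≤ suc ℓ ∸ # (A i)
    two-radius i = ≤-trans (≤-reflexive (*-comm 2 (radius i))) (m/n*n≤m (suc ℓ ∸ # (A i)) 2)

    -- Halving starts from `suc ℓ`, which makes up for rounding down.
    radius-big : ∀ i → ℓ ≤ # (A i) + 2 * radius i
    radius-big i = s≤s⁻¹ (≤-trans (≤-trans (m≤n+m∸n (suc ℓ) (# (A i))) (+-monoʳ-≤ (# (A i)) half-up)) (≤-reflexive (+-suc (# (A i)) (2 * radius i))))
      where
      d = suc ℓ ∸ # (A i)
      half-up : d ≤ suc (2 * radius i)
      half-up = ≤-trans (≤-reflexive (m≡m%n+[m/n]*n d 2)) (+-mono-≤ (s≤s⁻¹ (m%n<n d 2)) (≤-reflexive (*-comm (radius i) 2)))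

    B : Fin k → Fin n → Bool
    B i = ball (A i) (radius i)

    Close : Fin k → Fin k → Set
    Close i j = ∃ λ u → ∃ λ v → A i u ≡ true × A j v ≡ true × ∃ λ S → Join S u v × # S ≤ radius i + radius j

    meeting : ∀ i j v → B i v ≡ true → B j v ≡ true → Close i j
    meeting i j v p q =
      let u , Au , S , jS , le = ball-join (A i) (radius i) v p
          w , Aw , T , jT , le′ = ball-join (A j) (radius j) v q
      in u , w , Au , Aw , S ⊕ T , Join-⊕ jS (Join-sym jT) , ≤-trans (#-⊕-≤ S T) (+-mono-≤ le le′)

    -- With L = ℓ + 1 and a ≤ L, twice the left side is at most 2b + (L - a) + (L - b), which is at
    -- most 2L because b ≤ a. If a exceeds L, its radius is zero and b ≤ L suffices.
    light : ∀ a b r q x → 2 * r ≤ suc ℓ ∸ a → 2 * q ≤ suc ℓ ∸ b → x ≤ r + q → b ≤ a → a ≤ suc ℓ ⊎ b ≤ suc ℓ → b + x ≤ suc ℓ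
    light a b r q x hr hq hx b≤a small = *-cancelˡ-≤ 2 (≤-trans (*-monoʳ-≤ 2 (+-monoʳ-≤ b hx))
        (≤-trans (≤-reflexive (lem b r q)) (≤-trans (+-monoʳ-≤ (b + b) (+-mono-≤ hr hq)) (go (a ≤? suc ℓ)))))
      where
      lem : ∀ b r q → 2 * (b + (r + q)) ≡ (b + b) + (2 * r + 2 * q)
      lem = solve-∀
      L = suc ℓ
      b≤L : b ≤ L
      b≤L = [ (λ a≤ → ≤-trans b≤a a≤) , id ]′ small
      two : L + L ≡ 2 * L
      two = cong (L +_) (sym (+-identityʳ L))
      go : Dec (a ≤ L) → (b + b) + ((L ∸ a) + (L ∸ b)) ≤ 2 * L
      go (yes a≤) = ≤-trans (≤-reflexive (lem₂ b (L ∸ a) (L ∸ b)))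
        (≤-trans (+-mono-≤ (≤-trans (+-monoˡ-≤ (L ∸ a) b≤a) (≤-reflexive (m+[n∸m]≡n a≤))) (≤-reflexive (m+[n∸m]≡n b≤L))) (≤-reflexive two))
        where
        lem₂ : ∀ b x y → (b + b) + (x + y) ≡ (b + x) + (b + y)
        lem₂ = solve-∀
      go (no a≰) = ≤-trans (≤-reflexive (cong (λ z → (b + b) + (z + (L ∸ b))) (m≤n⇒m∸n≡0 (<⇒≤ (≰⇒> a≰)))))
        (≤-trans (≤-reflexive (+-assoc b b (L ∸ b))) (≤-trans (+-mono-≤ b≤L (≤-reflexive (m+[n∸m]≡n b≤L))) (≤-reflexive two)))

    -- Only the second set enters the bound: its cycle will be used twice, together with the path.
    Lopsided : Set
    Lopsided = ∃ λ i → ∃ λ j → ¬ i ≡ j × ∃ λ u → ∃ λ v → A i u ≡ true × A j v ≡ true × ∃ λ S → Join S u v × # (A j) + # S ≤ suc ℓ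

    orient : ∀ i j → ¬ i ≡ j → Close i j → # (A i) ≤ suc ℓ ⊎ # (A j) ≤ suc ℓ → Lopsided
    orient i j i≢j (u , v , Au , Av , S , jS , le) small with # (A j) ≤? # (A i)
    ... | yes p = i , j , i≢j , u , v , Au , Av , S , jS ,
          light (# (A i)) (# (A j)) (radius i) (radius j) (# S) (two-radius i) (two-radius j) le p small
    ... | no ¬p = j , i , (λ e → i≢j (sym e)) , v , u , Av , Au , S , Join-sym jS ,
          light (# (A j)) (# (A i)) (radius j) (radius i) (# S) (two-radius j) (two-radius i)
            (≤-trans le (≤-reflexive (+-comm (radius i) (radius j)))) (<⇒≤ (≰⇒> ¬p)) ([ inj₂ , inj₁ ]′ small)

    radius-0 : ∀ i → ¬ # (A i) ≤ suc ℓ → radius i ≡ 0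
    radius-0 i h = cong (_/ 2) (m≤n⇒m∸n≡0 (<⇒≤ (≰⇒> h)))

    meet-small : ∀ i j v → ¬ i ≡ j → B i v ≡ true → B j v ≡ true → # (A i) ≤ suc ℓ ⊎ # (A j) ≤ suc ℓ
    meet-small i j v i≢j p q with # (A i) ≤? suc ℓ | # (A j) ≤? suc ℓ
    ... | yes a | _ = inj₁ a
    ... | no _ | yes b = inj₂ b
    ... | no a | no b = ⊥-elim (true≢false (subst (λ r → ball (A j) r v ≡ true) (radius-0 j b) q)
                          (dis i j i≢j v (subst (λ r → ball (A i) r v ≡ true) (radius-0 i a) p)))

    abstract
      -- Pairwise disjoint balls would have at least kℓ > n vertices in total.
      lopsided : 2 ≤ k → Lopsided
      lopsided 2≤k with any? (λ i → any? (λ j → ¬? (i ≟ j) ×-dec any? (λ v → (B i v ∧ B j v) ≟ᵇ true)))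
      ... | yes (i , j , i≢j , v , h) =
            let p , q = ∧-true {B i v} h in orient i j i≢j (meeting i j v p q) (meet-small i j v i≢j p q)
      ... | no none = ⊥-elim (<⇒≱ big (≤-trans (≤-reflexive (sym (∑-const k ℓ)))
              (≤-trans (∑-mono (λ i → ≤-trans (radius-big i) (big-ball i)))
                (disjoint-family B (λ i j v p q → same i j v p q)))))
        where
        same : ∀ i j v → B i v ≡ true → B j v ≡ true → i ≡ j
        same i j v p q with i ≟ j
        ... | yes e = e
        ... | no i≢j = ⊥-elim (none (i , j , i≢j , v , ∧-intro p q))
        other : ∀ {k} → 2 ≤ k → (i : Fin k) → ∃ λ j → ¬ i ≡ j
        other (s≤s (s≤s _)) zero = suc zero , λ ()
        other (s≤s (s≤s _)) (suc i) = zero , λ ()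
        big-ball : ∀ i → # (A i) + 2 * radius i ≤ # (B i)
        -- The growth estimate needs a vertex outside the ball; a point of any other set is one.
        big-ball i = let j , i≢j = other 2≤k i ; x , Ax = pt i ; y , Ay = pt j in
          ball-size (A i) {x} {y} (radius i) Ax
            (≢true (λ h → i≢j (same i j y h (ball-⊇ (A j) (radius j) y Ay))))

-- A smallest equivalent signature

⨁-pair : ∀ {k} (f : Fin k → Bool) (i j : Fin k) → ¬ i ≡ j → (∀ l → f l ≡ true → l ≡ i ⊎ l ≡ j) → ⨁ f ≡ f i xor f j
⨁-pair f i j i≢j h = trans (⨁-cong (λ l → go l (l ≟ i) (l ≟ j))) (trans (⨁-xor (λ l → (l == i) ∧ f l) (λ l → (l == j) ∧ f l))
    (cong₂ _xor_ (⨁-single i f) (⨁-single j f)))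
  where
  go : ∀ l → Dec (l ≡ i) → Dec (l ≡ j) → f l ≡ ((l == i) ∧ f l) xor ((l == j) ∧ f l)
  go l (yes refl) (yes refl) = ⊥-elim (i≢j refl)
  go l (yes refl) (no q) = trans (bool₁ (λ x → x) (λ x → (true ∧ x) xor (false ∧ x)) (f l))
    (sym (cong₂ (λ x y → (x ∧ f l) xor (y ∧ f l)) (==-refl l) (==-≢ q)))
  go l (no p) (yes refl) = trans (bool₁ (λ x → x) (λ x → (false ∧ x) xor (true ∧ x)) (f l))
    (sym (cong₂ (λ x y → (x ∧ f l) xor (y ∧ f l)) (==-≢ p) (==-refl l)))
  go l (no p) (no q) = trans (≢true (λ t → [ p , q ]′ (h l t))) (sym (cong₂ (λ x y → (x ∧ f l) xor (y ∧ f l)) (==-≢ p) (==-≢ q)))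

#-⊕ : ∀ {k} (f g : Fin k → Bool) → # (f ⊕ g) ≡ # (f ⊖ g) + # (g ⊖ f)
#-⊕ f g = trans (∑-cong (λ i → go (f i) (g i))) (∑-+ (𝟙 ∘ (f ⊖ g)) (𝟙 ∘ (g ⊖ f)))
  where
  go : ∀ a b → 𝟙 (a xor b) ≡ 𝟙 (a ∧ not b) + 𝟙 (b ∧ not a)
  go true true = refl
  go true false = refl
  go false true = refl
  go false false = refl

module Signature (G : Graph) (σ : Fin (Graph.m G) → Sign) (cubic : Cubic G) (tec : TwoEdgeConnected G) where
  open Balls G σ cubic tec public

  -- Switching at `A` flips the signs of the edges in `δ A`.
  Equivalent : EdgeSet m → Set
  Equivalent N = ∃ λ A → ∀ e → N e ≡ neg e xor δ A e

  abstract
    least-signature : ∃ λ N → Equivalent N × (∀ N′ → Equivalent N′ → # N ≤ # N′)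
    least-signature = least-# {P = Equivalent} (λ h (A , q) → A , λ e → trans (sym (h e)) (q e))
      (λ N → anyPred? {P = λ A → ∀ e → N e ≡ neg e xor δ A e}
         (λ h q e → trans (q e) (cong (neg e xor_) (cong₂ _xor_ (h (s e)) (h (t e)))))
         (λ A → all? (λ e → N e ≟ᵇ (neg e xor δ A e))))
      (# neg) neg ≤-refl (∅ , λ e → sym (xor-identityʳ (neg e)))

  N H : EdgeSet m
  N = proj₁ least-signature
  H = ∁ N

  -- Switching changes signs along a cut, which an even set meets evenly.
  par-N : ∀ {S} → Even S → par S ≡ ⨁ (S ⊓ N)
  par-N {S} ev = sym (trans (⨁-cong (λ e → trans (cong (S e ∧_) (eq e)) (∧-distribˡ-xor (S e) (neg e) (δ A e))))
      (trans (⨁-xor (S ⊓ neg) (λ e → S e ∧ δ A e)) (trans (cong (par S xor_) (Even-cut A ev)) (xor-identityʳ (par S)))))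
    where
    A = proj₁ (proj₁ (proj₂ least-signature))
    eq = proj₂ (proj₁ (proj₂ least-signature))

  par-H : ∀ {S} → Even S → S ⊑ H → par S ≡ false
  par-H {S} ev sub = trans (par-N ev) (⨁-false (λ e → go (S e) (N e) (sub e)))
    where
    go : ∀ a b → (a ≡ true → not b ≡ true) → a ∧ b ≡ false
    go true b h = not-true (h refl)
    go false b h = refl

  -- Otherwise switching at `B` would give fewer negative edges.
  cut-half : ∀ B → # (N ⊓ δ B) ≤ # (δ B ⊖ N)
  cut-half B = +-cancelʳ-≤ (# (N ⊖ δ B)) (# (N ⊓ δ B)) (# (δ B ⊖ N))
    (≤-trans (≤-reflexive (sym (#-split N (δ B)))) (≤-trans (proj₂ (proj₂ least-signature) (N ⊕ δ B) switch)
      (≤-reflexive (trans (#-⊕ N (δ B)) (+-comm (# (N ⊖ δ B)) (# (δ B ⊖ N)))))))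
    where
    switch : Equivalent (N ⊕ δ B)
    switch = let A , eq = proj₁ (proj₂ least-signature) in (A ⊕ B) , λ e →
      trans (cong (_xor δ B e) (eq e)) (trans (xor-assoc (neg e) (δ A e) (δ B e)) (cong (neg e xor_)
        (bool₄ (λ a b c d → (a xor b) xor (c xor d)) (λ a b c d → (a xor c) xor (b xor d)) (A (s e)) (A (t e)) (B (s e)) (B (t e)))))

  #-split-cut : ∀ B → # (δ B) ≡ # (N ⊓ δ B) + # (δ B ⊖ N)
  #-split-cut B = trans (#-split (δ B) N) (cong (_+ # (δ B ⊖ N)) (#-cong (λ e → ∧-comm (δ B e) (N e))))

  -- By `cut-half`, a cut without edges of `H` has no edges of `N` either, and the graph is
  -- connected.
  H-conn : ∀ u v → Conn G H u v
  H-conn u v with conn? H u v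
  ... | yes c = c
  ... | no ¬c = ⊥-elim (<⇒≱ (cut≥2 A (reach-refl H u) (dec-false (conn? H u v) ¬c))
        (≤-trans (≤-reflexive (#-split-cut A)) (≤-trans (+-mono-≤ (≤-trans (cut-half A) (≤-reflexive none)) (≤-reflexive none)) z≤n)))
    where
    A = reach H u
    none : # (δ A ⊖ N) ≡ 0
    none = #-∅ (λ e → ≢true (λ h → let d , ne = ∧-true {δ A e} h in true≢false d (reach-closed H u e ne)))

  H₀ : EdgeSet m
  H₀ = core G H

  abstract
    flow : ShortFlow G H₀
    flow = short-flow G H

  -- A bridge of H forms a 2-edge cut with an edge of N.
  partner : ∀ b → H b ≡ true → H₀ b ≡ false → ∃ λ e → N e ≡ true × (∀ S → Even S → S b ≡ S e)
  partner b Hb b∉ = found (two-elements D 2≤D)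
    where
    F = removeEdge H b
    apart : ¬ Conn G F (s b) (t b)
    apart c = let Q , Q⊑ , j = conn⇒join c in
      true≢false (even⊑core G H (Join⇒Even (Join-⊕ j (Join-sym (Join-edge b))))
        (λ e h → [ (λ q → proj₁ (∧-true (Q⊑ e q))) , (λ q → subst (λ x → H x ≡ true) (==-≡ q) Hb) ]′ (xor-true {Q e} h)) b
        (trans (cong₂ _xor_ (≢true (λ q → true≢false (==-refl b) (not-true (proj₂ (∧-true {H b} (Q⊑ b q)))))) (==-refl b)) refl)) b∉
    A = reach F (s b)
    D = δ A
    2≤D : 2 ≤ # D
    2≤D = cut≥2 A (reach-refl F (s b)) (dec-false (conn? F (s b) (t b)) apart)
    Db : D b ≡ true
    Db = cong₂ _xor_ (reach-refl F (s b)) (dec-false (conn? F (s b) (t b)) apart)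
    one : # (D ⊖ N) ≤ 1
    one = ≤-trans (#-mono (λ e h → ≢false (λ q → let d , ne = ∧-true {D e} h in
             true≢false d (reach-closed F (s b) e (∧-intro ne (cong not q)))))) (≤-reflexive (#-singleton b))
    oneN : # (N ⊓ D) ≤ 1
    oneN = ≤-trans (cut-half A) one
    unique : ∀ {f : EdgeSet m} → # f ≤ 1 → ∀ i j → f i ≡ true → f j ≡ true → j ≡ i
    unique {f} le i j fi fj with j ≟ i
    ... | yes p = p
    ... | no p = ⊥-elim (<⇒≱ (s≤s (#-pos (f ⊖ (i ==_)) j (∧-intro fj (cong not (==-≢ (λ e → p (sym e)))))))
                   (≤-trans (≤-reflexive (sym (#-remove f i fi))) le))
    Goal = ∃ λ e → N e ≡ true × (∀ S → Even S → S b ≡ S e)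
    inN : ∀ e → D e ≡ true → ¬ e ≡ b → N e ≡ true
    inN e de ne = ≢false (λ q → ne (unique one b e (∧-intro Db Hb) (∧-intro de (cong not q))))
    with-e : ∀ e → D e ≡ true → ¬ e ≡ b → Goal
    with-e e de ne = e , inN e de ne , λ S ev → xor≡false (trans (sym (trans (⨁-pair (S ⊓ D) b e (λ p → ne (sym p)) (only S))
        (cong₂ _xor_ (trans (cong (S b ∧_) Db) (∧-identityʳ (S b))) (trans (cong (S e ∧_) de) (∧-identityʳ (S e)))))) (Even-cut A ev))
      where
      only : ∀ S l → (S ⊓ D) l ≡ true → l ≡ b ⊎ l ≡ e
      only S l h with l ≟ b
      ... | yes p = inj₁ p
      ... | no p = let d = proj₂ (∧-true {S l} h) in
                   inj₂ (unique oneN e l (∧-intro (inN e de ne) de) (∧-intro (inN l d p) d))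
    found : (∃ λ i → ∃ λ j → ¬ i ≡ j × D i ≡ true × D j ≡ true) → Goal
    found (i , j , i≢j , di , dj) with i ≟ b
    ... | no p = with-e i di p
    ... | yes p = with-e j dj (λ q → i≢j (trans p (sym q)))

  -- As `H` is connected, each edge of `N` closes up through `H` to an even set that contains no
  -- other edge of `N`. Sums of these realise every trace on `N`.
  prescribe : ∀ F → F ⊑ N → ∃ λ W → Even W × (∀ f → N f ≡ true → W f ≡ F f)
  prescribe F F⊑N = W , mkEven evW , onN
    where
    fund : ∀ e → ∃ λ Y → Even Y × (∀ f → N f ≡ true → Y f ≡ (f == e))
    fund e with conn⇒join (H-conn (s e) (t e))
    ... | Q , Q⊑ , j = Q ⊕ (e ==_) , Join⇒Even (Join-⊕ j (Join-sym (Join-edge e))) , λ f Nf →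
        cong₂ _xor_ (≢true (λ q → true≢false Nf (not-true (Q⊑ f q)))) (==-sym e f)
    Y : Fin m → EdgeSet m
    Y e = proj₁ (fund e)
    W : EdgeSet m
    W f = ⨁ (λ e → F e ∧ Y e f)
    evW : ∀ v → ∂ W v ≡ false
    evW v = trans (⨁-cong λ f → trans (∧-comm (W f) (inc f v)) (sym (⨁-∧ (inc f v) (λ e → F e ∧ Y e f))))
      (trans (⨁-swap (λ f e → inc f v ∧ (F e ∧ Y e f)))
      (⨁-false (λ e → trans (⨁-cong λ f → bool₃ (λ i a y → i ∧ (a ∧ y)) (λ i a y → a ∧ (y ∧ i)) (inc f v) (F e) (Y e f))
        (trans (⨁-∧ (F e) (λ f → Y e f ∧ inc f v)) (trans (cong (F e ∧_) (∂0 (proj₁ (proj₂ (fund e))) v)) (∧-zeroʳ (F e)))))))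
    onN : ∀ f → N f ≡ true → W f ≡ F f
    onN f Nf = trans (⨁-cong λ e → trans (cong (F e ∧_) (trans (proj₂ (proj₂ (fund e)) f Nf) (==-sym f e))) (∧-comm (F e) (e == f)))
                 (⨁-single f F)

  h r : ℕ
  h = # H₀
  r = # (∁ H₀)

  h+r : h + r ≡ m
  h+r = trans (sym (#-⊖ (allEdges G) H₀ (λ _ _ → refl))) (#-true {f = allEdges G} (λ _ → refl))

  -- Averaging controls only the part in `H₀`; the `r` other edges are all counted as used.
  core-split : ∀ {S} → 2 * # (S ⊓ H₀) ≤ h → 2 * # S ≤ h + 2 * r
  core-split {S} le = ≤-trans (≤-reflexive (trans (cong (2 *_) (#-split S H₀)) (*-distribˡ-+ 2 (# (S ⊓ H₀)) (# (S ⊖ H₀)))))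
    (+-mono-≤ le (*-monoʳ-≤ 2 (#-mono (λ e q → proj₂ (∧-true {S e} q)))))

  H₀⊑H : H₀ ⊑ H
  H₀⊑H = core⊑ G H

  N⊑ : N ⊑ ∁ H₀
  N⊑ e q = cong not (≢true (λ p → true≢false q (not-true (H₀⊑H e p))))

  #N≤r : # N ≤ r
  #N≤r = #-mono N⊑

  represent : ∀ F → F ⊑ N → ∃ λ W → Even W × (∀ f → N f ≡ true → W f ≡ F f) × 2 * # W ≤ h + 2 * r
  represent F F⊑N =
    let W , ev , on = prescribe F F⊑N
        V , evV , V⊑ , le = ShortFlow.shift flow W
    in W ⊕ V , Even-⊕ ev evV ,
       (λ f Nf → trans (cong (W f xor_) (≢true (λ q → true≢false Nf (not-true (H₀⊑H f (V⊑ f q)))))) (trans (xor-identityʳ (W f)) (on f Nf))) ,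
       core-split {W ⊕ V} le

  average-join : ∀ xs → odd? (length xs) ≡ false → ∃ λ J → (∀ v → ∂ J v ≡ rootsum xs v) × 2 * # J ≤ h + 2 * r
  average-join [] ev = ∅ , ∂-∅ {∅} (λ _ → refl) , ≤-trans (≤-reflexive (cong (2 *_) (#-∅ {f = ∅ {m}} (λ _ → refl)))) z≤n
  average-join (x ∷ xs) ev =
    let J , _ , hJ = root-join {H} (λ _ → true) (proj₂ x) (λ v _ → H-conn (proj₂ x) v) (x ∷ xs) (everything (x ∷ xs))
        V , evV , V⊑ , le = ShortFlow.shift flow J
    in J ⊕ V , (λ v → trans (∂-⊕ J V v) (trans (cong₂ _xor_ (trans (hJ v) (cong (λ o → rootsum (x ∷ xs) v xor (o ∧ (proj₂ x == v))) ev)) (∂0 evV v))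
                 (bool₁ (λ a → (a xor false) xor false) (λ a → a) (rootsum (x ∷ xs) v)))) ,
       core-split {J ⊕ V} le
    where
    everything : ∀ (xs : List Rooted) → All (λ _ → true ≡ true) xs
    everything [] = []
    everything (_ ∷ xs) = refl ∷ everything xs

-- Signed flows

∑ℤ-cong : ∀ {k} {f g : Fin k → ℤ} → (∀ i → f i ≡ g i) → ∑ℤ f ≡ ∑ℤ g
∑ℤ-cong {zero} h = refl
∑ℤ-cong {suc k} h = cong₂ _+ℤ_ (h zero) (∑ℤ-cong (h ∘ suc))

∑ℤ-zero : ∀ {k} {f : Fin k → ℤ} → (∀ i → f i ≡ 0ℤ) → ∑ℤ f ≡ 0ℤ
∑ℤ-zero {zero} h = refl
∑ℤ-zero {suc k} h = cong₂ _+ℤ_ (h zero) (∑ℤ-zero (h ∘ suc))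

+ℤ-interchange : ∀ a b c d → (a +ℤ b) +ℤ (c +ℤ d) ≡ (a +ℤ c) +ℤ (b +ℤ d)
+ℤ-interchange a b c d = trans (ℤ.+-assoc a b (c +ℤ d)) (trans (cong (a +ℤ_)
  (trans (sym (ℤ.+-assoc b c d)) (trans (cong (_+ℤ d) (ℤ.+-comm b c)) (ℤ.+-assoc c b d)))) (sym (ℤ.+-assoc a c (b +ℤ d))))

∑ℤ-+ : ∀ {k} (f g : Fin k → ℤ) → ∑ℤ (λ i → f i +ℤ g i) ≡ ∑ℤ f +ℤ ∑ℤ g
∑ℤ-+ {zero} f g = refl
∑ℤ-+ {suc k} f g = trans (cong ((f zero +ℤ g zero) +ℤ_) (∑ℤ-+ (f ∘ suc) (g ∘ suc)))
                         (+ℤ-interchange (f zero) (g zero) (∑ℤ (f ∘ suc)) (∑ℤ (g ∘ suc)))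

∑ℤ-swap : ∀ {k l} (f : Fin k → Fin l → ℤ) → ∑ℤ (λ i → ∑ℤ (f i)) ≡ ∑ℤ (λ j → ∑ℤ (λ i → f i j))
∑ℤ-swap {zero} {l} f = sym (∑ℤ-zero {l} {λ _ → 0ℤ} (λ _ → refl))
∑ℤ-swap {suc k} f = trans (cong (∑ℤ (f zero) +ℤ_) (∑ℤ-swap (f ∘ suc)))
                          (sym (∑ℤ-+ (f zero) (λ j → ∑ℤ (λ i → f (suc i) j))))

∑ℤ-single : ∀ {k} (j : Fin k) (f : Fin k → ℤ) → ∑ℤ (λ i → if j == i then f i else 0ℤ) ≡ f j
∑ℤ-single {suc k} zero f =
  trans (cong (f zero +ℤ_) (∑ℤ-zero {k} {λ i → if zero == suc i then f (suc i) else 0ℤ}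
    (λ i → cong (λ b → if b then f (suc i) else 0ℤ) (==-≢ {u = zero} {suc i} (λ ()))))) (ℤ.+-identityʳ (f zero))
∑ℤ-single {suc k} (suc j) f =
  trans (cong₂ _+ℤ_ (cong (λ b → if b then f zero else 0ℤ) (==-≢ {u = suc j} {zero} (λ ())))
                    (∑ℤ-cong (λ i → cong (λ b → if b then f (suc i) else 0ℤ) (==-suc j i))))
        (trans (ℤ.+-identityˡ _) (∑ℤ-single j (f ∘ suc)))

negIf : Bool → ℤ → ℤ
negIf true x = - x
negIf false x = x

negIf-+ : ∀ b x y → negIf b (x +ℤ y) ≡ negIf b x +ℤ negIf b y
negIf-+ true x y = ℤ.neg-distrib-+ x y
negIf-+ false x y = refl

negIf-0 : ∀ b → negIf b 0ℤ ≡ 0ℤ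
negIf-0 true = refl
negIf-0 false = refl

negIf-xor : ∀ a b x → negIf a (negIf b x) ≡ negIf (a xor b) x
negIf-xor true true x = ℤ.neg-involutive x
negIf-xor true false x = refl
negIf-xor false b x = refl

negIf-if : ∀ b c x → negIf b (if c then x else 0ℤ) ≡ (if c then negIf b x else 0ℤ)
negIf-if b true x = refl
negIf-if b false x = negIf-0 b

negIf-∑ : ∀ {k} b (f : Fin k → ℤ) → negIf b (∑ℤ f) ≡ ∑ℤ (λ i → negIf b (f i))
negIf-∑ {zero} b f = negIf-0 b
negIf-∑ {suc k} b f = trans (negIf-+ b (f zero) (∑ℤ (f ∘ suc))) (cong (negIf b (f zero) +ℤ_) (negIf-∑ b (f ∘ suc)))

double-0 : ∀ x → x +ℤ x ≡ 0ℤ → x ≡ 0ℤ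
double-0 (ℤ⁺ zero) _ = refl
double-0 (ℤ⁺ (suc k)) ()
double-0 (ℤ⁻ k) ()

module Flows (G : Graph) (σ : Fin (Graph.m G) → Sign) where
  open EvenSets G

  module _ (τ : Orientation G σ) (f : Fin m → ℤ) (isFlow : IsFlow G σ τ f) (A : Fin n → Bool) where

    a₁ a₂ : Fin m → Bool
    a₁ e = not (isToward G σ (τ e))
    a₂ e = not (isToward G σ (dir₂ G σ τ e))

    a₂-a₁ : ∀ e → a₂ e ≡ a₁ e xor not (isNeg G σ e)
    a₂-a₁ e with σ e
    ... | negative = sym (xor-identityʳ (not (isToward G σ (τ e))))
    ... | positive = flip (τ e)
      where
      flip : ∀ d → not (isToward G σ (flipDir G σ d)) ≡ not (isToward G σ d) xor true
      flip toward = refl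
      flip away = refl

    hd : Fin m → Fin n → ℤ
    hd e v = (if s e == v then negIf (a₁ e) (f e) else 0ℤ) +ℤ (if t e == v then negIf (a₂ e) (f e) else 0ℤ)

    balanced : ∀ v → ∑ℤ (λ e → hd e v) ≡ 0ℤ
    balanced v = trans (∑ℤ-cong (λ e → go (f e) (s e == v) (t e == v) (isToward G σ (τ e)) (isToward G σ (dir₂ G σ τ e))))
      (trans (∑ℤ-+ _ (λ e → - (out e))) (trans (cong₂ _+ℤ_ (isFlow v) (sym (negIf-∑ true out))) (ℤ.+-inverseʳ (outflow G σ τ f v))))
      where
      out : Fin m → ℤ
      out e = (if ⌊ src G e ≟ v ⌋ ∧ not (isToward G σ (τ e)) then f e else 0ℤ)
              +ℤ (if ⌊ tgt G e ≟ v ⌋ ∧ not (isToward G σ (dir₂ G σ τ e)) then f e else 0ℤ)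
      halves : ∀ x a p → (if a then negIf (not p) x else 0ℤ) ≡ (if a ∧ p then x else 0ℤ) +ℤ - (if a ∧ not p then x else 0ℤ)
      halves x true true = sym (ℤ.+-identityʳ x)
      halves x true false = sym (ℤ.+-identityˡ (- x))
      halves x false p = refl
      go : ∀ x a b p q → (if a then negIf (not p) x else 0ℤ) +ℤ (if b then negIf (not q) x else 0ℤ) ≡
           ((if a ∧ p then x else 0ℤ) +ℤ (if b ∧ q then x else 0ℤ)) +ℤ
           - ((if a ∧ not p then x else 0ℤ) +ℤ (if b ∧ not q then x else 0ℤ))
      go x a b p q = trans (cong₂ _+ℤ_ (halves x a p) (halves x b q))
        (trans (+ℤ-interchange (if a ∧ p then x else 0ℤ) (- (if a ∧ not p then x else 0ℤ)) (if b ∧ q then x else 0ℤ) (- (if b ∧ not q then x else 0ℤ)))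
          (cong (((if a ∧ p then x else 0ℤ) +ℤ (if b ∧ q then x else 0ℤ)) +ℤ_)
            (sym (ℤ.neg-distrib-+ (if a ∧ not p then x else 0ℤ) (if b ∧ not q then x else 0ℤ)))))

    -- The contribution of `e` to the sum of the conservation laws of all vertices, those at
    -- vertices of `A` taken with opposite sign. This is the sum for the signature switched at `A`:
    -- zero on positive edges, plus or minus 2 f(e) on negative ones.
    C : Fin m → ℤ
    C e = negIf (A (s e) xor a₁ e) (f e) +ℤ negIf (A (t e) xor a₂ e) (f e)

    ∑C : ∑ℤ C ≡ 0ℤ
    ∑C = trans (∑ℤ-cong (λ e → sym (edge e))) (trans (sym (∑ℤ-swap (λ v e → negIf (A v) (hd e v))))
           (∑ℤ-zero (λ v → trans (sym (negIf-∑ (A v) (λ e → hd e v))) (trans (cong (negIf (A v)) (balanced v)) (negIf-0 (A v))))))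
      where
      end : ∀ u x → ∑ℤ (λ v → if u == v then negIf (A v) x else 0ℤ) ≡ negIf (A u) x
      end u x = ∑ℤ-single u (λ v → negIf (A v) x)
      edge : ∀ e → ∑ℤ (λ v → negIf (A v) (hd e v)) ≡ C e
      edge e = trans (∑ℤ-cong (λ v → trans (negIf-+ (A v) _ _) (cong₂ _+ℤ_ (negIf-if (A v) (s e == v) (negIf (a₁ e) (f e))) (negIf-if (A v) (t e == v) (negIf (a₂ e) (f e))))))
        (trans (∑ℤ-+ (λ v → if s e == v then negIf (A v) (negIf (a₁ e) (f e)) else 0ℤ) (λ v → if t e == v then negIf (A v) (negIf (a₂ e) (f e)) else 0ℤ))
          (cong₂ _+ℤ_ (trans (end (s e) (negIf (a₁ e) (f e))) (negIf-xor (A (s e)) (a₁ e) (f e)))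
                      (trans (end (t e) (negIf (a₂ e) (f e))) (negIf-xor (A (t e)) (a₂ e) (f e)))))

    N : Fin m → Bool
    N e = isNeg G σ e xor δ A e

    C-positive : ∀ e → N e ≡ false → C e ≡ 0ℤ
    C-positive e h = trans (cong (λ b → negIf (A (s e) xor a₁ e) (f e) +ℤ negIf b (f e)) opposite) (cancel (A (s e) xor a₁ e) (f e))
      where
      opposite : A (t e) xor a₂ e ≡ not (A (s e) xor a₁ e)
      opposite = trans (cong (A (t e) xor_) (a₂-a₁ e)) (go (isNeg G σ e) (A (s e)) (A (t e)) (a₁ e) h)
        where
        go : ∀ n a b d → n xor (a xor b) ≡ false → b xor (d xor not n) ≡ not (a xor d)
        go true true false d h = bool₁ (λ d → d xor false) (λ d → not (not d)) d
        go true false true d h = cong not (xor-identityʳ d)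
        go false true true d h = bool₁ (λ d → not (d xor true)) (λ d → not (not d)) d
        go false false false d h = bool₁ (λ d → d xor true) not d
      cancel : ∀ b x → negIf b x +ℤ negIf (not b) x ≡ 0ℤ
      cancel true x = ℤ.+-inverseˡ x
      cancel false x = ℤ.+-inverseʳ x

    C-negative : ∀ e → N e ≡ true → C e ≡ 0ℤ → f e ≡ 0ℤ
    C-negative e h z = twice (A (s e) xor a₁ e) (f e) (trans (cong (λ b → negIf (A (s e) xor a₁ e) (f e) +ℤ negIf b (f e)) (sym same)) z)
      where
      same : A (t e) xor a₂ e ≡ A (s e) xor a₁ e
      same = trans (cong (A (t e) xor_) (a₂-a₁ e)) (go (isNeg G σ e) (A (s e)) (A (t e)) (a₁ e) h)
        where
        go : ∀ n a b d → n xor (a xor b) ≡ true → b xor (d xor not n) ≡ a xor d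
        go true true true d h = cong not (xor-identityʳ d)
        go true false false d h = xor-identityʳ d
        go false true false d h = bool₁ (λ d → d xor true) not d
        go false false true d h = bool₁ (λ d → not (d xor true)) (λ d → d) d
      twice : ∀ b x → negIf b x +ℤ negIf b x ≡ 0ℤ → x ≡ 0ℤ
      twice false x h = double-0 x h
      twice true x h = trans (sym (ℤ.neg-involutive x)) (cong -_ (double-0 (- x) h))

    -- In the vanishing total sum only the term of `e` survives.
    one-negative : ∀ e → N e ≡ true → (∀ g → N g ≡ true → e ≡ g) → f e ≡ 0ℤ
    one-negative e Ne only = C-negative e Ne (trans (sym (trans (∑ℤ-cong (λ g → go g (e ≟ g))) (∑ℤ-single e C))) ∑C)
      where
      go : ∀ g → Dec (e ≡ g) → C g ≡ (if e == g then C g else 0ℤ)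
      go g (yes refl) = cong (λ b → if b then C g else 0ℤ) (sym (==-refl g))
      go g (no q) = trans (C-positive g (≢true (λ h → q (only g h)))) (cong (λ b → if b then C g else 0ℤ) (sym (==-≢ q)))

-- Here b is the size of the cover of H₀, d that of the remaining circuits, h = |H₀| and r = m − h;
-- h + 2r bounds twice the size of an averaged even set or join.
module _ (b d h r n m : ℕ) (hr : h + r ≡ m) (mn : 2 * m ≡ 3 * n) (hb : 7 * b ≤ 12 * h) where

  126n : 126 * n ≡ 84 * (h + r)
  126n = trans (lem₁ n) (trans (cong (42 *_) (sym mn)) (trans (lem₂ m) (cong (84 *_) (sym hr))))
    where
    lem₁ : ∀ n → 126 * n ≡ 42 * (3 * n)
    lem₁ = solve-∀
    lem₂ : ∀ m → 42 * (2 * m) ≡ 84 * m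
    lem₂ = solve-∀

  -- An edge of `H₀` costs 12/7 + 1, any other edge 2.
  budget-even : 2 * d ≤ (h + 2 * r) + (h + 2 * r) → 9 * (b + d) ≤ 26 * m
  budget-even hd = *-cancelˡ-≤ 14 (≤-trans (≤-reflexive (lem₁ b d)) (≤-trans (+-mono-≤ (*-monoʳ-≤ 18 hb) (*-monoʳ-≤ 63 hd))
      (≤-trans (m≤m+n _ (22 * h + 112 * r)) (≤-reflexive (trans (lem₂ h r) (cong (λ m → 14 * (26 * m)) hr))))))
    where
    lem₁ : ∀ b d → 14 * (9 * (b + d)) ≡ 18 * (7 * b) + 63 * (2 * d)
    lem₁ = solve-∀
    lem₂ : ∀ h r → 18 * (12 * h) + 63 * ((h + 2 * r) + (h + 2 * r)) + (22 * h + 112 * r) ≡ 14 * (26 * (h + r))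
    lem₂ = solve-∀

  -- The tight case. With n = 2m/3 an edge outside `H₀` costs 1 + 2/3, and `3 ≤ r` lets each of them
  -- carry another 2/3 to pay for the additive constant 2.
  budget-paths : 3 ≤ r → 2 * d ≤ (h + 2 * r) + (2 * n + 4) → 9 * (b + d) ≤ 26 * m
  budget-paths r≥3 hd = *-cancelˡ-≤ 14 (≤-trans (≤-reflexive (lem₁ b d)) (≤-trans (+-mono-≤ (*-monoʳ-≤ 18 hb) (*-monoʳ-≤ 63 hd))
      (≤-trans (≤-reflexive (trans (lem₂ h r n) (cong (λ x → (279 * h + 126 * r) + (x + 84 * 3)) 126n)))
      (≤-trans (+-monoʳ-≤ (279 * h + 126 * r) (+-monoʳ-≤ (84 * (h + r)) (*-monoʳ-≤ 84 r≥3)))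
      (≤-trans (m≤m+n _ (h + 70 * r)) (≤-reflexive (trans (lem₃ h r) (cong (λ m → 14 * (26 * m)) hr))))))))
    where
    lem₁ : ∀ b d → 14 * (9 * (b + d)) ≡ 18 * (7 * b) + 63 * (2 * d)
    lem₁ = solve-∀
    lem₂ : ∀ h r n → 18 * (12 * h) + 63 * ((h + 2 * r) + (2 * n + 4)) ≡ (279 * h + 126 * r) + (126 * n + 252)
    lem₂ = solve-∀
    lem₃ : ∀ h r → (279 * h + 126 * r) + (84 * (h + r) + 84 * r) + (h + 70 * r) ≡ 14 * (26 * (h + r))
    lem₃ = solve-∀

  -- An edge of `H₀` costs 12/7 + 1 + 2/15. Any other costs 2 + 2/15, and 2/3 for the additive
  -- constant.
  budget-close : 3 ≤ r → 10 * d ≤ 5 * ((h + 2 * r) + (h + 2 * r)) + (2 * n + 20) → 9 * (b + d) ≤ 26 * m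
  budget-close r≥3 hd = *-cancelˡ-≤ 70 (≤-trans (≤-reflexive (lem₁ b d)) (≤-trans (+-mono-≤ (*-monoʳ-≤ 90 hb) (*-monoʳ-≤ 63 hd))
      (≤-trans (≤-reflexive (trans (lem₂ h r n) (cong (λ x → (1710 * h + 1260 * r) + (x + 420 * 3)) 126n)))
      (≤-trans (+-monoʳ-≤ (1710 * h + 1260 * r) (+-monoʳ-≤ (84 * (h + r)) (*-monoʳ-≤ 420 r≥3)))
      (≤-trans (m≤m+n _ (26 * h + 56 * r)) (≤-reflexive (trans (lem₃ h r) (cong (λ m → 70 * (26 * m)) hr))))))))
    where
    lem₁ : ∀ b d → 70 * (9 * (b + d)) ≡ 90 * (7 * b) + 63 * (10 * d)
    lem₁ = solve-∀
    lem₂ : ∀ h r n → 90 * (12 * h) + 63 * (5 * ((h + 2 * r) + (h + 2 * r)) + (2 * n + 20)) ≡ (1710 * h + 1260 * r) + (126 * n + 1260)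
    lem₂ = solve-∀
    lem₃ : ∀ h r → (1710 * h + 1260 * r) + (84 * (h + r) + 420 * r) + (26 * h + 56 * r) ≡ 70 * (26 * (h + r))
    lem₃ = solve-∀

  -- An edge of `H₀` costs 12/7 + 9/8, any other edge 9/4.
  budget-meet : 8 * d ≤ 9 * (h + 2 * r) → 9 * (b + d) ≤ 26 * m
  budget-meet hd = *-cancelˡ-≤ 56 (≤-trans (≤-reflexive (lem₁ b d)) (≤-trans (+-mono-≤ (*-monoʳ-≤ 72 hb) (*-monoʳ-≤ 63 hd))
      (≤-trans (m≤m+n _ (25 * h + 322 * r)) (≤-reflexive (trans (lem₂ h r) (cong (λ m → 56 * (26 * m)) hr))))))
    where
    lem₁ : ∀ b d → 56 * (9 * (b + d)) ≡ 72 * (7 * b) + 63 * (8 * d)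
    lem₁ = solve-∀
    lem₂ : ∀ h r → 72 * (12 * h) + 63 * (9 * (h + 2 * r)) + (25 * h + 322 * r) ≡ 56 * (26 * (h + r))
    lem₂ = solve-∀

-- From circuits through `N` to a circuit cover

module Assembly (G : Graph) (σ : Fin (Graph.m G) → Sign) (cubic : Cubic G) (tec : TwoEdgeConnected G) where
  open Signature G σ cubic tec public

  Goal : Set
  Goal = Σ (List (EdgeSet m)) λ 𝓒 → IsCircuitCover G σ 𝓒 × 9 * coverLength G σ 𝓒 ≤ 26 * m

  Hit : List (EdgeSet m) → Fin m → Set
  Hit Cs e = Any (λ C → C e ≡ true) Cs

  total-++ : ∀ as bs → total (as ++ bs) ≡ total as + total bs
  total-++ as bs = trans (cong sum (map-++ # as bs)) (sum-++ (map # as) (map # bs))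

  circuits : ∀ {Cs} → All (Signed false) Cs → All (IsCircuit G σ) Cs
  circuits [] = []
  circuits (sc ∷ scs) = inj₁ (positiveCycle sc) ∷ circuits scs

  bell-circuits : ∀ {Bs} → All Bell Bs → All (IsCircuit G σ) Bs
  bell-circuits [] = []
  bell-circuits (b ∷ bs) = Bell.circuit b ∷ bell-circuits bs

  -- A negative cycle would contain an edge of `N`, so every cycle of `S` is a circuit.
  positive-parts : ∀ {S} → Even S → S ⊑ H → ∃ λ Cs → All (IsCircuit G σ) Cs × (∀ e → S e ≡ true → Hit Cs e) × total Cs ≡ # S
  positive-parts {S} ev sub = go (parts S ev)
    where
    go : Parts S → ∃ λ Cs → All (IsCircuit G σ) Cs × (∀ e → S e ≡ true → Hit Cs e) × total Cs ≡ # S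
    go p = pos , circuits pos-ok , (λ e h → [ id , (λ a → ⊥-elim (no-negs negs-ok negs⊑ a)) ]′ (cover e h)) ,
           trans (sym (+-identityʳ (total pos))) (trans (cong (λ z → total pos + z) (sym (no-size negs-ok negs⊑))) size-eq)
      where
      open Parts p
      absurd : ∀ {C} → Signed true C → C ⊑ S → ⊥
      absurd sc C⊑ = true≢false (parity sc) (par-H (even (cyc sc)) (λ e q → sub e (C⊑ e q)))
      no-negs : ∀ {Cs e} → All (Signed true) Cs → All (_⊑ S) Cs → Hit Cs e → ⊥
      no-negs (sc ∷ _) (q ∷ _) (here _) = absurd sc q
      no-negs (_ ∷ scs) (_ ∷ qs) (there a) = no-negs scs qs a
      no-size : ∀ {Cs} → All (Signed true) Cs → All (_⊑ S) Cs → total Cs ≡ 0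
      no-size [] [] = refl
      no-size (sc ∷ _) (q ∷ _) = ⊥-elim (absurd sc q)

  abstract
    base : ∃ λ Cs → All (IsCircuit G σ) Cs × (∀ e → H₀ e ≡ true → Hit Cs e) × 7 * total Cs ≤ 12 * h
    base =
      let open ShortFlow flow
          c₁ , o₁ , k₁ , t₁ = positive-parts even₁ (λ e q → H₀⊑H e (C₁⊑ e q))
          c₂ , o₂ , k₂ , t₂ = positive-parts even₂ (λ e q → H₀⊑H e (C₂⊑ e q))
          c₃ , o₃ , k₃ , t₃ = positive-parts even₃ (λ e q → H₀⊑H e (C₃⊑ e q))
      in c₁ ++ (c₂ ++ c₃) , ++⁺ o₁ (++⁺ o₂ o₃) ,
         (λ e q → [ (λ a → ++⁺ˡ (k₁ e a)) , (λ a → ++⁺ʳ c₁ ([ (λ b → ++⁺ˡ (k₂ e b)) , (λ b → ++⁺ʳ c₂ (k₃ e b)) ]′ (∨-true {C₂ e} a))) ]′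
            (∨-true {C₁ e} (covered e q))) ,
         ≤-trans (*-monoʳ-≤ 7 (≤-reflexive (trans (total-++ c₁ (c₂ ++ c₃)) (cong₂ _+_ t₁ (trans (total-++ c₂ c₃) (cong₂ _+_ t₂ t₃)))))) short

  b : ℕ
  b = total (proj₁ base)

  -- Every edge outside H₀ lies in N or forms a 2-edge cut with an edge of N, and even sets meet
  -- such cuts evenly; hence it suffices to cover even sets through the edges of N.
  Reaches : List (EdgeSet m) → Fin m → Set
  Reaches Ds e = ∃ λ K → Even K × K e ≡ true × (∀ f → K f ≡ true → Hit Ds f)

  assemble : ∀ Ds → All (IsCircuit G σ) Ds → (∀ e → N e ≡ true → Reaches Ds e) → 9 * (b + total Ds) ≤ 26 * m → Goal
  assemble Ds ok reaches le = proj₁ base ++ Ds , (++⁺ (proj₁ (proj₂ base)) ok , cov) ,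
      ≤-trans (*-monoʳ-≤ 9 (≤-reflexive (total-++ (proj₁ base) Ds))) le
    where
    cov : ∀ e → Hit (proj₁ base ++ Ds) e
    cov e = go (bool-split (H₀ e)) (bool-split (N e))
      where
      go : H₀ e ≡ true ⊎ H₀ e ≡ false → N e ≡ true ⊎ N e ≡ false → Hit (proj₁ base ++ Ds) e
      go (inj₁ p) _ = ++⁺ˡ (proj₁ (proj₂ (proj₂ base)) e p)
      go (inj₂ _) (inj₁ q) = let K , _ , Ke , hit = reaches e q in ++⁺ʳ (proj₁ base) (hit e Ke)
      go (inj₂ p) (inj₂ q) =
        let e′ , Ne′ , same = partner e (cong not q) p
            K , ev , Ke , hit = reaches e′ Ne′
        in ++⁺ʳ (proj₁ base) (hit e (trans (same K ev) Ke))

  hb : 7 * b ≤ 12 * h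
  hb = proj₂ (proj₂ (proj₂ base))

-- An even number of negative cycles, or at least three

module Cases (G : Graph) (σ : Fin (Graph.m G) → Sign) (cubic : Cubic G) (tec : TwoEdgeConnected G)
             (adm : FlowAdmissible G σ) where
  open Assembly G σ cubic tec public

  point : ∀ {C} → Signed true C → ∃ λ v → vert C v ≡ true
  point {C} sc = let e , Ce = proj₁ (cycle (cyc sc)) in s e , vert-s C e Ce

  open Roots point

  #vert : ∀ {C} → Signed true C → # (vert C) ≡ # C
  #vert sc = vert-size (even (cyc sc))

  NearBell : EdgeSet m → EdgeSet m → Set
  NearBell A B = ∃ λ D → Bell D × A ⊑ D × B ⊑ D × ∃ λ k → # D ≤ # A + (# B + k) × 2 * k + (# A + # B) ≤ n + 2

  near-bell : ∀ {A B} → Signed true A → Signed true B → VDisj A B → NearBell A B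
  near-bell {A} {B} sa sb dis =
    let u , v , u∈ , v∈ , S , j , le = near (vert A) (vert B) (proj₂ (point sa)) (proj₂ (point sb)) dis
        D , bell , A⊑ , B⊑ , sz = join-bell sa sb dis u∈ v∈ j
    in D , bell , A⊑ , B⊑ , # S , sz , ≤-trans (≤-reflexive (cong₂ (λ a b → 2 * # S + (a + b)) (sym (#vert sa)) (sym (#vert sb)))) le

  pair-size : ∀ {A B} → Signed true A → Signed true B → VDisj A B → # A + # B ≤ n
  pair-size {A} {B} sa sb dis = ≤-trans (≤-reflexive (trans (cong₂ _+_ (sym (#vert sa)) (sym (#vert sb)))
      (sym (#-⊔-disj (vert A) (vert B) (λ v → go (vert A v) (vert B v) (dis v)))))) (#≤k _)
    where
    go : ∀ a b → (a ≡ true → b ≡ false) → a ∧ b ≡ false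
    go true b h = h refl
    go false b h = refl

  near-size : ∀ a b k x n → x ≤ a + (b + k) → 2 * k + (a + b) ≤ n + 2 → a + b ≤ n → 2 * x ≤ 2 * n + 2
  near-size a b k x n hx hk hab = ≤-trans (*-monoʳ-≤ 2 hx) (≤-trans (≤-reflexive (lem a b k))
      (≤-trans (+-mono-≤ hk hab) (≤-reflexive (lem₂ n))))
    where
    lem : ∀ a b k → 2 * (a + (b + k)) ≡ (2 * k + (a + b)) + (a + b)
    lem = solve-∀
    lem₂ : ∀ n → (n + 2) + n ≡ 2 * n + 2
    lem₂ = solve-∀

  odd-≥3 : ∀ k → odd? k ≡ true → ¬ k ≡ 1 → 3 ≤ k
  odd-≥3 0 () _
  odd-≥3 1 _ h = ⊥-elim (h refl)
  odd-≥3 2 () _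
  odd-≥3 (suc (suc (suc k))) _ _ = s≤s (s≤s (s≤s z≤n))

  -- Here flow-admissibility enters: the flow would vanish on the only edge of `N`.
  #N≢1 : ¬ # N ≡ 1
  #N≢1 q = let e , Ne = #-∃ N (λ z → 0≢1+n (trans (sym z) q)) in
    nz e (Flows.one-negative G σ τ f isFlow A e (trans (sym (eq e)) Ne) (λ g Ng → unique e g Ne (trans (eq g) Ng)))
    where
    τ = proj₁ adm
    f = proj₁ (proj₂ adm)
    isFlow = proj₁ (proj₂ (proj₂ adm))
    nz = proj₂ (proj₂ (proj₂ adm))
    A = proj₁ (proj₁ (proj₂ least-signature))
    eq = proj₂ (proj₁ (proj₂ least-signature))
    unique : ∀ e g → N e ≡ true → N g ≡ true → e ≡ g
    unique e g Ne Ng with e ≟ g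
    ... | yes p = p
    ... | no p = ⊥-elim (<⇒≱ (s≤s (#-pos (N ⊖ (e ==_)) g (∧-intro Ng (cong not (==-≢ p)))))
                   (≤-trans (≤-reflexive (sym (#-remove N e Ne))) (≤-reflexive q)))

  par-on-N : ∀ {W F} → Even W → F ⊑ N → (∀ e → N e ≡ true → W e ≡ F e) → par W ≡ ⨁ F
  par-on-N {W} {F} ev F⊑N on = trans (par-N ev) (⨁-cong (λ e → go e (bool-split (N e))))
    where
    go : ∀ e → N e ≡ true ⊎ N e ≡ false → W e ∧ N e ≡ F e
    go e (inj₁ p) = trans (cong₂ _∧_ (on e p) p) (∧-identityʳ (F e))
    go e (inj₂ p) = trans (trans (cong (W e ∧_) p) (∧-zeroʳ (W e))) (sym (≢true (λ q → true≢false (F⊑N e q) p)))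

  neg-meets-N : ∀ {C} → Signed true C → ∃ λ e → N e ≡ true × C e ≡ true
  neg-meets-N {C} sc = let e , q = ⨁-∃ (C ⊓ N) (trans (sym (par-N (even (cyc sc)))) (parity sc)) in
    e , proj₂ (∧-true {C e} q) , proj₁ (∧-true {C e} q)

  double-≤ : ∀ p q x j u v → p + q ≡ x → 2 * x ≤ u → 2 * j ≤ v → ∀ z → z ≤ q + j → 2 * (p + z) ≤ u + v
  double-≤ p q x j u v refl hx hj z hz = ≤-trans (*-monoʳ-≤ 2 (+-monoʳ-≤ p hz))
      (≤-trans (≤-reflexive (lem p q j)) (+-mono-≤ hx hj))
    where
    lem : ∀ p q j → 2 * (p + (q + j)) ≡ 2 * (p + q) + 2 * j
    lem = solve-∀

  module Whole (W : EdgeSet m) (evW : Even W) (onN : ∀ e → N e ≡ true → W e ≡ true) (szW : 2 * # W ≤ h + 2 * r)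
               (p : Parts W) where
    open Parts p

    reaches : ∀ {Ds} → (∀ f → Hit pos f ⊎ Hit negs f → Hit Ds f) → ∀ e → N e ≡ true → Reaches Ds e
    reaches hit e Ne = W , evW , onN e Ne , λ f Wf → hit f (cover f Wf)

    even-goal : odd? (length negs) ≡ false → Goal
    even-goal ev =
      let xs = roots negs-ok
          J , ∂J , szJ = average-join xs (trans (cong odd? (length-roots negs-ok)) ev)
          mkPairing bells ok covers sz _ = pairing xs J (roots-ok negs-ok) (roots-disj negs-ok negs-disj) ∂J
      in assemble (pos ++ bells) (++⁺ (circuits pos-ok) (bell-circuits ok))
           (reaches (λ f → [ ++⁺ˡ , (λ a → ++⁺ʳ pos (covers f (roots-Any negs-ok a))) ]′))
           (budget-even b (total (pos ++ bells)) h r n m h+r 2m≡3n hb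
             (≤-trans (≤-reflexive (cong (2 *_) (total-++ pos bells)))
               (double-≤ (total pos) (total negs) (# W) (# J) (h + 2 * r) (h + 2 * r) size-eq szW szJ (total bells)
                 (≤-trans sz (≤-reflexive (cong (_+ # J) (size-roots negs-ok)))))))

    -- Beyond the cycles themselves the barbells cost a second copy of `A` and two paths. Twice this
    -- surplus, plus b + c, is the sum of the two bounds from `near`.
    three-arith : ∀ a b c k l p x y → x ≤ a + (b + k) → y ≤ a + (c + l) →
                  2 * k + (a + b) ≤ n + 2 → 2 * l + (a + c) ≤ n + 2 → ∀ w → p + (a + (b + (c + 0))) ≡ w → 2 * w ≤ h + 2 * r →
                  2 * (p + (x + (y + 0))) ≤ (h + 2 * r) + (2 * n + 4)
    three-arith a b c k l p x y hx hy hk hl w refl hw =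
      ≤-trans (*-monoʳ-≤ 2 (+-monoʳ-≤ p (+-mono-≤ hx (+-monoˡ-≤ 0 hy))))
        (≤-trans (≤-trans (m≤m+n _ (b + c)) (≤-reflexive (lem p a b c k l)))
          (≤-trans (+-mono-≤ hw (+-mono-≤ hk hl)) (≤-reflexive (lem₂ (h + 2 * r) n))))
      where
      lem : ∀ p a b c k l → 2 * (p + ((a + (b + k)) + ((a + (c + l)) + 0))) + (b + c) ≡
            2 * (p + (a + (b + (c + 0)))) + ((2 * k + (a + b)) + (2 * l + (a + c)))
      lem = solve-∀
      lem₂ : ∀ x n → x + ((n + 2) + (n + 2)) ≡ x + (2 * n + 4)
      lem₂ = solve-∀

    -- For three cycles the argument of `five-goal` would give n/3 instead of n/5, and 12/7 + 1 +
    -- 2/9 exceeds 26/9. Instead no averaged join is used: `A` is connected to both other cycles by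
    -- short paths.
    three-goal : 3 ≤ r → ∀ A B C → negs ≡ A ∷ B ∷ C ∷ [] → Goal
    three-goal r≥3 A B C eq = go (subst (All (Signed true)) eq negs-ok) (subst (AllPairs VDisj) eq negs-disj)
      where
      go : All (Signed true) (A ∷ B ∷ C ∷ []) → AllPairs VDisj (A ∷ B ∷ C ∷ []) → Goal
      go (sa ∷ sb ∷ sc ∷ []) ((ab ∷ ac ∷ []) ∷ _) =
        let X , bx , A⊑X , B⊑X , k , hx , hk = near-bell sa sb ab
            Y , by , A⊑Y , C⊑Y , l , hy , hl = near-bell sa sc ac
        in assemble (pos ++ (X ∷ Y ∷ [])) (++⁺ (circuits pos-ok) (bell-circuits (bx ∷ by ∷ [])))
             (reaches (λ f → [ ++⁺ˡ , (λ a → ++⁺ʳ pos (hit X Y A⊑X B⊑X C⊑Y f (subst (λ Cs → Hit Cs f) eq a))) ]′))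
             (budget-paths b (total (pos ++ (X ∷ Y ∷ []))) h r n m h+r 2m≡3n hb r≥3
               (≤-trans (≤-reflexive (cong (2 *_) (total-++ pos (X ∷ Y ∷ []))))
                 (three-arith (# A) (# B) (# C) k l (total pos) (# X) (# Y) hx hy hk hl (# W)
                   (trans (cong (λ Cs → total pos + total Cs) (sym eq)) size-eq) szW)))
        where
        hit : ∀ X Y → A ⊑ X → B ⊑ X → C ⊑ Y → ∀ f → Hit (A ∷ B ∷ C ∷ []) f → Hit (X ∷ Y ∷ []) f
        hit X Y α β γ f (here q) = here (α f q)
        hit X Y α β γ f (there (here q)) = here (β f q)
        hit X Y α β γ f (there (there (here q))) = there (here (γ f q))

    five-arith : ∀ p a ys j d z c w → p + (a + ys) ≡ w → 2 * w ≤ h + 2 * r → 2 * j ≤ h + 2 * r → d ≤ a + c → z ≤ ys + j →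
                 5 * c ≤ n + 10 → 10 * (p + (d + z)) ≤ 5 * ((h + 2 * r) + (h + 2 * r)) + (2 * n + 20)
    five-arith p a ys j d z c w refl hw hj hd hz hc = ≤-trans (*-monoʳ-≤ 10 (+-monoʳ-≤ p (+-mono-≤ hd hz)))
        (≤-trans (≤-reflexive (lem p a ys j c)) (≤-trans (+-mono-≤ (*-monoʳ-≤ 5 (+-mono-≤ hw hj)) (*-monoʳ-≤ 2 hc)) (≤-reflexive (lem₂ (5 * ((h + 2 * r) + (h + 2 * r))) n))))
      where
      lem : ∀ p a ys j c → 10 * (p + ((a + c) + (ys + j))) ≡ 5 * (2 * (p + (a + ys)) + 2 * j) + 2 * (5 * c)
      lem = solve-∀
      lem₂ : ∀ x n → x + 2 * (n + 10) ≡ x + (2 * n + 20)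
      lem₂ = solve-∀

    pick-at : (xs : List Rooted) (i : Fin (length xs)) → ∃ λ ys → Pick xs (lookup xs i) ys
    pick-at (x ∷ xs) zero = xs , first
    pick-at (x ∷ xs) (suc i) = let ys , q = pick-at xs i in x ∷ ys , later q

    lookup-All : ∀ {P : Rooted → Set} {xs} → All P xs → ∀ i → P (lookup xs i)
    lookup-All (q ∷ _) zero = q
    lookup-All (_ ∷ qs) (suc i) = lookup-All qs i

    lookup-disj : ∀ {xs} → AllPairs RDisj xs → ∀ i j → ¬ i ≡ j → RDisj (lookup xs i) (lookup xs j)
    lookup-disj (_ ∷ _) zero zero ne = ⊥-elim (ne refl)
    lookup-disj (q ∷ _) zero (suc j) _ = lookup-All q j
    lookup-disj {x ∷ xs} (q ∷ _) (suc i) zero _ = VDisj-sym {proj₁ x} {proj₁ (lookup xs i)} (lookup-All q i)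
    lookup-disj (_ ∷ qs) (suc i) (suc j) ne = lookup-disj qs i j (λ e → ne (cong suc e))

    -- The cycle `Ci` is covered by a barbell with `Cj`, and all the others, including `Cj` once
    -- more, are paired along an averaged join. The surplus is |Cj| plus the path, at most `suc ℓ`.
    five-goal : 3 ≤ r → odd? (length negs) ≡ true → 5 ≤ length negs → Goal
    five-goal r≥3 odd five = go (lopsided A pt dis ℓ big 2≤k)
      where
      xs = roots negs-ok
      oks = roots-ok negs-ok
      djs = roots-disj negs-ok negs-disj
      k = length xs
      5≤k : 5 ≤ k
      5≤k = ≤-trans five (≤-reflexive (sym (length-roots negs-ok)))
      2≤k : 2 ≤ k
      2≤k = ≤-trans (s≤s (s≤s z≤n)) 5≤k
      A : Fin k → Fin n → Bool
      A i = vert (proj₁ (lookup xs i))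
      pt : ∀ i → ∃ λ x → A i x ≡ true
      pt i = proj₂ (lookup xs i) , proj₂ (lookup-All oks i)
      dis : ∀ i j → ¬ i ≡ j → ∀ v → A i v ≡ true → A j v ≡ false
      dis i j ne = lookup-disj djs i j ne
      -- The least value with 5ℓ > n; this makes the surplus at most n/5 + 2.
      ℓ = suc (n / 5)
      big : n < k * ℓ
      big = ≤-trans (s≤s (≤-trans (≤-reflexive (m≡m%n+[m/n]*n n 5)) (+-monoˡ-≤ (n / 5 * 5) (s≤s⁻¹ (m%n<n n 5)))))
              (≤-trans (≤-reflexive (lem (n / 5))) (*-monoˡ-≤ ℓ 5≤k))
        where
        lem : ∀ q → suc (4 + q * 5) ≡ 5 * suc q
        lem = solve-∀
      five-ℓ : 5 * suc ℓ ≤ n + 10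
      five-ℓ = ≤-trans (≤-reflexive (lem (n / 5))) (+-monoˡ-≤ 10 (m/n*n≤m n 5))
        where
        lem : ∀ q → 5 * suc (suc q) ≡ q * 5 + 10
        lem = solve-∀
      go : Lopsided A pt dis ℓ big → Goal
      go (i , j , i≢j , u , v , u∈ , v∈ , S , jS , light) =
        let ys , q = pick-at xs i
            Ci = proj₁ (lookup xs i)
            Cj = proj₁ (lookup xs j)
            sci = proj₁ (lookup-All oks i)
            scj = proj₁ (lookup-All oks j)
            D , bell , Ci⊑ , _ , szD = join-bell sci scj (lookup-disj djs i j i≢j) u∈ v∈ jS
            J , ∂J , szJ = average-join ys (not-true {odd? (length ys)} (trans (cong odd? (trans (sym (length-pick q)) (length-roots negs-ok))) odd))
            mkPairing bells ok covers sz _ = pairing ys J (proj₂ (All-pick q oks)) (proj₂ (Disj-pick q djs)) ∂J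
        in assemble (pos ++ (D ∷ bells)) (++⁺ (circuits pos-ok) (bell-circuits (bell ∷ ok)))
             (reaches (λ f → [ ++⁺ˡ , (λ a → ++⁺ʳ pos ([ (λ c → here (Ci⊑ f c)) , (λ a′ → there (covers f a′)) ]′ (Any-pick q (roots-Any negs-ok a)))) ]′))
             (budget-close b (total (pos ++ (D ∷ bells))) h r n m h+r 2m≡3n hb r≥3
               (≤-trans (≤-reflexive (cong (10 *_) (total-++ pos (D ∷ bells))))
                 (five-arith (total pos) (# Ci) (size-of ys) (# J) (# D) (total bells) (suc ℓ) (# W)
                   (trans (cong (total pos +_) (trans (sym (size-pick q)) (size-roots negs-ok))) size-eq) szW szJ
                   (≤-trans szD (+-monoʳ-≤ (# Ci) (≤-trans (≤-reflexive (cong (_+ # S) (sym (#vert scj)))) light))) sz five-ℓ)))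

-- A single negative cycle

module Conclusion (G : Graph) (σ : Fin (Graph.m G) → Sign) (cubic : Cubic G) (tec : TwoEdgeConnected G)
                  (adm : FlowAdmissible G σ) where
  open Cases G σ cubic tec adm

  -- A circuit that takes care of one edge `e₀` of `N`. The even set `K` is kept because `D` may be
  -- a barbell, whose path need not be even.
  record Seed (D : EdgeSet m) : Set where
    constructor mkSeed
    field
      circuit : IsCircuit G σ D
      K : EdgeSet m
      K-even : Even K
      K⊑D : K ⊑ D
      e₀ : Fin m
      e₀∈N : N e₀ ≡ true
      e₀∈K : K e₀ ≡ true

  bell-seed : ∀ {D} → Bell D → Seed D
  bell-seed bell = let e , Ne , Ce = neg-meets-N odd-ok in mkSeed circuit heart heart-even heart⊑ e Ne (odd⊑ e Ce)
    where open Bell bell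

  find-part : ∀ {Cs e} → All (Signed false) Cs → Hit Cs e → ∃ λ C → Signed false C × C e ≡ true
  find-part (sc ∷ _) (here q) = _ , sc , q
  find-part (_ ∷ scs) (there a) = find-part scs a

  -- An even set meeting `N` in exactly two edges has an even number of negative cycles. If there
  -- are none, its cycle through `e₀` is positive; otherwise two of them form a short barbell, which
  -- contains an edge of `N` of its own.
  initial-seed : 3 ≤ # N → ∃ λ D → Seed D × 2 * # D ≤ 2 * n + 2
  initial-seed three = start (two-elements N (≤-trans (s≤s (s≤s z≤n)) three))
    where
    start : (∃ λ i → ∃ λ j → ¬ i ≡ j × N i ≡ true × N j ≡ true) → ∃ λ D → Seed D × 2 * # D ≤ 2 * n + 2
    start (e₀ , e₁ , ne , N₀ , N₁) = go (represent F F⊑N)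
      where
      F : EdgeSet m
      F f = (e₀ == f) ∨ (e₁ == f)
      F⊑N : F ⊑ N
      F⊑N f q = [ (λ p → subst (λ x → N x ≡ true) (==-≡ p) N₀) , (λ p → subst (λ x → N x ≡ true) (==-≡ p) N₁) ]′ (∨-true {e₀ == f} q)
      F₀ : F e₀ ≡ true
      F₀ = ∨-introˡ (==-refl e₀)
      F₁ : F e₁ ≡ true
      F₁ = ∨-introʳ {e₀ == e₁} (==-refl e₁)
      ⨁F : ⨁ F ≡ false
      ⨁F = trans (⨁-pair F e₀ e₁ ne (λ l q → [ (λ p → inj₁ (sym (==-≡ p))) , (λ p → inj₂ (sym (==-≡ p))) ]′ (∨-true {e₀ == l} q))) (cong₂ _xor_ F₀ F₁)
      go : (∃ λ W → Even W × (∀ f → N f ≡ true → W f ≡ F f) × 2 * # W ≤ h + 2 * r) → ∃ λ D → Seed D × 2 * # D ≤ 2 * n + 2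
      go (W , ev , on , _) = split (parts W ev)
        where
        split : Parts W → ∃ λ D → Seed D × 2 * # D ≤ 2 * n + 2
        split p = cases negs negs-ok negs-disj (trans par-eq (trans (par-on-N ev F⊑N on) ⨁F)) (cover e₀ (trans (on e₀ N₀) F₀))
          where
          open Parts p
          cases : ∀ Cs → All (Signed true) Cs → AllPairs VDisj Cs → odd? (length Cs) ≡ false → Hit pos e₀ ⊎ Hit Cs e₀ →
                  ∃ λ D → Seed D × 2 * # D ≤ 2 * n + 2
          cases [] _ _ _ (inj₁ a) = let C , sc , Ce = find-part pos-ok a in
            C , mkSeed (inj₁ (positiveCycle sc)) C (even (cyc sc)) (λ _ q → q) e₀ N₀ Ce ,
            ≤-trans (*-monoʳ-≤ 2 (Even≤n (even (cyc sc)))) (m≤m+n (2 * n) 2)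
          cases (A ∷ B ∷ _) (sa ∷ sb ∷ _) ((ab ∷ _) ∷ _) _ _ =
            let X , bell , _ , _ , k , hx , hk = near-bell sa sb ab
            in X , bell-seed bell , near-size (# A) (# B) k (# X) n hx hk (pair-size sa sb ab)

  one-arith : ∀ p q w d → p + q ≡ w → 2 * w ≤ h + 2 * r → 2 * d ≤ 2 * n + 2 → 2 * (p + (d + 0)) ≤ (h + 2 * r) + (2 * n + 4)
  one-arith p q w d refl hw hd = ≤-trans (≤-trans (m≤m+n _ (2 * q)) (≤-reflexive (lem p q d)))
      (+-mono-≤ hw (≤-trans hd (+-monoʳ-≤ (2 * n) (s≤s (s≤s z≤n)))))
    where
    lem : ∀ p q d → 2 * (p + (d + 0)) + 2 * q ≡ 2 * (p + q) + 2 * d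
    lem = solve-∀

  module Central (three : 3 ≤ # N) (⨁N : ⨁ N ≡ true) (C : EdgeSet m) (sc : Signed true C) (szC : 2 * # C ≤ h + 2 * r)
                 (meets : ∀ S → Even S → par S ≡ true → ∃ λ v → vert C v ≡ true × vert S v ≡ true) where

    r≥3 : 3 ≤ r
    r≥3 = ≤-trans three #N≤r

    choose : ∀ {M} → Signed true M → ∃ λ v → vert M v ≡ true
    choose {M} sm = let v , _ , q = meets M (even (cyc sm)) (parity sm) in v , q

    choose-in : ∀ {M} (sm : Signed true M) → vert C (proj₁ (choose sm)) ≡ true
    choose-in {M} sm = proj₁ (proj₂ (meets M (even (cyc sm)) (parity sm)))

    module R = Roots choose

    -- A join inside `C` and its complement in `C` have the same odd vertices, and one of them has
    -- at most half of the edges of `C`.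
    central-join : ∀ xs → odd? (length xs) ≡ false → All (λ y → vert C (proj₂ y) ≡ true) xs →
                   ∃ λ J → (∀ v → ∂ J v ≡ rootsum xs v) × 2 * # J ≤ # C
    central-join xs ev inC = shorter (root-join {C} (vert C) (proj₁ (point sc)) conn xs inC)
      where
      conn : ∀ v → vert C v ≡ true → Conn G C (proj₁ (point sc)) v
      conn v q = proj₂ (proj₂ (cycle (cyc sc))) _ v (vert-∈ {C} (proj₂ (point sc))) (vert-∈ {C} q)
      shorter : (∃ λ J → J ⊑ C × (∀ v → ∂ J v ≡ rootsum xs v xor (odd? (length xs) ∧ (proj₁ (point sc) == v)))) →
                ∃ λ J → (∀ v → ∂ J v ≡ rootsum xs v) × 2 * # J ≤ # C
      shorter (J , J⊑ , hJ) = which (# J ≤? # (C ⊖ J))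
        where
        ∂J′ : ∀ v → ∂ J v ≡ rootsum xs v
        ∂J′ v = trans (hJ v) (trans (cong (λ o → rootsum xs v xor (o ∧ (proj₁ (point sc) == v))) ev) (xor-identityʳ (rootsum xs v)))
        sum≡ : # C ≡ # J + # (C ⊖ J)
        sum≡ = #-⊖ C J J⊑
        double : ∀ a → 2 * a ≡ a + a
        double a = cong (a +_) (+-identityʳ a)
        which : Dec (# J ≤ # (C ⊖ J)) → ∃ λ J → (∀ v → ∂ J v ≡ rootsum xs v) × 2 * # J ≤ # C
        which (yes le) = J , ∂J′ , ≤-trans (≤-reflexive (double (# J))) (≤-trans (+-monoʳ-≤ (# J) le) (≤-reflexive (sym sum≡)))
        which (no gt) = C ⊖ J , (λ v → trans (sym (∂-cong (⊕⊖ J⊑) v)) (trans (∂-⊕ C J v) (trans (cong (_xor ∂ J v) (∂0 (even (cyc sc)) v)) (∂J′ v)))) ,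
          ≤-trans (≤-reflexive (double (# (C ⊖ J)))) (≤-trans (+-monoˡ-≤ (# (C ⊖ J)) (<⇒≤ (≰⇒> gt))) (≤-reflexive (sym sum≡)))

    two-arith : ∀ p a b k d x w → p + (a + (b + 0)) ≡ w → 2 * w ≤ h + 2 * r → d ≤ x → x ≤ a + (b + k) → 2 * k + (a + b) ≤ n + 2 →
                2 * (p + (d + (x + 0))) ≤ (h + 2 * r) + (2 * n + 4)
    two-arith p a b k d x w refl hw hd hx hk = ≤-trans (*-monoʳ-≤ 2 (+-monoʳ-≤ p (+-mono-≤ (≤-trans hd hx) (+-monoˡ-≤ 0 hx))))
        (≤-trans (≤-reflexive (lem p a b k)) (≤-trans (+-mono-≤ hw (*-monoʳ-≤ 2 hk)) (≤-reflexive (lem₂ (h + 2 * r) n))))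
      where
      lem : ∀ p a b k → 2 * (p + ((a + (b + k)) + ((a + (b + k)) + 0))) ≡ 2 * (p + (a + (b + 0))) + 2 * (2 * k + (a + b))
      lem = solve-∀
      lem₂ : ∀ x n → x + 2 * (n + 2) ≡ x + (2 * n + 4)
      lem₂ = solve-∀

    -- Put x = h + 2r. Then p + q ≤ x/2 and j ≤ c/2 ≤ x/4, so p + d + z ≤ p + (3/2)(q + j) ≤
    -- (3/2)(x/2) + (3/2)(x/4) = 9x/8.
    four-arith : ∀ p q w j c d z → p + q ≡ w → 2 * w ≤ h + 2 * r → 2 * j ≤ c → 2 * c ≤ h + 2 * r → z ≤ q + j → 2 * d ≤ z →
                 8 * (p + (d + z)) ≤ 9 * (h + 2 * r)
    four-arith p q w j c d z refl hw hj hc hz hd =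
      ≤-trans (≤-reflexive (lem p d z)) (≤-trans (+-monoʳ-≤ (8 * p) (+-monoˡ-≤ (8 * z) (*-monoʳ-≤ 4 hd)))
      (≤-trans (≤-trans (≤-reflexive (lem₂ p z)) (+-monoʳ-≤ (8 * p) (*-monoʳ-≤ 12 hz)))
      (≤-trans (≤-trans (m≤m+n _ (4 * p)) (≤-reflexive (lem₃ p q j)))
      (≤-trans (+-mono-≤ (*-monoʳ-≤ 6 hw) (*-monoʳ-≤ 6 hj))
      (≤-trans (+-monoʳ-≤ (6 * (h + 2 * r)) (≤-trans (≤-reflexive (lem₄ c)) (*-monoʳ-≤ 3 hc))) (≤-reflexive (lem₅ (h + 2 * r))))))))
      where
      lem : ∀ p d z → 8 * (p + (d + z)) ≡ 8 * p + (4 * (2 * d) + 8 * z)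
      lem = solve-∀
      lem₂ : ∀ p z → 8 * p + (4 * z + 8 * z) ≡ 8 * p + 12 * z
      lem₂ = solve-∀
      lem₃ : ∀ p q j → (8 * p + 12 * (q + j)) + 4 * p ≡ 6 * (2 * (p + q)) + 6 * (2 * j)
      lem₃ = solve-∀
      lem₄ : ∀ c → 6 * c ≡ 3 * (2 * c)
      lem₄ = solve-∀
      lem₅ : ∀ x → 6 * x + 3 * x ≡ 9 * x
      lem₅ = solve-∀

    -- As |N| is odd, the trace `N` without `e₀` gives an even number of negative cycles, and `D` is
    -- added for `e₀`. The budget needs `D` to be no longer than a barbell at hand. If it is longer,
    -- that barbell becomes the new seed, with a new `e₀`; this stops because seeds get shorter.
    seed-goal : ∀ k D → Seed D → # D ≤ k → 2 * # D ≤ 2 * n + 2 → Goal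
    seed-goal k D seed D≤k szD = start (represent F (λ e q → proj₁ (∧-true q)))
      where
      open Seed seed
      F : EdgeSet m
      F = N ⊖ (e₀ ==_)
      ⨁F : ⨁ F ≡ false
      ⨁F = trans (sym (odd?-# F)) (not-true (trans (cong odd? (sym (#-remove N e₀ e₀∈N))) (trans (odd?-# N) ⨁N)))

      restart : ∀ k X → # X < # D → # D ≤ k → Bell X → 2 * # X ≤ 2 * n + 2 → Goal
      restart zero X lt le bell sz = ⊥-elim (n≮0 (≤-trans lt le))
      restart (suc k) X lt le bell sz = seed-goal k X (bell-seed bell) (s≤s⁻¹ (≤-trans lt le)) sz

      start : (∃ λ W → Even W × (∀ f → N f ≡ true → W f ≡ F f) × 2 * # W ≤ h + 2 * r) → Goal
      start (W , ev , on , szW) = split (parts W ev)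
        where
        split : Parts W → Goal
        split p = cases negs refl negs-ok negs-disj (trans par-eq (trans (par-on-N ev (λ e q → proj₁ (∧-true q)) on) ⨁F))
          where
          open Parts p
          reach-all : ∀ Ds → (∀ f → Hit pos f ⊎ Hit negs f → Hit (pos ++ (D ∷ Ds)) f) → ∀ e → N e ≡ true → Reaches (pos ++ (D ∷ Ds)) e
          reach-all Ds hit e Ne = go (e₀ ≟ e)
            where
            go : Dec (e₀ ≡ e) → Reaches (pos ++ (D ∷ Ds)) e
            go (yes q) = K , K-even , subst (λ x → K x ≡ true) q e₀∈K , λ f Kf → ++⁺ʳ pos (here (K⊑D f Kf))
            go (no q) = W , ev , trans (on e Ne) (∧-intro Ne (cong not (==-≢ q))) , λ f Wf → hit f (cover f Wf)
          cases : ∀ Cs → negs ≡ Cs → All (Signed true) Cs → AllPairs VDisj Cs → odd? (length Cs) ≡ false → Goal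
          cases [] eq _ _ _ = assemble (pos ++ (D ∷ [])) (++⁺ (circuits pos-ok) (circuit ∷ []))
            (reach-all [] (λ f → [ ++⁺ˡ , (λ a → ⊥-elim (no-hit (subst (λ Cs → Hit Cs f) eq a))) ]′))
            (budget-paths b (total (pos ++ (D ∷ []))) h r n m h+r 2m≡3n hb r≥3
              (≤-trans (≤-reflexive (cong (2 *_) (total-++ pos (D ∷ []))))
                (one-arith (total pos) (total negs) (# W) (# D) size-eq szW szD)))
            where
            no-hit : ∀ {f} → Hit [] f → ⊥
            no-hit ()
          -- There is only one barbell, so `D` can be as long as the whole pairing rather than half
          -- of it. Hence the two cycles are joined by a shortest path bound instead of along `C`.
          cases (A ∷ B ∷ []) eq (sa ∷ sb ∷ []) ((ab ∷ []) ∷ _) _ = decide (near-bell sa sb ab)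
            where
            decide : NearBell A B → Goal
            decide (X , bell , A⊑ , B⊑ , l , hx , hl) = cmp (# D ≤? # X)
              where
              hit : ∀ f → Hit (A ∷ B ∷ []) f → Hit (D ∷ X ∷ []) f
              hit f (here q) = there (here (A⊑ f q))
              hit f (there (here q)) = there (here (B⊑ f q))
              cmp : Dec (# D ≤ # X) → Goal
              cmp (no gt) = restart k X (≰⇒> gt) D≤k bell (near-size (# A) (# B) l (# X) n hx hl (pair-size sa sb ab))
              cmp (yes le) = assemble (pos ++ (D ∷ X ∷ [])) (++⁺ (circuits pos-ok) (circuit ∷ Bell.circuit bell ∷ []))
                (reach-all (X ∷ []) (λ f → [ ++⁺ˡ , (λ a → ++⁺ʳ pos (hit f (subst (λ Cs → Hit Cs f) eq a))) ]′))
                (budget-paths b (total (pos ++ (D ∷ X ∷ []))) h r n m h+r 2m≡3n hb r≥3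
                  (≤-trans (≤-reflexive (cong (2 *_) (total-++ pos (D ∷ X ∷ []))))
                    (two-arith (total pos) (# A) (# B) l (# D) (# X) (# W)
                      (trans (cong (λ Cs → total pos + total Cs) (sym eq)) size-eq) szW le hx hl)))
          cases (A₁ ∷ A₂ ∷ A₃ ∷ A₄ ∷ As) eq scs dis ev′ = joined (central-join xs (trans (cong odd? (R.length-roots scs)) ev′) (R.roots-in choose-in scs))
            where
            xs = R.roots scs
            joined : (∃ λ J → (∀ v → ∂ J v ≡ rootsum xs v) × 2 * # J ≤ # C) → Goal
            joined (J , ∂J , szJ) = paired (pairing xs J (R.roots-ok scs) (R.roots-disj scs dis) ∂J)
              where
              finish : ∀ bells → All Bell bells → (∀ e → Any (λ x → proj₁ x e ≡ true) xs → Hit bells e) → total bells ≤ size-of xs + # J →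
                       ∀ X → Bell X → 2 * # X ≤ total bells → Goal
              finish bells ok covers sz X bell hX = cmp (# D ≤? # X)
                where
                cmp : Dec (# D ≤ # X) → Goal
                cmp (no gt) = restart k X (≰⇒> gt) D≤k bell (≤-trans (*-monoʳ-≤ 2 (<⇒≤ (≰⇒> gt))) szD)
                cmp (yes le) = assemble (pos ++ (D ∷ bells)) (++⁺ (circuits pos-ok) (circuit ∷ bell-circuits ok))
                  (reach-all bells (λ f → [ ++⁺ˡ , (λ a → ++⁺ʳ pos (there (covers f (R.roots-Any scs (subst (λ Cs → Hit Cs f) eq a))))) ]′))
                  (budget-meet b (total (pos ++ (D ∷ bells))) h r n m h+r 2m≡3n hb
                    (≤-trans (≤-reflexive (cong (8 *_) (total-++ pos (D ∷ bells))))
                      (four-arith (total pos) (total negs) (# W) (# J) (# C) (# D) (total bells) size-eq szW szJ szC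
                        (≤-trans sz (≤-reflexive (cong (_+ # J) (trans (R.size-roots scs) (cong total (sym eq))))))
                        (≤-trans (*-monoʳ-≤ 2 le) hX))))
              paired : Pairing xs J → Goal
              -- Four or more cycles give at least two barbells, and the shorter of the first two
              -- has at most half of the total length.
              paired (mkPairing (X ∷ Y ∷ bs) (bx ∷ by ∷ ok) covers sz cnt) = smaller (# X ≤? # Y)
                where
                double : ∀ a → 2 * a ≡ a + a
                double a = cong (a +_) (+-identityʳ a)
                smaller : Dec (# X ≤ # Y) → Goal
                smaller (yes le) = finish (X ∷ Y ∷ bs) (bx ∷ by ∷ ok) covers sz X bx
                  (≤-trans (≤-reflexive (double (# X))) (+-monoʳ-≤ (# X) (≤-trans le (m≤m+n (# Y) (total bs)))))
                smaller (no gt) = finish (X ∷ Y ∷ bs) (bx ∷ by ∷ ok) covers sz Y by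
                  (≤-trans (≤-reflexive (double (# Y))) (+-mono-≤ (<⇒≤ (≰⇒> gt)) (m≤m+n (# Y) (total bs))))
              paired (mkPairing [] [] covers sz cnt) with trans (sym (R.length-roots scs)) cnt
              ... | ()
              paired (mkPairing (X ∷ []) (bx ∷ []) covers sz cnt) with trans (sym (R.length-roots scs)) cnt
              ... | ()

  -- A set `S` of odd parity contains a negative cycle `M`, which avoids `C` as `S` does. The
  -- barbell of `C` and `M` has at most n + 1 edges and replaces `C` in the cover of `W`; `M` serves
  -- only to complete it.
  apart-goal : 3 ≤ r → ∀ W → Even W → (∀ e → N e ≡ true → W e ≡ true) → 2 * # W ≤ h + 2 * r → (p : Parts W) →
               ∀ C → Parts.negs p ≡ C ∷ [] → Signed true C →
               ∀ S → Even S → par S ≡ true → (∀ v → vert C v ≡ true → vert S v ≡ false) → Goal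
  apart-goal r≥3 W ev on szW p C eq sc S evS parS dis = find (parts S evS)
    where
    open Parts p
    find : Parts S → Goal
    find q = cases (Parts.negs q) (Parts.negs-ok q) (Parts.negs⊑ q) (trans (Parts.par-eq q) parS)
      where
      cases : ∀ Cs → All (Signed true) Cs → All (_⊑ S) Cs → odd? (length Cs) ≡ true → Goal
      cases (M ∷ _) (sm ∷ _) (M⊑ ∷ _) _ = build (near-bell sc sm disj)
        where
        disj : VDisj C M
        disj v v∈ = ≢true (λ z → true≢false (vert-mono M⊑ v z) (dis v v∈))
        build : NearBell C M → Goal
        build (X , bell , C⊑ , _ , l , hx , hl) = assemble (pos ++ (X ∷ [])) (++⁺ (circuits pos-ok) (Bell.circuit bell ∷ []))
          (Whole.reaches W ev on szW p (λ f → [ ++⁺ˡ , (λ a → ++⁺ʳ pos (hit f (subst (λ Cs → Hit Cs f) eq a))) ]′))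
          (budget-paths b (total (pos ++ (X ∷ []))) h r n m h+r 2m≡3n hb r≥3
            (≤-trans (≤-reflexive (cong (2 *_) (total-++ pos (X ∷ []))))
              (one-arith (total pos) (total negs) (# W) (# X) size-eq szW (near-size (# C) (# M) l (# X) n hx hl (pair-size sc sm disj)))))
          where
          hit : ∀ f → Hit (C ∷ []) f → Hit (X ∷ []) f
          hit f (here q) = here (C⊑ f q)

  goal : Goal
  goal = start (represent N (λ _ q → q))
    where
    start : (∃ λ W → Even W × (∀ f → N f ≡ true → W f ≡ N f) × 2 * # W ≤ h + 2 * r) → Goal
    start (W , ev , on , szW) = split (parts W ev)
      where
      onN : ∀ e → N e ≡ true → W e ≡ true
      onN e q = trans (on e q) q
      split : Parts W → Goal
      split p = parity? (bool-split (odd? (length negs)))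
        where
        open Parts p
        module P = Whole W ev onN szW p
        parity? : odd? (length negs) ≡ true ⊎ odd? (length negs) ≡ false → Goal
        parity? (inj₂ q) = P.even-goal q
        parity? (inj₁ q) = cases negs refl negs-ok
          where
          ⨁N : ⨁ N ≡ true
          ⨁N = trans (sym (par-on-N ev (λ _ z → z) on)) (trans (sym par-eq) q)
          three : 3 ≤ # N
          three = odd-≥3 (# N) (trans (odd?-# N) ⨁N) #N≢1
          r≥3 : 3 ≤ r
          r≥3 = ≤-trans three #N≤r
          one : ∀ C → negs ≡ C ∷ [] → Signed true C → Goal
          one C eq sc = meets? (anyPred? {P = Away} away-resp dec)
            where
            Away : EdgeSet m → Set
            Away S = Even S × par S ≡ true × (∀ v → vert C v ≡ true → vert S v ≡ false)
            away-resp : Respects≗ Away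
            away-resp {S} {S′} e (a , c , d) = Even-cong e a , trans (sym (par-cong e)) c ,
              λ v z → trans (cong (λ k → not (k ≡ᵇ 0)) (sym (dg-cong e v))) (d v z)
            dec : ∀ S → Dec (Away S)
            dec S = even? S ×-dec ((par S ≟ᵇ true) ×-dec
              map′ (λ f v z → not-true (f v z)) (λ f v z → cong not (f v z)) (⊑? (vert C) (∁ (vert S))))
            szC : 2 * # C ≤ h + 2 * r
            szC = ≤-trans (*-monoʳ-≤ 2 (≤-trans (≤-trans (m≤m+n (# C) 0) (m≤n+m (# C + 0) (total pos)))
                    (≤-reflexive (trans (cong (λ Cs → total pos + total Cs) (sym eq)) size-eq)))) szW
            meets? : Dec (∃ Away) → Goal
            meets? (yes (S , evS , parS , dis)) = apart-goal r≥3 W ev onN szW p C eq sc S evS parS dis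
            meets? (no none) = let D , seed , szD = initial-seed three in
              Central.seed-goal three ⨁N C sc szC meets (# D) D seed ≤-refl szD
              where
              meets : ∀ S → Even S → par S ≡ true → ∃ λ v → vert C v ≡ true × vert S v ≡ true
              meets S evS parS with any? (λ v → (vert C v ∧ vert S v) ≟ᵇ true)
              ... | yes (v , z) = v , ∧-true {vert C v} z
              ... | no nope = ⊥-elim (none (S , evS , parS , λ v z → ≢true (λ y → nope (v , ∧-intro z y))))
          cases : ∀ Cs → negs ≡ Cs → All (Signed true) Cs → Goal
          cases [] eq _ = ⊥-elim (true≢false q (cong (λ Cs → odd? (length Cs)) eq))
          cases (C ∷ []) eq (sc ∷ []) = one C eq sc
          cases (_ ∷ _ ∷ []) eq _ = ⊥-elim (true≢false q (cong (λ Cs → odd? (length Cs)) eq))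
          cases (A ∷ B ∷ C ∷ []) eq _ = P.three-goal r≥3 A B C eq
          cases (_ ∷ _ ∷ _ ∷ _ ∷ []) eq _ = ⊥-elim (true≢false q (cong (λ Cs → odd? (length Cs)) eq))
          cases (_ ∷ _ ∷ _ ∷ _ ∷ _ ∷ Cs) eq _ =
            P.five-goal r≥3 q (≤-trans (s≤s (s≤s (s≤s (s≤s (s≤s z≤n))))) (≤-reflexive (sym (cong length eq))))

theorem1p6 : (G : Graph) → (σ : Fin (Graph.m G) → Sign)
    → Cubic G → TwoEdgeConnected G → FlowAdmissible G σ
    → Σ (List (EdgeSet (Graph.m G))) λ 𝓒 →
    IsCircuitCover G σ 𝓒 × 9 * coverLength G σ 𝓒 ≤ 26 * Graph.m G
theorem1p6 G σ cubic tec adm = Conclusion.goal G σ cubic tec adm
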